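{- Let $k,t$ be positive integers and let $n\geq 111t^3k^3$. If $G$ is a connected graph with $n$ vertices and at most $n\left(1+\frac{1}{127t^2k^2+79t^2k}\right)$ edges, then $r(G,tB_k)=2n+t-2$.
   Context: For graphs $G,H$, the Ramsey number $r(G,H)$ is the smallest positive integer $N$ such that every red-blue coloring of the edges of the complete graph $K_N$ contains a red subgraph isomorphic to $G$ or a blue subgraph isomorphic to $H$. The book $B_k$ is the graph $K_2+\overline{K}_k$ on $k+2$ vertices (an edge together with $k$ further vertices each adjacent to both endpoints of the edge), and $tB_k$ denotes the disjoint union of $t$ vertex-disjoint copies of $B_k$. All graphs are finite and simple. -}

module Defs where

open import Data.Nat using (ℕ; zero; suc; _+_; _*_; _∸_; _<_; _<ᵇ_)
open import Data.Bool using (Bool; true; false; _∧_; _∨_; not; if_then_else_)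
open import Data.Bool.Properties using (∨-comm; ∧-zeroʳ)
open import Data.Empty using (⊥-elim)
open import Data.Fin using (Fin; toℕ; remQuot) renaming (zero to fzero; suc to fsuc)
open import Data.Fin.Properties using () renaming (_≟_ to _≟F_)
open import Data.List using (List; map; allFin)
open import Data.Nat.ListAction using (sum)
open import Data.Product using (Σ; _×_; _,_; proj₁; proj₂; ∃)
open import Data.Sum using (_⊎_)
open import Relation.Nullary using (¬_; does; yes; no)
open import Relation.Binary.PropositionalEquality using (_≡_; refl)
import Relation.Binary.PropositionalEquality as P
open import Function.Definitions using (Injective)

record Graph : Set where
  field
    V      : ℕ
    adj    : Fin V → Fin V → Bool
    sym    : ∀ u v → adj u v ≡ adj v u
    irrefl : ∀ v → adj v v ≡ false
open Graph public

∣V∣ : Graph → ℕ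
∣V∣ = V

∣E∣ : Graph → ℕ
∣E∣ G = sum (map (λ u → sum (map (λ v →
          if (toℕ u <ᵇ toℕ v) ∧ adj G u v then 1 else 0) (allFin (V G)))) (allFin (V G)))

data Reach (G : Graph) : Fin (V G) → Fin (V G) → Set where
  here  : ∀ {u} → Reach G u u
  step  : ∀ {u w v} → adj G u w ≡ true → Reach G w v → Reach G u v

Connected : Graph → Set
Connected G = ∀ u v → Reach G u v

-- Book B_k = K_2 + complement(K_k) on vertices Fin (2 + k):
-- vertices 0 and 1 form the spine; every other vertex is adjacent to both.
isSpine : ∀ {m} → Fin m → Bool
isSpine fzero = true
isSpine (fsuc fzero) = true
isSpine _ = false

bookAdj : (k : ℕ) → Fin (2 + k) → Fin (2 + k) → Bool
bookAdj k i j = not (does (i ≟F j)) ∧ (isSpine i ∨ isSpine j)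

tBookAdj : (t k : ℕ) → Fin (t * (2 + k)) → Fin (t * (2 + k)) → Bool
tBookAdj t k x y = pairAdj (remQuot {t} (2 + k) x) (remQuot {t} (2 + k) y)
  where
  pairAdj : Fin t × Fin (2 + k) → Fin t × Fin (2 + k) → Bool
  pairAdj (a , i) (b , j) = does (a ≟F b) ∧ bookAdj k i j


≟-sym : ∀ {m} (a b : Fin m) → does (a ≟F b) ≡ does (b ≟F a)
≟-sym a b with a ≟F b | b ≟F a
... | yes _ | yes _ = refl
... | no _  | no _  = refl
... | yes p | no q  = ⊥-elim (q (P.sym p))
... | no p  | yes q = ⊥-elim (p (P.sym q))

≟-refl : ∀ {m} (a : Fin m) → does (a ≟F a) ≡ true
≟-refl a with a ≟F a
... | yes _ = refl
... | no q  = ⊥-elim (q refl)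

bookAdj-sym : ∀ k i j → bookAdj k i j ≡ bookAdj k j i
bookAdj-sym k i j rewrite ≟-sym i j | ∨-comm (isSpine i) (isSpine j) = refl

bookAdj-irrefl : ∀ k i → bookAdj k i i ≡ false
bookAdj-irrefl k i rewrite ≟-refl i = refl

tBookAdj-sym : ∀ t k x y → tBookAdj t k x y ≡ tBookAdj t k y x
tBookAdj-sym t k x y = go (remQuot {t} (2 + k) x) (remQuot {t} (2 + k) y)
  where
  go : ∀ (p q : Fin t × Fin (2 + k)) →
       does (proj₁ p ≟F proj₁ q) ∧ bookAdj k (proj₂ p) (proj₂ q)
         ≡ does (proj₁ q ≟F proj₁ p) ∧ bookAdj k (proj₂ q) (proj₂ p)
  go (a , i) (b , j) rewrite ≟-sym a b | bookAdj-sym k i j = refl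

tBookAdj-irrefl : ∀ t k x → tBookAdj t k x x ≡ false
tBookAdj-irrefl t k x = go (remQuot {t} (2 + k) x)
  where
  go : ∀ (p : Fin t × Fin (2 + k)) →
       does (proj₁ p ≟F proj₁ p) ∧ bookAdj k (proj₂ p) (proj₂ p) ≡ false
  go (a , i) rewrite bookAdj-irrefl k i = ∧-zeroʳ (does (a ≟F a))

tB : (t k : ℕ) → Graph
tB t k = record { V = t * (2 + k) ; adj = tBookAdj t k
                ; sym = tBookAdj-sym t k ; irrefl = tBookAdj-irrefl t k }

-- A red/blue colouring of the edges of K_N: a symmetric Boolean function
-- (true = red, false = blue); diagonal values are irrelevant.
Colouring : ℕ → Set
Colouring N = Σ (Fin N → Fin N → Bool) (λ c → ∀ i j → c i j ≡ c j i)

HasCopy : ∀ {N} → Colouring N → Bool → Graph → Set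
HasCopy {N} (c , _) b H =
  Σ (Fin (V H) → Fin N) λ f → Injective _≡_ _≡_ f ×
    (∀ u v → adj H u v ≡ true → c (f u) (f v) ≡ b)

Arrows : ℕ → Graph → Graph → Set
Arrows N G H = (c : Colouring N) → HasCopy c true G ⊎ HasCopy c false H

IsRamseyNumber : Graph → Graph → ℕ → Set
IsRamseyNumber G H r = 0 < r × Arrows r G H × (∀ N → 0 < N → N < r → ¬ Arrows N G H)

{-# OPTIONS --safe #-}

-- Let b be the blue graph of a colouring without blue tB_k. Removing disjoint blue books
-- leaves a set V, all but at most (t - 1)(k + 2) vertices, without blue books, in which
-- every blue neighbourhood is a red clique up to k - 1 blue edges at each vertex.
-- A sparse connected graph has a leaf, or a long thread of vertices of degree two, or few
-- vertices, so red copies are built by putting back leaves and thread vertices.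
-- A leaf fits unless the image x of its parent is blue to all free vertices; these then
-- form a near-clique. A thread absorbs a free vertex y unless y is blue to almost all of
-- it; blue edges among the free vertices then span books with pages on the thread.
-- Hence graphs slightly smaller than G always embed in V. To finish, if G has a long
-- thread, a blue matching among the free vertices has fewer than t edges, so they form a
-- red clique up to few vertices, and these receive vertices of the thread. Otherwise G has
-- many leaves. If these do not fit, there are two disjoint near-cliques A and C, each
-- of almost n vertices. If many vertices of one have many red neighbours in the other,
-- leaves hang across. If not, A and C are essentially red cliques with blue edges between them;
-- a vertex with many blue neighbours in both spans a book, so there are fewer than t of
-- those, and all others join A or C. One of the two then has at least n vertices, and
-- the leaves of G go to the vertices that joined it.
module Submission where

open import Defs
  using (Graph; adj; irrefl; ∣V∣; ∣E∣; Reach; Connected; bookAdj; tBookAdj; tBookAdj-irrefl; ≟-sym; ≟-refl; tB;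
         Colouring; HasCopy; Arrows; IsRamseyNumber)
  renaming (here to reach-here; step to reach-step)
open import Data.Bool using (Bool; true; false; _∧_; not; if_then_else_)
import Data.Bool.Properties as Bool
open import Data.Empty using (⊥; ⊥-elim)
open import Data.Fin using (Fin; zero; suc; toℕ; fromℕ<; remQuot; combine)
open import Data.Fin.Patterns using (0F; 1F; 2F)
open import Data.Fin.Properties
  using (any?; all?; toℕ<n; toℕ-fromℕ<; toℕ-injective; fromℕ<-injective; injective⇒≤;
         combine-remQuot; remQuot-combine; combine-injective)
  renaming (_≟_ to _≟F_; suc-injective to sucF-injective)
import Data.List as List
open import Data.List.Properties using (map-tabulate)
open import Data.Nat
  using (ℕ; zero; suc; pred; _+_; _*_; _∸_; _^_; _≤_; _<_; _≰_; z≤n; s≤s; _≤?_; _<?_; _≟_; _<ᵇ_; >-nonZero)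
open import Data.Nat.DivMod using (_/_; _%_; m≡m%n+[m/n]*n; m%n<n; m/n*n≤m)
import Data.Nat.ListAction as ListAction
open import Data.Nat.Properties hiding (_≟_; _≤?_; _<?_)
open import Data.Nat.Tactic.RingSolver using (solve-∀)
open import Data.Product using (Σ; ∃; ∃-syntax; _×_; _,_; proj₁; proj₂)
open import Data.Sum using (_⊎_; inj₁; inj₂; [_,_]′)
open import Data.Vec.Functional using (_∷_)
open import Function using (_∘_; id; case_of_)
open import Relation.Binary.Definitions using (tri<; tri≈; tri>)
open import Relation.Binary.PropositionalEquality hiding (resp)
open import Relation.Nullary using (¬_; Dec; yes; no; does; ¬?; _×-dec_; _⊎-dec_; _→-dec_)
open import Relation.Nullary.Decidable using (dec-true)
open import Algebra.Properties.CommutativeMonoid.Sum +-0-commutativeMonoid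
  using (sum; sum-cong-≗; ∑-distrib-+; ∑-comm)

-- Inside `V` a failed step is harmless, because the free vertices are numerous enough for a fresh
-- start among them. But `V` has only about 2n - (t - 1)(k + 1) vertices, and this argument stops
-- some `c₂` vertices short of n. The last vertices of G must be allowed on the removed books, where
-- a single blue book contradicts nothing; only t disjoint ones do. Hence the final arguments look
-- for t disjoint blue edges, each with at least tk common blue neighbours away from all of them:
-- with that many, pages for all t books can be chosen greedily without clashes. The edge hypothesis
-- enters only through a bound `ℓ` on the excess of edges over vertices. Deleting a leaf and
-- suppressing a vertex of degree two both preserve it, so one `ℓ` with ℓ(127t²k² + 79t²k) ≤ n
-- serves the whole induction. Every size condition is then at most linear in `ℓ`, and the numerical
-- constants leave room for both the linear and the constant part. Marked sets run through the
-- reductions because some vertices, such as parents of leaves still to be hung, have a prescribed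
-- region and must survive until the base case places them there.

Sub : ℕ → Set
Sub n = Fin n → Bool

infix 4 _∈_ _∉_ _⊆_

_∈_ _∉_ : ∀ {n} → Fin n → Sub n → Set
x ∈ p = p x ≡ true
x ∉ p = ¬ (p x ≡ true)

_⊆_ : ∀ {n} → Sub n → Sub n → Set
p ⊆ q = ∀ x → x ∈ p → x ∈ q

mem? : ∀ {n} (p : Sub n) x → Dec (x ∈ p)
mem? p x = p x Bool.≟ true

does-true : ∀ {A : Set} (d : Dec A) → does d ≡ true → A
does-true (yes a) _ = a

opaque
  set : ∀ {n} {P : Fin n → Set} → (∀ x → Dec (P x)) → Sub n
  set d x = does (d x)

  ∈set : ∀ {n} {P : Fin n → Set} (d : ∀ x → Dec (P x)) {x} → P x → x ∈ set d
  ∈set d {x} px = dec-true (d x) px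

  set∈ : ∀ {n} {P : Fin n → Set} (d : ∀ x → Dec (P x)) {x} → x ∈ set d → P x
  set∈ d {x} = does-true (d x)

¬true : ∀ {b} → ¬ (b ≡ true) → b ≡ false
¬true = Bool.¬-not

true≢false : ∀ {b} → b ≡ true → b ≡ false → ⊥
true≢false refl ()

∅ : ∀ {n} → Sub n
∅ _ = false

infixr 6 _∪_
infixr 7 _∩_
infixl 7 _∖_

_∪_ _∩_ _∖_ : ∀ {n} → Sub n → Sub n → Sub n
p ∪ q = set (λ x → mem? p x ⊎-dec mem? q x)
p ∩ q = set (λ x → mem? p x ×-dec mem? q x)
p ∖ q = set (λ x → mem? p x ×-dec ¬? (mem? q x))

⁅_⁆ : ∀ {n} → Fin n → Sub n
⁅ x ⁆ = set (λ y → y ≟F x)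

module _ {n} (p q : Sub n) where
  ∈∪ : ∀ {x} → x ∈ p ⊎ x ∈ q → x ∈ p ∪ q
  ∈∪ = ∈set (λ x → mem? p x ⊎-dec mem? q x)
  ∪∈ : ∀ {x} → x ∈ p ∪ q → x ∈ p ⊎ x ∈ q
  ∪∈ = set∈ (λ x → mem? p x ⊎-dec mem? q x)
  ∈∩ : ∀ {x} → x ∈ p → x ∈ q → x ∈ p ∩ q
  ∈∩ a b = ∈set (λ x → mem? p x ×-dec mem? q x) (a , b)
  ∩∈ : ∀ {x} → x ∈ p ∩ q → x ∈ p × x ∈ q
  ∩∈ = set∈ (λ x → mem? p x ×-dec mem? q x)
  ∈∖ : ∀ {x} → x ∈ p → x ∉ q → x ∈ p ∖ q
  ∈∖ a b = ∈set (λ x → mem? p x ×-dec ¬? (mem? q x)) (a , b)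
  ∖∈ : ∀ {x} → x ∈ p ∖ q → x ∈ p × x ∉ q
  ∖∈ = set∈ (λ x → mem? p x ×-dec ¬? (mem? q x))

∈⁅⁆ : ∀ {n} {x y : Fin n} → y ≡ x → y ∈ ⁅ x ⁆
∈⁅⁆ {x = x} = ∈set (λ y → y ≟F x)

⁅⁆∈ : ∀ {n} {x y : Fin n} → y ∈ ⁅ x ⁆ → y ≡ x
⁅⁆∈ {x = x} = set∈ (λ y → y ≟F x)

-- Cardinalities as sums of indicators

⟦_⟧ : Bool → ℕ
⟦ true ⟧ = 1
⟦ false ⟧ = 0

opaque
  count : ∀ {n} → Sub n → ℕ
  count p = sum (λ x → ⟦ p x ⟧)

  count-def : ∀ {n} (p : Sub n) → count p ≡ sum (λ x → ⟦ p x ⟧)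
  count-def p = refl

sum-mono : ∀ {n} {f g : Fin n → ℕ} → (∀ i → f i ≤ g i) → sum f ≤ sum g
sum-mono {zero} h = z≤n
sum-mono {suc n} h = +-mono-≤ (h zero) (sum-mono (h ∘ suc))

term≤sum : ∀ {n} (f : Fin n → ℕ) i → f i ≤ sum f
term≤sum f zero = m≤m+n _ _
term≤sum f (suc i) = ≤-trans (term≤sum (f ∘ suc) i) (m≤n+m _ _)

opaque
  unfolding count

  sum-weight : ∀ {n} (p : Sub n) {f : Fin n → ℕ} {c} →
    (∀ x → x ∈ p → f x ≤ c) → (∀ x → x ∉ p → f x ≡ 0) → sum f ≤ count p * c
  sum-weight {zero} p h z = z≤n
  sum-weight {suc n} p {f} {c} h z with p zero in eq
  ... | true = +-mono-≤ (h zero eq) (sum-weight (p ∘ suc) (h ∘ suc) (z ∘ suc))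
  ... | false rewrite z zero (λ e → true≢false e eq) = sum-weight (p ∘ suc) (h ∘ suc) (z ∘ suc)

  weight-sum : ∀ {n} (p : Sub n) {f : Fin n → ℕ} {c} →
    (∀ x → x ∈ p → c ≤ f x) → count p * c ≤ sum f
  weight-sum {zero} p h = z≤n
  weight-sum {suc n} p {f} {c} h with p zero in eq
  ... | true = +-mono-≤ (h zero eq) (weight-sum (p ∘ suc) (h ∘ suc))
  ... | false = ≤-trans (weight-sum (p ∘ suc) (h ∘ suc)) (m≤n+m _ _)

⟦⟧≤1 : ∀ b → ⟦ b ⟧ ≤ 1
⟦⟧≤1 true = ≤-refl
⟦⟧≤1 false = z≤n

⟦⟧≤ : ∀ {b k} → (b ≡ true → 1 ≤ k) → ⟦ b ⟧ ≤ k
⟦⟧≤ {true} h = h refl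
⟦⟧≤ {false} h = z≤n

1≤⟦⟧ : ∀ {b} → b ≡ true → 1 ≤ ⟦ b ⟧
1≤⟦⟧ refl = ≤-refl

⟦∈⟧ : ∀ {b} → b ≡ true → ⟦ b ⟧ ≡ 1
⟦∈⟧ refl = refl

⟦∉⟧ : ∀ {b} → ¬ (b ≡ true) → ⟦ b ⟧ ≡ 0
⟦∉⟧ {true} h = ⊥-elim (h refl)
⟦∉⟧ {false} h = refl

opaque
  unfolding count

  count-mono : ∀ {n} (p q : Sub n) → p ⊆ q → count p ≤ count q
  count-mono p q h = sum-mono (λ x → ⟦⟧≤ (λ e → 1≤⟦⟧ (h x e)))

  count-≤+ : ∀ {n} (p q r : Sub n) → (∀ x → x ∈ p → x ∈ q ⊎ x ∈ r) → count p ≤ count q + count r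
  count-≤+ p q r h = ≤-trans
    (sum-mono (λ x → ⟦⟧≤ (λ e → [ (λ a → ≤-trans (1≤⟦⟧ a) (m≤m+n _ _))
                                 , (λ a → ≤-trans (1≤⟦⟧ a) (m≤n+m _ _)) ]′ (h x e))))
    (≤-reflexive (∑-distrib-+ (λ x → ⟦ q x ⟧) (λ x → ⟦ r x ⟧)))

  count-+≤ : ∀ {n} (p q r : Sub n) → p ⊆ r → q ⊆ r → (∀ x → x ∈ p → x ∈ q → ⊥) →
    count p + count q ≤ count r
  count-+≤ p q r hp hq hd = ≤-trans
    (≤-reflexive (sym (∑-distrib-+ (λ x → ⟦ p x ⟧) (λ x → ⟦ q x ⟧))))
    (sum-mono pt)
    where
    pt : ∀ x → ⟦ p x ⟧ + ⟦ q x ⟧ ≤ ⟦ r x ⟧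
    pt x with p x in ep | q x in eq
    ... | true | true = ⊥-elim (hd x ep eq)
    ... | true | false = 1≤⟦⟧ (hp x ep)
    ... | false | true = 1≤⟦⟧ (hq x eq)
    ... | false | false = z≤n

  ∪-∖ : ∀ {n} (p q : Sub n) x → x ∈ p → x ∈ (p ∖ q) ⊎ x ∈ q
  ∪-∖ p q x e = case mem? q x of λ where
    (yes h) → inj₂ h
    (no h) → inj₁ (∈∖ p q e h)

  count-∖ : ∀ {n} (p q : Sub n) → count p ≤ count (p ∖ q) + count q
  count-∖ p q = count-≤+ p (p ∖ q) q (∪-∖ p q)

  count-⋃ : ∀ {m n} (p : Sub n) (q : Fin m → Sub n) →
    (∀ x → x ∈ p → ∃[ i ] x ∈ q i) → count p ≤ sum (λ i → count (q i))
  count-⋃ p q h = ≤-trans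
    (sum-mono (λ x → ⟦⟧≤ (λ e → let i , a = h x e in
       ≤-trans (1≤⟦⟧ a) (term≤sum (λ i → ⟦ q i x ⟧) i))))
    (≤-reflexive (∑-comm (λ x i → ⟦ q i x ⟧)))

  count-empty : ∀ {n} (p : Sub n) → (∀ x → x ∉ p) → count p ≡ 0
  count-empty {zero} p h = refl
  count-empty {suc n} p h rewrite ¬true (h zero) = count-empty (p ∘ suc) (h ∘ suc)

  count-≤1 : ∀ {n} (p : Sub n) → (∀ x y → x ∈ p → y ∈ p → x ≡ y) → count p ≤ 1
  count-≤1 {zero} p h = z≤n
  count-≤1 {suc n} p h with p zero in eq
  ... | true = ≤-reflexive (cong suc (count-empty (p ∘ suc) (λ x e → case h zero (suc x) eq e of λ ())))
  ... | false = count-≤1 (p ∘ suc) (λ x y a b → sucF-injective (h (suc x) (suc y) a b))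

  count-pick : ∀ {n} (p q : Sub n) → count q < count p → ∃[ x ] x ∈ p × x ∉ q
  count-pick p q lt with any? (λ x → mem? p x ×-dec ¬? (mem? q x))
  ... | yes e = e
  ... | no ¬e = ⊥-elim (<⇒≱ lt (count-mono p q sub))
    where
    sub : p ⊆ q
    sub x e with mem? q x
    ... | yes h = h
    ... | no h = ⊥-elim (¬e (x , e , h))

  count-full : ∀ n → count {n} (λ _ → true) ≡ n
  count-full zero = refl
  count-full (suc n) = cong suc (count-full n)

count-inhabited : ∀ {n} (p : Sub n) → 0 < count p → ∃[ x ] x ∈ p
count-inhabited p lt =
  let x , e , _ = count-pick p ∅ (subst (_< count p) (sym (count-empty ∅ (λ _ ()))) lt) in x , e

∈⇒0<count : ∀ {n} (p : Sub n) {x} → x ∈ p → 0 < count p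
∈⇒0<count p {x} e = subst (0 <_) (sym (count-def p)) (≤-trans (1≤⟦⟧ e) (term≤sum (λ x → ⟦ p x ⟧) x))

count-≤⟦⟧ : ∀ {n} (p : Sub n) c → (∀ x → x ∈ p → c ≡ true) → (∀ x y → x ∈ p → y ∈ p → x ≡ y) → count p ≤ ⟦ c ⟧
count-≤⟦⟧ p true h1 h2 = count-≤1 p h2
count-≤⟦⟧ p false h1 h2 = ≤-reflexive (count-empty p λ x e → case h1 x e of λ ())

count-image : ∀ {m n} (p : Sub m) (q : Sub n) (f : Fin m → Fin n) →
  (∀ y → y ∈ q → ∃[ x ] x ∈ p × f x ≡ y) → count q ≤ count p
count-image p q f h = ≤-trans (count-⋃ q (λ x → set (d x)) cov)
  (≤-trans (sum-mono λ x → count-≤⟦⟧ _ (p x)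
    (λ y a → proj₁ (set∈ (d x) a))
    (λ y z a b → trans (proj₂ (set∈ (d x) a)) (sym (proj₂ (set∈ (d x) b)))))
    (≤-reflexive (sym (count-def p))))
  where
  d : ∀ x y → Dec (x ∈ p × y ≡ f x)
  d x y = mem? p x ×-dec (y ≟F f x)
  cov : ∀ y → y ∈ q → ∃[ x ] y ∈ set (d x)
  cov y e = let x , a , b = h y e in x , ∈set (d x) (a , sym b)

count-inj : ∀ {m n} (p : Sub m) (q : Sub n) (f : Fin m → Fin n) →
  (∀ x → x ∈ p → f x ∈ q) → (∀ x y → x ∈ p → y ∈ p → f x ≡ f y → x ≡ y) → count p ≤ count q
count-inj p q f h inj = ≤-trans (count-⋃ p (λ y → set (d y)) (λ x e → f x , ∈set (d (f x)) (e , refl)))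
  (≤-trans (sum-mono λ y → count-≤⟦⟧ _ (q y)
    (λ x a → let a1 , a2 = set∈ (d y) a in subst (_∈ q) a2 (h x a1))
    (λ x z a b → let a1 , a2 = set∈ (d y) a ; b1 , b2 = set∈ (d y) b in inj x z a1 b1 (trans a2 (sym b2))))
    (≤-reflexive (sym (count-def q))))
  where
  d : ∀ y x → Dec (x ∈ p × f x ≡ y)
  d y x = mem? p x ×-dec (f x ≟F y)

count⁅⁆ : ∀ {n} (x : Fin n) → count ⁅ x ⁆ ≤ 1
count⁅⁆ x = count-≤1 ⁅ x ⁆ (λ y z a b → trans (⁅⁆∈ a) (sym (⁅⁆∈ b)))

InjSub : ∀ {m n} → (Fin m → Fin n) → Set
InjSub f = ∀ i j → f i ≡ f j → i ≡ j

opaque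
  unfolding count

  choose : ∀ {n} m (p : Sub n) → m ≤ count p → Σ (Fin m → Fin n) λ f → InjSub f × (∀ i → f i ∈ p)
  choose zero p _ = (λ ()) , (λ ()) , λ ()
  choose {zero} (suc m) p ()
  choose {suc n} (suc m) p le with p zero in eq
  choose {suc n} (suc m) p (s≤s le) | true with choose m (p ∘ suc) le
  ... | f , inj , h = g , ginj , gh
    where
    g : Fin (suc m) → Fin (suc n)
    g zero = zero
    g (suc i) = suc (f i)
    ginj : InjSub g
    ginj zero zero _ = refl
    ginj (suc i) (suc j) e = cong suc (inj i j (sucF-injective e))
    gh : ∀ i → g i ∈ p
    gh zero = eq
    gh (suc i) = h i
  choose {suc n} (suc m) p le | false with choose (suc m) (p ∘ suc) le
  ... | f , inj , h = suc ∘ f , (λ i j e → inj i j (sucF-injective e)) , h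

image : ∀ {m n} → (Fin m → Fin n) → Sub n
image f = set (λ y → any? (λ i → f i ≟F y))

module _ {m n} (f : Fin m → Fin n) where
  ∈image : ∀ {y} → (∃[ i ] f i ≡ y) → y ∈ image f
  ∈image = ∈set (λ y → any? (λ i → f i ≟F y))
  image∈ : ∀ {y} → y ∈ image f → ∃[ i ] f i ≡ y
  image∈ = set∈ (λ y → any? (λ i → f i ≟F y))

  count-image≤ : count (image f) ≤ m
  count-image≤ = subst (count (image f) ≤_) (count-full m)
    (count-image (λ _ → true) (image f) f (λ y e → let i , h = image∈ e in i , refl , h))

  count-image≥ : InjSub f → m ≤ count (image f)
  count-image≥ inj = subst (_≤ count (image f)) (count-full m)
    (count-inj (λ _ → true) (image f) f (λ x _ → ∈image (x , refl)) (λ x y _ _ → inj x y))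

inj-into⇒≤ : ∀ {m n} (f : Fin m → Fin n) (p : Sub n) → InjSub f → (∀ i → f i ∈ p) → m ≤ count p
inj-into⇒≤ f p inj h = ≤-trans (count-image≥ f inj)
  (count-mono (image f) p (λ y e → let i , a = image∈ f e in subst (_∈ p) a (h i)))

trim : ∀ {n} m (p : Sub n) → m ≤ count p → ∃[ q ] q ⊆ p × count q ≡ m
trim m p le with choose m p le
... | f , inj , h = image f , (λ y e → let i , a = image∈ f e in subst (_∈ p) a (h i))
                  , ≤-antisym (count-image≤ f) (count-image≥ f inj)

-- Every set is at least as large as the number of representatives wanted, so a greedy choice
-- replaces Hall's theorem.
sdr : ∀ {n} m (P : Fin m → Sub n) → (∀ i → m ≤ count (P i)) →
  Σ (Fin m → Fin n) λ g → InjSub g × (∀ i → g i ∈ P i)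
sdr {n} m P h =
  let g , inj , a , _ = go m P ∅ (λ i → ≤-trans (≤-reflexive (trans (cong (m +_) (count-empty {n} ∅ λ _ ())) (+-identityʳ m))) (h i))
  in g , inj , a
  where
  go : ∀ m (P : Fin m → Sub n) (used : Sub n) → (∀ i → m + count used ≤ count (P i)) →
    Σ (Fin m → Fin n) λ g → InjSub g × (∀ i → g i ∈ P i) × (∀ i → g i ∉ used)
  go zero P used h = (λ ()) , (λ ()) , (λ ()) , λ ()
  go (suc m) P used h with count-pick (P zero) used (≤-trans (s≤s (m≤n+m _ m)) (h zero))
  ... | y , yP , y∉ with go m (P ∘ suc) (used ∪ ⁅ y ⁆) h′
    where
    h′ : ∀ i → m + count (used ∪ ⁅ y ⁆) ≤ count (P (suc i))
    h′ i = ≤-trans (+-monoʳ-≤ m (≤-trans (count-≤+ (used ∪ ⁅ y ⁆) used ⁅ y ⁆ (λ x → ∪∈ used ⁅ y ⁆))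
                                         (≤-trans (+-monoʳ-≤ (count used) (count⁅⁆ y)) (≤-reflexive (+-comm (count used) 1)))))
             (≤-trans (≤-reflexive (+-suc m (count used))) (h (suc i)))
  ... | g , inj , gP , g∉ = g′ , inj′ , gP′ , g∉′
    where
    g′ : Fin (suc m) → Fin n
    g′ zero = y
    g′ (suc i) = g i
    y∉g : ∀ i → y ≢ g i
    y∉g i e = g∉ i (∈∪ used ⁅ y ⁆ (inj₂ (∈⁅⁆ (sym e))))
    inj′ : InjSub g′
    inj′ zero zero _ = refl
    inj′ zero (suc j) e = ⊥-elim (y∉g j e)
    inj′ (suc i) zero e = ⊥-elim (y∉g i (sym e))
    inj′ (suc i) (suc j) e = cong suc (inj i j e)
    gP′ : ∀ i → g′ i ∈ P i
    gP′ zero = yP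
    gP′ (suc i) = gP i
    g∉′ : ∀ i → g′ i ∉ used
    g∉′ zero = y∉
    g∉′ (suc i) e = g∉ i (∈∪ used ⁅ y ⁆ (inj₁ e))

-- Sparse connected graphs under leaf deletion and suppression

-- A graph on the vertex set S ⊆ Fin n. Connectedness is expressed by cuts, which
-- survive the deletion of leaves and the suppression of vertices of degree two.
record PG (n : ℕ) : Set where
  field
    S : Sub n
    E : Fin n → Sub n
    E-sym : ∀ {u v} → v ∈ E u → u ∈ E v
    E-irr : ∀ {u} → u ∉ E u
    E-S : ∀ {u v} → v ∈ E u → u ∈ S
    conn : ∀ (X : Sub n) {u v} → u ∈ S → u ∈ X → v ∈ S → v ∉ X →
      ∃[ a ] ∃[ b ] b ∈ E a × a ∈ X × b ∉ X

open PG

ord : ∀ {n} → PG n → ℕ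
ord G = count (S G)

deg : ∀ {n} → PG n → Fin n → ℕ
deg G v = count (E G v)

degsum : ∀ {n} → PG n → ℕ
degsum G = sum (deg G)

E-S′ : ∀ {n} (G : PG n) {u v} → v ∈ E G u → v ∈ S G
E-S′ G e = E-S G (E-sym G e)

-- In terms of edges: they exceed the vertices by at most `ℓ`. Both reductions remove as many edges
-- as vertices, so `ℓ` never changes.
Sparse : ∀ {n} → ℕ → PG n → Set
Sparse ℓ G = degsum G ≤ 2 * (ord G + ℓ)

count-∖⁅⁆ : ∀ {n} (p : Sub n) {x} → x ∈ p → suc (count (p ∖ ⁅ x ⁆)) ≤ count p
count-∖⁅⁆ p {x} e = ≤-trans (≤-reflexive (+-comm 1 _))
  (≤-trans (+-monoʳ-≤ (count (p ∖ ⁅ x ⁆)) (∈⇒0<count ⁅ x ⁆ (∈⁅⁆ refl)))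
    (count-+≤ (p ∖ ⁅ x ⁆) ⁅ x ⁆ p (λ y a → proj₁ (∖∈ p ⁅ x ⁆ a))
      (λ y a → subst (_∈ p) (sym (⁅⁆∈ a)) e)
      (λ y a b → proj₂ (∖∈ p ⁅ x ⁆ a) b)))

count-∪⁅⁆ : ∀ {n} (p : Sub n) x → count (p ∪ ⁅ x ⁆) ≤ suc (count p)
count-∪⁅⁆ p x = ≤-trans (count-≤+ (p ∪ ⁅ x ⁆) p ⁅ x ⁆ (λ y → ∪∈ p ⁅ x ⁆))
  (≤-trans (+-monoʳ-≤ (count p) (count⁅⁆ x)) (≤-reflexive (+-comm (count p) 1)))

∈∖⁅⁆ : ∀ {n} (p : Sub n) {x y} → y ∈ p → y ≢ x → y ∈ p ∖ ⁅ x ⁆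
∈∖⁅⁆ p {x} a ne = ∈∖ p ⁅ x ⁆ a (λ e → ne (⁅⁆∈ e))

2≤count : ∀ {n} (p : Sub n) {x y} → x ∈ p → y ∈ p → x ≢ y → 2 ≤ count p
2≤count p {x} {y} a b ne = ≤-trans (s≤s (∈⇒0<count (p ∖ ⁅ x ⁆) (∈∖⁅⁆ p b (ne ∘ sym)))) (count-∖⁅⁆ p a)

3≤count : ∀ {n} (p : Sub n) {x y z} → x ∈ p → y ∈ p → z ∈ p → x ≢ y → z ≢ x → z ≢ y → 3 ≤ count p
3≤count p {x} {y} {z} a b c ne n1 n2 = ≤-trans
  (s≤s (2≤count (p ∖ ⁅ z ⁆) (∈∖⁅⁆ p a (n1 ∘ sym)) (∈∖⁅⁆ p b (n2 ∘ sym)) ne)) (count-∖⁅⁆ p c)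

count≤1-unique : ∀ {n} (p : Sub n) {x y} → count p ≤ 1 → x ∈ p → y ∈ p → x ≡ y
count≤1-unique p {x} {y} le a b with x ≟F y
... | yes e = e
... | no ne = ⊥-elim (<⇒≱ (2≤count p a b ne) le)

module DeleteLeaves {n} (G : PG n) (W : Sub n) (W⊆S : W ⊆ S G)
  (leaf : ∀ w → w ∈ W → deg G w ≡ 1) (indep : ∀ u v → v ∈ E G u → u ∈ W → v ∉ W) where

  private
    dE : ∀ u v → Dec (v ∈ E G u × u ∉ W × v ∉ W)
    dE u v = mem? (E G u) v ×-dec ¬? (mem? W u) ×-dec ¬? (mem? W v)

    parent : ∀ {w} → w ∈ W → ∃[ p ] p ∈ E G w
    parent {w} e = count-inhabited (E G w) (≤-reflexive (sym (leaf w e)))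

    -- A cut of the smaller graph is lifted by putting each deleted leaf on the side of its parent;
    -- then no crossing edge touches a leaf.
    dX : ∀ (X : Sub n) v → Dec ((v ∈ X × v ∉ W) ⊎ (v ∈ W × ∃[ u ] u ∈ E G v × u ∈ X))
    dX X v = (mem? X v ×-dec ¬? (mem? W v)) ⊎-dec
             (mem? W v ×-dec any? (λ u → mem? (E G v) u ×-dec mem? X u))

    only-parent : ∀ {w u v} → w ∈ W → u ∈ E G w → v ∈ E G w → u ≡ v
    only-parent {w} e = count≤1-unique (E G w) (≤-reflexive (leaf w e))

  delete : PG n
  delete .S = S G ∖ W
  delete .E u = set (dE u)
  delete .E-sym {u} {v} e = let a , b , c = set∈ (dE u) e in ∈set (dE v) (E-sym G a , c , b)
  delete .E-irr {u} e = E-irr G (proj₁ (set∈ (dE u) e))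
  delete .E-S {u} e = let a , b , c = set∈ (dE u) e in ∈∖ (S G) W (E-S G a) b
  delete .conn X {u} {v} uS uX vS vX
    with ∖∈ (S G) W uS | ∖∈ (S G) W vS
  ... | uS′ , uW | vS′ , vW
    with conn G (set (dX X)) uS′ (∈set (dX X) (inj₁ (uX , uW))) vS′ (λ e → case set∈ (dX X) e of λ where
                 (inj₁ (a , _)) → vX a
                 (inj₂ (a , _)) → vW a)
  ... | a , b , ab , aX , bX with mem? W b
  ...   | yes bW = ⊥-elim (case set∈ (dX X) aX of λ where
            (inj₁ (aX′ , _)) → bX (∈set (dX X) (inj₂ (bW , a , E-sym G ab , aX′)))
            (inj₂ (aW , _)) → indep a b ab aW bW)
  ...   | no bW with set∈ (dX X) aX
  ...     | inj₁ (aX′ , aW) = a , b , ∈set (dE a) (ab , aW , bW) , aX′ , λ bX′ → bX (∈set (dX X) (inj₁ (bX′ , bW)))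
  ...     | inj₂ (aW , p , pa , pX) =
              ⊥-elim (bX (∈set (dX X) (inj₁ (subst (_∈ X) (only-parent aW pa ab) pX , bW))))

  delete-E : ∀ {u v} → v ∈ E delete u → v ∈ E G u
  delete-E {u} e = proj₁ (set∈ (dE u) e)

  E-delete : ∀ {u v} → v ∈ E G u → u ∉ W → v ∉ W → v ∈ E delete u
  E-delete {u} a b c = ∈set (dE u) (a , b , c)

  ord-delete : ord delete + count W ≡ ord G
  ord-delete = ≤-antisym
    (count-+≤ (S G ∖ W) W (S G) (λ x e → proj₁ (∖∈ (S G) W e)) W⊆S (λ x a b → proj₂ (∖∈ (S G) W a) b))
    (count-∖ (S G) W)

  -- Each leaf pays twice: its own degree, and one unit at its parent. Independence of `W` keeps the
  -- two payments apart.
  degsum-delete : degsum delete + 2 * count W ≤ degsum G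
  degsum-delete = begin
    degsum delete + 2 * count W
      ≤⟨ +-monoʳ-≤ (degsum delete) (≤-trans (≤-reflexive (cong (count W +_) (+-identityʳ _)))
           (+-mono-≤ (count-⋃ W (λ u → E G u ∩ W) cov) (≤-reflexive (count-def W)))) ⟩
    degsum delete + (sum (λ u → count (E G u ∩ W)) + sum (λ u → ⟦ W u ⟧))
      ≡⟨ cong (degsum delete +_) (sym (∑-distrib-+ (λ u → count (E G u ∩ W)) (λ u → ⟦ W u ⟧))) ⟩
    degsum delete + sum (λ u → count (E G u ∩ W) + ⟦ W u ⟧)
      ≡⟨ sym (∑-distrib-+ (deg delete) (λ u → count (E G u ∩ W) + ⟦ W u ⟧)) ⟩
    sum (λ u → deg delete u + (count (E G u ∩ W) + ⟦ W u ⟧))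
      ≤⟨ sum-mono pt ⟩
    degsum G ∎
    where
    open ≤-Reasoning
    cov : ∀ w → w ∈ W → ∃[ u ] w ∈ E G u ∩ W
    cov w e = let p , a = parent e in p , ∈∩ (E G p) W (E-sym G a) e
    pt : ∀ u → deg delete u + (count (E G u ∩ W) + ⟦ W u ⟧) ≤ deg G u
    pt u = case mem? W u of λ where
      (yes uW) → ≤-reflexive (trans (cong₂ _+_ (count-empty (E delete u) (λ v e → proj₁ (proj₂ (set∈ (dE u) e)) uW))
        (cong₂ _+_ (count-empty (E G u ∩ W) (λ v e → indep u v (proj₁ (∩∈ (E G u) W e)) uW (proj₂ (∩∈ (E G u) W e))))
                   (⟦∈⟧ uW)))
        (sym (leaf u uW)))
      (no u∉W) → ≤-trans (≤-reflexive (cong (deg delete u +_) (trans (cong (count (E G u ∩ W) +_) (⟦∉⟧ u∉W)) (+-identityʳ _))))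
        (count-+≤ (E delete u) (E G u ∩ W) (E G u) (λ v → delete-E)
            (λ v e → proj₁ (∩∈ (E G u) W e))
            (λ v a b → proj₂ (proj₂ (set∈ (dE u) a)) (proj₂ (∩∈ (E G u) W b))))

  sparse-delete : ∀ ℓ → Sparse ℓ G → Sparse ℓ delete
  sparse-delete ℓ sp = +-cancelʳ-≤ (2 * count W) _ _ (begin
    degsum delete + 2 * count W ≤⟨ degsum-delete ⟩
    degsum G ≤⟨ sp ⟩
    2 * (ord G + ℓ) ≡⟨ cong (λ z → 2 * (z + ℓ)) (sym ord-delete) ⟩
    2 * (ord delete + count W + ℓ) ≡⟨ lem (ord delete) (count W) ℓ ⟩
    2 * (ord delete + ℓ) + 2 * count W ∎)
    where
    open ≤-Reasoning
    lem : ∀ a b c → 2 * (a + b + c) ≡ 2 * (a + c) + 2 * b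
    lem = solve-∀

-- The non-adjacency of `u` and `w` keeps the result simple: one new edge replaces two old ones, so
-- exactly one edge is lost with the vertex.
module Suppress {n} (G : PG n) (v u w : Fin n) (uv : u ∈ E G v) (wv : w ∈ E G v) (u≢w : u ≢ w)
  (only : ∀ x → x ∈ E G v → x ≡ u ⊎ x ≡ w) (uw : w ∉ E G u) where

  private
    dE : ∀ x y → Dec ((y ∈ E G x × x ≢ v × y ≢ v) ⊎ ((x ≡ u × y ≡ w) ⊎ (x ≡ w × y ≡ u)))
    dE x y = (mem? (E G x) y ×-dec ¬? (x ≟F v) ×-dec ¬? (y ≟F v)) ⊎-dec
             ((x ≟F u ×-dec y ≟F w) ⊎-dec (x ≟F w ×-dec y ≟F u))

    u≢v : u ≢ v
    u≢v refl = E-irr G uv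
    w≢v : w ≢ v
    w≢v refl = E-irr G wv

    uS : u ∈ S G
    uS = E-S′ G uv
    wS : w ∈ S G
    wS = E-S′ G wv

  suppress : PG n
  suppress .S = S G ∖ ⁅ v ⁆
  suppress .E x = set (dE x)
  suppress .E-sym {x} {y} e with set∈ (dE x) e
  ... | inj₁ (a , b , c) = ∈set (dE y) (inj₁ (E-sym G a , c , b))
  ... | inj₂ (inj₁ (a , b)) = ∈set (dE y) (inj₂ (inj₂ (b , a)))
  ... | inj₂ (inj₂ (a , b)) = ∈set (dE y) (inj₂ (inj₁ (b , a)))
  suppress .E-irr {x} e with set∈ (dE x) e
  ... | inj₁ (a , _) = E-irr G a
  ... | inj₂ (inj₁ (a , b)) = u≢w (trans (sym a) b)
  ... | inj₂ (inj₂ (a , b)) = u≢w (trans (sym b) a)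
  suppress .E-S {x} e with set∈ (dE x) e
  ... | inj₁ (a , b , c) = ∈∖⁅⁆ (S G) (E-S G a) b
  ... | inj₂ (inj₁ (refl , _)) = ∈∖⁅⁆ (S G) uS u≢v
  ... | inj₂ (inj₂ (refl , _)) = ∈∖⁅⁆ (S G) wS w≢v
  -- If `X` misses both neighbours of `v`, then `v` is put outside and no crossing edge ends there.
  -- Otherwise `v` is put inside, and a crossing edge from `v` is replaced by the new edge between
  -- `u` and `w`, whose other end lies in `X`.
  suppress .conn X {s} {t} sS sX tS tX with mem? X u ⊎-dec mem? X w
  ... | no ¬uw with conn G (X ∖ ⁅ v ⁆) (proj₁ (∖∈ (S G) ⁅ v ⁆ sS)) (∈∖ X ⁅ v ⁆ sX (proj₂ (∖∈ (S G) ⁅ v ⁆ sS)))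
                     (proj₁ (∖∈ (S G) ⁅ v ⁆ tS)) (λ e → tX (proj₁ (∖∈ X ⁅ v ⁆ e)))
  ...   | a , b , ab , aX , bX with ∖∈ X ⁅ v ⁆ aX | b ≟F v
  ...     | aX′ , a∉ | yes refl = ⊥-elim (¬uw (case only a (E-sym G ab) of λ where
              (inj₁ refl) → inj₁ aX′
              (inj₂ refl) → inj₂ aX′))
  ...     | aX′ , a∉ | no b≢v = a , b , ∈set (dE a) (inj₁ (ab , (λ e → a∉ (∈⁅⁆ e)) , b≢v)) , aX′
                                , λ bX′ → bX (∈∖⁅⁆ X bX′ b≢v)
  suppress .conn X {s} {t} sS sX tS tX | yes uwX
    with conn G (X ∪ ⁅ v ⁆) (proj₁ (∖∈ (S G) ⁅ v ⁆ sS)) (∈∪ X ⁅ v ⁆ (inj₁ sX))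
           (proj₁ (∖∈ (S G) ⁅ v ⁆ tS)) (λ e → case ∪∈ X ⁅ v ⁆ e of λ where
              (inj₁ a) → tX a
              (inj₂ a) → proj₂ (∖∈ (S G) ⁅ v ⁆ tS) a)
  ... | a , b , ab , aX , bX with a ≟F v
  ...   | no a≢v = a , b , ∈set (dE a) (inj₁ (ab , a≢v , λ e → bX (∈∪ X ⁅ v ⁆ (inj₂ (∈⁅⁆ e)))))
                 , [ id , (λ e → ⊥-elim (a≢v (⁅⁆∈ e))) ]′ (∪∈ X ⁅ v ⁆ aX) , λ bX′ → bX (∈∪ X ⁅ v ⁆ (inj₁ bX′))
  ...   | yes refl with only b ab
  ...     | inj₁ refl = w , u , ∈set (dE w) (inj₂ (inj₂ (refl , refl)))
                      , [ (λ e → ⊥-elim (bX (∈∪ X ⁅ v ⁆ (inj₁ e)))) , id ]′ uwX , λ e → bX (∈∪ X ⁅ v ⁆ (inj₁ e))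
  ...     | inj₂ refl = u , w , ∈set (dE u) (inj₂ (inj₁ (refl , refl)))
                      , [ id , (λ e → ⊥-elim (bX (∈∪ X ⁅ v ⁆ (inj₁ e)))) ]′ uwX , λ e → bX (∈∪ X ⁅ v ⁆ (inj₁ e))

  E-suppress : ∀ {x y} → y ∈ E G x → x ≢ v → y ≢ v → y ∈ E suppress x
  E-suppress {x} a b c = ∈set (dE x) (inj₁ (a , b , c))

  E-suppress-new : w ∈ E suppress u
  E-suppress-new = ∈set (dE u) (inj₂ (inj₁ (refl , refl)))

  ord-suppress : suc (ord suppress) ≤ ord G
  ord-suppress = count-∖⁅⁆ (S G) (E-S G uv)

  ord≤ : ord G ≤ suc (ord suppress)
  ord≤ = ≤-trans (count-∖ (S G) ⁅ v ⁆) (≤-trans (+-monoʳ-≤ (ord suppress) (count⁅⁆ v)) (≤-reflexive (+-comm _ 1)))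

  private
    extra : ∀ {x z} → v ∈ E G x → (∀ y → y ∈ E suppress x → (y ∈ E G x × y ≢ v) ⊎ y ≡ z) → deg suppress x ≤ deg G x
    extra {x} {z} vx h = ≤-trans
      (count-mono (E suppress x) ((E G x ∖ ⁅ v ⁆) ∪ ⁅ z ⁆) (λ y e → ∈∪ (E G x ∖ ⁅ v ⁆) ⁅ z ⁆ (case h y e of λ where
        (inj₁ (a , b)) → inj₁ (∈∖⁅⁆ (E G x) a b)
        (inj₂ a) → inj₂ (∈⁅⁆ a))))
      (≤-trans (count-∪⁅⁆ (E G x ∖ ⁅ v ⁆) z) (count-∖⁅⁆ (E G x) vx))

    pt : ∀ x → deg suppress x + 2 * ⟦ ⁅ v ⁆ x ⟧ ≤ deg G x
    pt x = case x ≟F v of λ where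
        (yes refl) → ≤-trans (≤-reflexive (cong₂ (λ a b → a + 2 * b)
           (count-empty (E suppress v) (λ y e → case set∈ (dE v) e of λ where
                  (inj₁ (_ , b , _)) → b refl
                  (inj₂ (inj₁ (a , _))) → u≢v (sym a)
                  (inj₂ (inj₂ (a , _))) → w≢v (sym a))) (⟦∈⟧ (∈⁅⁆ {x = v} refl)))) (2≤count (E G v) uv wv u≢w)
        (no x≢v) → ≤-trans (≤-reflexive (trans (cong (λ b → deg suppress x + 2 * b) (⟦∉⟧ (λ e → x≢v (⁅⁆∈ {x = v} e)))) (+-identityʳ _)))
                      (go (x ≟F u) (x ≟F w))
      where
      go : Dec (x ≡ u) → Dec (x ≡ w) → deg suppress x ≤ deg G x
      go (yes refl) _ = extra {z = w} (E-sym G uv) λ y e → case set∈ (dE x) e of λ where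
        (inj₁ (a , _ , b)) → inj₁ (a , b)
        (inj₂ (inj₁ (_ , b))) → inj₂ b
        (inj₂ (inj₂ (a , _))) → ⊥-elim (u≢w a)
      go (no _) (yes refl) = extra {z = u} (E-sym G wv) λ y e → case set∈ (dE x) e of λ where
        (inj₁ (a , _ , b)) → inj₁ (a , b)
        (inj₂ (inj₁ (a , _))) → ⊥-elim (u≢w (sym a))
        (inj₂ (inj₂ (_ , b))) → inj₂ b
      go (no xu) (no xw) = count-mono (E suppress x) (E G x) λ y e → case set∈ (dE x) e of λ where
        (inj₁ (a , _)) → a
        (inj₂ (inj₁ (a , _))) → ⊥-elim (xu a)
        (inj₂ (inj₂ (a , _))) → ⊥-elim (xw a)

  -- The neighbours `u` and `w` trade `v` for each other and keep their degrees; the two lost units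
  -- are the degree of `v`.
  degsum-suppress : degsum suppress + 2 ≤ degsum G
  degsum-suppress = begin
    degsum suppress + 2 ≤⟨ +-monoʳ-≤ (degsum suppress) (≤-trans (*-monoʳ-≤ 2 (1≤⟦⟧ (∈⁅⁆ {x = v} refl)))
                             (term≤sum (λ x → 2 * ⟦ ⁅ v ⁆ x ⟧) v)) ⟩
    degsum suppress + sum (λ x → 2 * ⟦ ⁅ v ⁆ x ⟧) ≡⟨ sym (∑-distrib-+ (deg suppress) (λ x → 2 * ⟦ ⁅ v ⁆ x ⟧)) ⟩
    sum (λ x → deg suppress x + 2 * ⟦ ⁅ v ⁆ x ⟧) ≤⟨ sum-mono pt ⟩
    degsum G ∎
    where open ≤-Reasoning

  sparse-suppress : ∀ ℓ → Sparse ℓ G → Sparse ℓ suppress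
  sparse-suppress ℓ sp = +-cancelʳ-≤ 2 _ _ (begin
    degsum suppress + 2 ≤⟨ degsum-suppress ⟩
    degsum G ≤⟨ sp ⟩
    2 * (ord G + ℓ) ≤⟨ *-monoʳ-≤ 2 (+-monoˡ-≤ ℓ ord≤) ⟩
    2 * (suc (ord suppress) + ℓ) ≡⟨ lem (ord suppress) ℓ ⟩
    2 * (ord suppress + ℓ) + 2 ∎)
    where
    open ≤-Reasoning
    lem : ∀ a c → 2 * (suc a + c) ≡ 2 * (a + c) + 2
    lem = solve-∀

-- Threads, and the trichotomy leaf, thread or few vertices

-- The inner vertices are `th 1` to `th m`. The ends `th 0` and `th (suc m)` may be marked and have
-- any degree; values of `th` further on are arbitrary.
record Thread {n} (G : PG n) (P : Sub n) (m : ℕ) : Set where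
  field
    th : ℕ → Fin n
    th-inj : ∀ i j → i ≤ suc m → j ≤ suc m → th i ≡ th j → i ≡ j
    th-adj : ∀ i → i ≤ m → th (suc i) ∈ E G (th i)
    only : ∀ i w → i < m → w ∈ E G (th (suc i)) → w ≡ th i ⊎ w ≡ th (2 + i)
    free : ∀ i → i < m → th (suc i) ∉ P
    deg2 : ∀ i → i < m → deg G (th (suc i)) ≡ 2

-- The vertices of `P` are protected: they are neither removed as leaves nor inner vertices of the
-- thread, so they are still present when `small` is reached.
data Reduction {n} (G : PG n) (P : Sub n) (m : ℕ) (bound : ℕ) : Set where
  leaf : ∀ v → v ∈ S G → v ∉ P → deg G v ≡ 1 → Reduction G P m bound
  thread : Thread G P m → Reduction G P m bound
  small : ord G ≤ bound → Reduction G P m bound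

-- B collects the vertices that are marked or of degree other than two. Breadth-first
-- layers around B: past the first layer, every layer consists of unmarked vertices of
-- degree two and is no larger than the one before, so either there are few vertices
-- or layer m + 1 is reached along a thread.
module Layers {n} (G : PG n) (P : Sub n) (m p ℓ : ℕ) (P≤ : count P ≤ p) (sp : Sparse ℓ G)
  (v₀ : Fin n) (v₀S : v₀ ∈ S G)
  (no-leaf : ∀ v → v ∈ S G → v ∉ P → deg G v ≢ 1) where
  private
    -- Adding `v₀` gives the search a starting point even in an unmarked cycle; it costs one in
    -- `suc p`.
    P₀ : Sub n
    P₀ = P ∪ ⁅ v₀ ⁆

    dB : ∀ v → Dec (v ∈ S G × (v ∈ P₀ ⊎ deg G v ≢ 2))
    dB v = mem? (S G) v ×-dec (mem? P₀ v ⊎-dec ¬? (deg G v ≟ 2))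

    B : Sub n
    B = set dB

    dT : ∀ v → Dec (v ∈ S G × v ∉ P₀ × 3 ≤ deg G v)
    dT v = mem? (S G) v ×-dec ¬? (mem? P₀ v) ×-dec (3 ≤? deg G v)

    T : Sub n
    T = set dT

    v₀P₀ : v₀ ∈ P₀
    v₀P₀ = ∈∪ P ⁅ v₀ ⁆ (inj₂ (∈⁅⁆ refl))

    inner : ∀ {v} → v ∈ S G → v ∉ B → v ∉ P × deg G v ≡ 2
    inner {v} vS vB = (λ e → vB (∈set dB (vS , inj₁ (∈∪ P ⁅ v₀ ⁆ (inj₁ e))))) , d2
      where
      d2 : deg G v ≡ 2
      d2 = case deg G v ≟ 2 of λ where
        (yes e) → e
        (no ne) → ⊥-elim (vB (∈set dB (vS , inj₂ ne)))

    positive : ∀ v → v ∈ S G → v ∉ P₀ → 1 ≤ deg G v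
    positive v vS vP with conn G ⁅ v ⁆ vS (∈⁅⁆ refl) v₀S (λ e → vP (subst (_∈ P₀) (⁅⁆∈ e) v₀P₀))
    ... | a , b , ab , av , _ = subst (λ z → 1 ≤ deg G z) (⁅⁆∈ av) (∈⇒0<count (E G a) ab)

    3≤deg : ∀ v → v ∈ S G → v ∉ P₀ → deg G v ≢ 2 → 3 ≤ deg G v
    3≤deg v vS vP ne with deg G v | positive v vS vP | no-leaf v vS (λ e → vP (∈∪ P ⁅ v₀ ⁆ (inj₁ e)))
    ... | 1 | _ | h = ⊥-elim (h refl)
    ... | 2 | _ | _ = ⊥-elim (ne refl)
    ... | suc (suc (suc d)) | _ | _ = s≤s (s≤s (s≤s z≤n))

    P₀≤ : count P₀ ≤ suc p
    P₀≤ = ≤-trans (count-∪⁅⁆ P v₀) (s≤s P≤)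

    sum-2* : (q : Sub n) → sum (λ v → 2 * ⟦ q v ⟧) ≡ 2 * count q
    sum-2* q = begin
      sum (λ v → 2 * ⟦ q v ⟧) ≡⟨ sum-cong-≗ (λ v → cong (⟦ q v ⟧ +_) (+-identityʳ ⟦ q v ⟧)) ⟩
      sum (λ v → ⟦ q v ⟧ + ⟦ q v ⟧) ≡⟨ ∑-distrib-+ (λ v → ⟦ q v ⟧) (λ v → ⟦ q v ⟧) ⟩
      sum (λ v → ⟦ q v ⟧) + sum (λ v → ⟦ q v ⟧) ≡⟨ cong₂ _+_ (sym (count-def q)) (trans (sym (count-def q)) (sym (+-identityʳ _))) ⟩
      2 * count q ∎
      where open ≡-Reasoning

    -- Degrees are compared with two. Outside `P₀` none is smaller, a vertex of `P₀` falls short by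
    -- at most two, and the total surplus is at most 2ℓ.
    T≤ : count T ≤ 2 * ℓ + 2 * count P₀
    T≤ = +-cancelˡ-≤ (2 * ord G) _ _ (begin
      2 * ord G + count T ≡⟨ cong₂ _+_ (sym (sum-2* (S G))) (count-def T) ⟩
      sum (λ v → 2 * ⟦ S G v ⟧) + sum (λ v → ⟦ T v ⟧) ≡⟨ sym (∑-distrib-+ (λ v → 2 * ⟦ S G v ⟧) (λ v → ⟦ T v ⟧)) ⟩
      sum (λ v → 2 * ⟦ S G v ⟧ + ⟦ T v ⟧) ≤⟨ sum-mono pt ⟩
      sum (λ v → deg G v + 2 * ⟦ P₀ v ⟧) ≡⟨ ∑-distrib-+ (deg G) (λ v → 2 * ⟦ P₀ v ⟧) ⟩
      degsum G + sum (λ v → 2 * ⟦ P₀ v ⟧) ≡⟨ cong (degsum G +_) (sum-2* P₀) ⟩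
      degsum G + 2 * count P₀ ≤⟨ +-monoˡ-≤ _ sp ⟩
      2 * (ord G + ℓ) + 2 * count P₀ ≡⟨ lem (ord G) ℓ (count P₀) ⟩
      2 * ord G + (2 * ℓ + 2 * count P₀) ∎)
      where
      open ≤-Reasoning
      lem : ∀ a b c → 2 * (a + b) + 2 * c ≡ 2 * a + (2 * b + 2 * c)
      lem = solve-∀
      pt : ∀ v → 2 * ⟦ S G v ⟧ + ⟦ T v ⟧ ≤ deg G v + 2 * ⟦ P₀ v ⟧
      pt v = case mem? (S G) v of λ where
        (no vS) → ≤-trans (≤-reflexive (cong₂ (λ a b → 2 * a + b) (⟦∉⟧ vS) (⟦∉⟧ (λ e → vS (proj₁ (set∈ dT e)))))) z≤n
        (yes vS) → case mem? P₀ v of λ where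
          (yes vP) → ≤-trans (≤-reflexive (cong₂ (λ a b → 2 * a + b) (⟦∈⟧ vS) (⟦∉⟧ (λ e → proj₁ (proj₂ (set∈ dT e)) vP))))
                       (≤-trans (≤-reflexive (cong (2 *_) (sym (⟦∈⟧ vP)))) (m≤n+m _ (deg G v)))
          (no vP) → ≤-trans (case deg G v ≟ 2 of λ where
              (yes e) → ≤-trans (≤-reflexive (cong₂ (λ a b → 2 * a + b) (⟦∈⟧ vS)
                          (⟦∉⟧ (λ h → case subst (3 ≤_) e (proj₂ (proj₂ (set∈ dT h))) of λ { (s≤s (s≤s ())) }))))
                          (≤-reflexive (sym e))
              (no ne) → ≤-trans (+-mono-≤ (≤-reflexive (cong (2 *_) (⟦∈⟧ vS))) (⟦⟧≤1 (T v))) (3≤deg v vS vP ne))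
            (m≤m+n _ _)

    B≤ : count B ≤ count P₀ + count T
    B≤ = count-≤+ B P₀ T λ v e → let vS , h = set∈ dB e in case mem? P₀ v of λ where
      (yes a) → inj₁ a
      (no na) → inj₂ (∈set dT (vS , na , 3≤deg v vS na (case h of λ where
        (inj₁ a) → ⊥-elim (na a)
        (inj₂ ne) → ne)))

    dQ : ∀ u v → Dec (u ∈ B × v ∈ E G u)
    dQ u v = mem? B u ×-dec mem? (E G u) v

    β : ℕ
    β = sum (λ u → count (set (dQ u)))

    -- All vertices outside `B` have degree exactly two, so the surplus of at most 2ℓ is
    -- concentrated on `B`.
    β≤ : β ≤ 2 * ℓ + 2 * count B
    β≤ = +-cancelˡ-≤ (2 * ord G) _ _ (begin
      2 * ord G + β ≡⟨ cong (_+ β) (sym (sum-2* (S G))) ⟩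
      sum (λ v → 2 * ⟦ S G v ⟧) + β ≡⟨ sym (∑-distrib-+ (λ v → 2 * ⟦ S G v ⟧) (λ u → count (set (dQ u)))) ⟩
      sum (λ v → 2 * ⟦ S G v ⟧ + count (set (dQ v))) ≤⟨ sum-mono pt ⟩
      sum (λ v → deg G v + 2 * ⟦ B v ⟧) ≡⟨ ∑-distrib-+ (deg G) (λ v → 2 * ⟦ B v ⟧) ⟩
      degsum G + sum (λ v → 2 * ⟦ B v ⟧) ≡⟨ cong (degsum G +_) (sum-2* B) ⟩
      degsum G + 2 * count B ≤⟨ +-monoˡ-≤ _ sp ⟩
      2 * (ord G + ℓ) + 2 * count B ≡⟨ lem (ord G) ℓ (count B) ⟩
      2 * ord G + (2 * ℓ + 2 * count B) ∎)
      where
      open ≤-Reasoning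
      lem : ∀ a b c → 2 * (a + b) + 2 * c ≡ 2 * a + (2 * b + 2 * c)
      lem = solve-∀
      pt : ∀ v → 2 * ⟦ S G v ⟧ + count (set (dQ v)) ≤ deg G v + 2 * ⟦ B v ⟧
      pt v = case mem? B v of λ where
        (yes vB) → ≤-trans (+-mono-≤ (*-monoʳ-≤ 2 (≤-trans (⟦⟧≤1 (S G v)) (1≤⟦⟧ vB)))
                      (count-mono (set (dQ v)) (E G v) (λ w e → proj₂ (set∈ (dQ v) e))))
                     (≤-reflexive (+-comm _ (deg G v)))
        (no vB) → ≤-trans (≤-reflexive (trans (cong (2 * ⟦ S G v ⟧ +_)
                       (count-empty (set (dQ v)) (λ w e → vB (proj₁ (set∈ (dQ v) e))))) (+-identityʳ _)))
          (≤-trans (case mem? (S G) v of λ where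
              (yes vS) → ≤-reflexive (trans (cong (2 *_) (⟦∈⟧ vS)) (sym (proj₂ (inner vS vB))))
              (no vS) → ≤-trans (≤-reflexive (cong (2 *_) (⟦∉⟧ vS))) z≤n) (m≤m+n _ _))

    dN : ∀ (X : Sub n) v → Dec (v ∈ X ⊎ ∃[ u ] u ∈ X × v ∈ E G u)
    dN X v = mem? X v ⊎-dec any? (λ u → mem? X u ×-dec mem? (E G u) v)

    R : ℕ → Sub n
    R zero = B
    R (suc i) = set (dN (R i))

    Lay : ℕ → Sub n
    Lay zero = B
    Lay (suc i) = R (suc i) ∖ R i

    R-step : ∀ i → R i ⊆ R (suc i)
    R-step i v e = ∈set (dN (R i)) (inj₁ e)

    R-mono : ∀ {i j} → i ≤ j → R i ⊆ R j
    R-mono {i} {zero} z≤n v e = e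
    R-mono {i} {suc j} le v e with m≤n⇒m<n∨m≡n le
    ... | inj₁ (s≤s lt) = R-step j v (R-mono lt v e)
    ... | inj₂ refl = e

    Lay⊆R : ∀ i → Lay i ⊆ R i
    Lay⊆R zero v e = e
    Lay⊆R (suc i) v e = proj₁ (∖∈ (R (suc i)) (R i) e)

    Lay-disjoint : ∀ {i j} → i < j → ∀ v → v ∈ Lay i → v ∉ Lay j
    Lay-disjoint {i} {suc j} (s≤s le) v a b = proj₂ (∖∈ (R (suc j)) (R j) b) (R-mono le v (Lay⊆R i v a))

    Lay-pred : ∀ i v → v ∈ Lay (suc i) → ∃[ u ] u ∈ Lay i × v ∈ E G u
    Lay-pred i v e with ∖∈ (R (suc i)) (R i) e
    ... | a , b with set∈ (dN (R i)) a
    ...   | inj₁ h = ⊥-elim (b h)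
    ...   | inj₂ (u , uR , uv) = u , lay i uR b , uv
      where
      lay : ∀ i → u ∈ R i → v ∉ R i → u ∈ Lay i
      lay zero h _ = h
      lay (suc i) h vi = ∈∖ (R (suc i)) (R i) h (λ u∈ → vi (∈set (dN (R i)) (inj₂ (u , u∈ , uv))))

    Lay-inner : ∀ i v → v ∈ Lay (suc i) → v ∈ S G × v ∉ B × v ∉ P × deg G v ≡ 2
    Lay-inner i v e =
      let u , uL , uv = Lay-pred i v e
          vB = λ h → proj₂ (∖∈ (R (suc i)) (R i) e) (R-mono {0} {i} z≤n v h)
      in E-S′ G uv , vB , inner (E-S′ G uv) vB

    Lay₁≤ : count (Lay 1) ≤ β
    Lay₁≤ = count-⋃ (Lay 1) (λ u → set (dQ u))
      (λ v e → let u , uB , uv = Lay-pred 0 v e in u , ∈set (dQ u) (uB , uv))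

    dL : ∀ i u v → Dec (u ∈ Lay (suc i) × v ∈ E G u × v ∈ Lay (2 + i))
    dL i u v = mem? (Lay (suc i)) u ×-dec mem? (E G u) v ×-dec mem? (Lay (2 + i)) v

    -- A vertex past the start has degree two and spends one edge on the layer before, so at most
    -- one edge leads on.
    Lay-shrinks : ∀ i → count (Lay (2 + i)) ≤ count (Lay (suc i))
    Lay-shrinks i = ≤-trans
      (count-⋃ (Lay (2 + i)) (λ u → set (dL i u))
        (λ v e → let u , uL , uv = Lay-pred (suc i) v e in u , ∈set (dL i u) (uL , uv , e)))
      (≤-trans (sum-mono pt) (≤-reflexive (sym (count-def (Lay (suc i))))))
      where
      pt : ∀ u → count (set (dL i u)) ≤ ⟦ Lay (suc i) u ⟧
      pt u = case mem? (Lay (suc i)) u of λ where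
        (no h) → ≤-trans (≤-reflexive (count-empty (set (dL i u)) (λ v e → h (proj₁ (set∈ (dL i u) e))))) z≤n
        (yes h) → let u′ , u′L , u′u = Lay-pred i u h
                      d2 = proj₂ (proj₂ (proj₂ (Lay-inner i u h))) in
          ≤-trans (+-cancelʳ-≤ 1 (count (set (dL i u))) 1
            (≤-trans (+-monoʳ-≤ (count (set (dL i u))) (∈⇒0<count ⁅ u′ ⁆ (∈⁅⁆ refl)))
              (≤-trans (count-+≤ (set (dL i u)) ⁅ u′ ⁆ (E G u)
                (λ v e → proj₁ (proj₂ (set∈ (dL i u) e)))
                (λ v e → subst (_∈ E G u) (sym (⁅⁆∈ e)) (E-sym G u′u))
                (λ v a b → Lay-disjoint {i} {2 + i} (m≤n⇒m≤1+n ≤-refl) v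
                   (subst (_∈ Lay i) (sym (⁅⁆∈ b)) u′L) (proj₂ (proj₂ (set∈ (dL i u) a)))))
                (≤-reflexive d2)))) (1≤⟦⟧ h)

    Lay≤ : ∀ i → count (Lay (suc i)) ≤ β
    Lay≤ zero = Lay₁≤
    Lay≤ (suc i) = ≤-trans (Lay-shrinks i) (Lay≤ i)

    R≤ : ∀ i → count (R i) ≤ count B + i * β
    R≤ zero = ≤-reflexive (sym (+-identityʳ _))
    R≤ (suc i) = begin
      count (R (suc i)) ≤⟨ count-∖ (R (suc i)) (R i) ⟩
      count (Lay (suc i)) + count (R i) ≤⟨ +-mono-≤ (Lay≤ i) (R≤ i) ⟩
      β + (count B + i * β) ≡⟨ lem β (count B) (i * β) ⟩
      count B + suc i * β ∎
      where
      open ≤-Reasoning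
      lem : ∀ a b c → a + (b + c) ≡ b + (a + c)
      lem = solve-∀

    chain : ∀ i v → v ∈ Lay i → Σ (ℕ → Fin n) λ th → th i ≡ v × (∀ j → j ≤ i → th j ∈ Lay j) ×
      (∀ j → j < i → th (suc j) ∈ E G (th j))
    chain zero v e = (λ _ → v) , refl , (λ { zero z≤n → e }) , λ _ ()
    chain (suc i) v e with Lay-pred i v e
    ... | u , uL , uv with chain i u uL
    ...   | th , th-i , lay , ad = th′ , at-top , lay′ , ad′
      where
      th′ : ℕ → Fin n
      th′ j = case j ≟ suc i of λ where
        (yes _) → v
        (no _) → th j
      at-top : th′ (suc i) ≡ v
      at-top with suc i ≟ suc i
      ... | yes _ = refl
      ... | no ne = ⊥-elim (ne refl)
      below : ∀ j → j ≤ i → th′ j ≡ th j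
      below j le with j ≟ suc i
      ... | yes refl = ⊥-elim (<-irrefl refl le)
      ... | no _ = refl
      lay′ : ∀ j → j ≤ suc i → th′ j ∈ Lay j
      lay′ j le with m≤n⇒m<n∨m≡n le
      ... | inj₁ (s≤s le′) = subst (_∈ Lay j) (sym (below j le′)) (lay j le′)
      ... | inj₂ refl = subst (_∈ Lay j) (sym at-top) e
      ad′ : ∀ j → j < suc i → th′ (suc j) ∈ E G (th′ j)
      ad′ j (s≤s le) with m≤n⇒m<n∨m≡n le
      ... | inj₁ lt = subst₂ (λ a b → b ∈ E G a) (sym (below j le)) (sym (below (suc j) lt)) (ad j lt)
      ... | inj₂ refl = subst₂ (λ a b → b ∈ E G a) (sym (trans (below j le) th-i)) (sym at-top) uv

    toThread : ∀ v → v ∈ Lay (suc m) → Thread G P m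
    toThread v e with chain (suc m) v e
    ... | th , _ , lay , ad = record
      { th = th
      ; th-inj = λ i j le le′ eq → case <-cmp i j of λ where
          (tri< lt _ _) → ⊥-elim (Lay-disjoint lt (th j) (subst (_∈ Lay i) eq (lay i le)) (lay j le′))
          (tri≈ _ e _) → e
          (tri> _ _ lt) → ⊥-elim (Lay-disjoint lt (th i) (subst (_∈ Lay j) (sym eq) (lay j le′)) (lay i le))
      ; th-adj = λ i le → ad i (s≤s le)
      ; only = λ i w lt we → case w ≟F th i of λ where
          (yes h) → inj₁ h
          (no h) → case w ≟F th (2 + i) of λ where
            (yes h′) → inj₂ h′
            (no h′) → ⊥-elim (<⇒≱ (3≤count (E G (th (suc i))) {th i} {th (2 + i)} {w}
                 (E-sym G (ad i (m≤n⇒m≤1+n lt))) (ad (suc i) (s≤s lt)) we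
                 (λ eq → Lay-disjoint {i} {2 + i} (m≤n⇒m≤1+n ≤-refl) (th i) (lay i (m≤n⇒m≤1+n (<⇒≤ lt)))
                    (subst (_∈ Lay (2 + i)) (sym eq) (lay (2 + i) (s≤s lt)))) h h′)
                 (≤-reflexive (proj₂ (proj₂ (proj₂ (Lay-inner i _ (lay (suc i) (m≤n⇒m≤1+n lt))))))))
      ; free = λ i lt → proj₁ (proj₂ (proj₂ (Lay-inner i _ (lay (suc i) (m≤n⇒m≤1+n lt)))))
      ; deg2 = λ i lt → proj₂ (proj₂ (proj₂ (Lay-inner i _ (lay (suc i) (m≤n⇒m≤1+n lt)))))
      }

    -- From |B| ≤ 3(p + 1) + 2ℓ follows β ≤ 2ℓ + 2|B| ≤ 6(p + 1) + 6ℓ. The same number bounds `B`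
    -- itself, which accounts for the factor `suc m`.
    final-bound : count (R m) ≤ suc m * (6 * suc p + 6 * ℓ)
    final-bound = begin
      count (R m) ≤⟨ R≤ m ⟩
      count B + m * β ≤⟨ +-mono-≤ B≤′ (*-monoʳ-≤ m β≤′) ⟩
      suc m * (6 * suc p + 6 * ℓ) ∎
      where
      open ≤-Reasoning
      p₀ = count P₀
      B≤3 : count B ≤ 3 * suc p + 2 * ℓ
      B≤3 = begin
        count B ≤⟨ B≤ ⟩
        p₀ + count T ≤⟨ +-monoʳ-≤ p₀ T≤ ⟩
        p₀ + (2 * ℓ + 2 * p₀) ≡⟨ lem p₀ ℓ ⟩
        3 * p₀ + 2 * ℓ ≤⟨ +-monoˡ-≤ (2 * ℓ) (*-monoʳ-≤ 3 P₀≤) ⟩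
        3 * suc p + 2 * ℓ ∎
        where
        lem : ∀ a b → a + (2 * b + 2 * a) ≡ 3 * a + 2 * b
        lem = solve-∀
      B≤′ : count B ≤ 6 * suc p + 6 * ℓ
      B≤′ = ≤-trans B≤3 (+-mono-≤ (*-monoˡ-≤ (suc p) {3} {6} (s≤s (s≤s (s≤s z≤n)))) (*-monoˡ-≤ ℓ {2} {6} (s≤s (s≤s z≤n))))
      β≤′ : β ≤ 6 * suc p + 6 * ℓ
      β≤′ = begin
        β ≤⟨ β≤ ⟩
        2 * ℓ + 2 * count B ≤⟨ +-monoʳ-≤ (2 * ℓ) (*-monoʳ-≤ 2 B≤3) ⟩
        2 * ℓ + 2 * (3 * suc p + 2 * ℓ) ≡⟨ lem (suc p) ℓ ⟩
        6 * suc p + 6 * ℓ ∎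
        where
        lem : ∀ a b → 2 * b + 2 * (3 * a + 2 * b) ≡ 6 * a + 6 * b
        lem = solve-∀

  layers : Reduction G P m (suc m * (6 * suc p + 6 * ℓ))
  layers with any? (λ v → mem? (S G) v ×-dec ¬? (mem? (R m) v))
  ... | no h = small (≤-trans (count-mono (S G) (R m) (λ v e → case mem? (R m) v of λ where
                 (yes a) → a
                 (no na) → ⊥-elim (h (v , e , na)))) final-bound)
  -- Some vertex is out of reach of m steps, so by connectedness an edge leaves `R m`, and it ends
  -- in layer m + 1.
  ... | yes (v , vS , vR) with conn G (R m) v₀S (R-mono {0} {m} z≤n v₀ (∈set dB (v₀S , inj₁ v₀P₀))) vS vR
  ...   | a , b , ab , aR , bR = thread (toThread b (∈∖ (R (suc m)) (R m) (∈set (dN (R m)) (inj₂ (a , aR , ab))) bR))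

reduction : ∀ {n} (G : PG n) (P : Sub n) m p ℓ → count P ≤ p → Sparse ℓ G →
  Reduction G P m (suc m * (6 * suc p + 6 * ℓ))
reduction G P m p ℓ P≤ sp with any? (λ v → mem? (S G) v ×-dec ¬? (mem? P v) ×-dec (deg G v ≟ 1))
... | yes (v , a , b , c) = leaf v a b c
... | no h with any? (mem? (S G))
...   | no e = small (≤-trans (≤-reflexive (count-empty (S G) (λ v vS → e (v , vS)))) z≤n)
...   | yes (v₀ , v₀S) = Layers.layers G P m p ℓ P≤ sp v₀ v₀S (λ v a b c → h (v , a , b , c))

-- Partial red embeddings into the host

-- A blue graph b on a nonempty host. It is irreflexive, so "red" means "not blue" and a
-- vertex counts as red to itself.
record BlueGraph (N : ℕ) : Set where
  field
    b : Fin N → Sub N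
    b-sym : ∀ {x y} → y ∈ b x → x ∈ b y
    b-irr : ∀ {x} → x ∉ b x
    y₀ : Fin N

module Host {N : ℕ} (host : BlueGraph N) where
  open BlueGraph host

  -- Only the values of `φ` on `D` count. The constraint `C` travels with the embedding, so that
  -- later steps know in which region each vertex was put.
  record Emb {n} (G : PG n) (D : Sub n) (C : Fin n → Fin N → Set) : Set where
    field
      φ : Fin n → Fin N
      inj : ∀ {u v} → u ∈ D → v ∈ D → φ u ≡ φ v → u ≡ v
      red : ∀ {u v} → u ∈ D → v ∈ D → v ∈ E G u → φ v ∉ b (φ u)
      con : ∀ {u} → u ∈ D → C u (φ u)

  open Emb

  Clique : Sub N → Set
  Clique A = ∀ x y → x ∈ A → y ∈ A → y ∉ b x

  Near : Sub N → ℕ → Set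
  Near A κ = ∀ a → a ∈ A → count (A ∩ b a) ≤ κ

  module _ {n} (G : PG n) {C : Fin n → Fin N → Set} where

    restrict : ∀ {D D′} → D′ ⊆ D → Emb G D C → Emb G D′ C
    restrict s e = record { φ = φ e ; inj = λ a c → inj e (s _ a) (s _ c)
                          ; red = λ a c → red e (s _ a) (s _ c) ; con = λ a → con e (s _ a) }

    empty-emb : Emb G ∅ C
    empty-emb = record { φ = λ _ → y₀ ; inj = λ () ; red = λ () ; con = λ () }

    module _ {D : Sub n} (e : Emb G D C) (v : Fin n) (v∉D : v ∉ D) (y : Fin N) (Cvy : C v y)
             (unused : ∀ u → u ∈ D → φ e u ≢ y) (ok : ∀ u → u ∈ D → v ∈ E G u → y ∉ b (φ e u)) where
      private
        ψ : Fin n → Fin N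
        ψ u = case u ≟F v of λ where
          (yes _) → y
          (no _) → φ e u
        ψv : ψ v ≡ y
        ψv with v ≟F v
        ... | yes _ = refl
        ... | no ne = ⊥-elim (ne refl)
        ψD : ∀ {u} → u ∈ D → ψ u ≡ φ e u
        ψD {u} uD with u ≟F v
        ... | yes refl = ⊥-elim (v∉D uD)
        ... | no ne = refl
        view : ∀ {u} → u ∈ D ∪ ⁅ v ⁆ → u ∈ D ⊎ u ≡ v
        view a = [ inj₁ , inj₂ ∘ ⁅⁆∈ ]′ (∪∈ D ⁅ v ⁆ a)

      extend : Emb G (D ∪ ⁅ v ⁆) C
      extend .φ = ψ
      extend .inj {u} {w} a c h with view a | view c
      ... | inj₁ uD | inj₁ wD = inj e uD wD (trans (sym (ψD uD)) (trans h (ψD wD)))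
      ... | inj₁ uD | inj₂ refl = ⊥-elim (unused u uD (trans (sym (ψD uD)) (trans h ψv)))
      ... | inj₂ refl | inj₁ wD = ⊥-elim (unused w wD (trans (sym (ψD wD)) (trans (sym h) ψv)))
      ... | inj₂ refl | inj₂ refl = refl
      extend .red {u} {w} a c h with view a | view c
      ... | inj₁ uD | inj₁ wD = subst₂ (λ p q → q ∉ b p) (sym (ψD uD)) (sym (ψD wD)) (red e uD wD h)
      ... | inj₁ uD | inj₂ refl = subst₂ (λ p q → q ∉ b p) (sym (ψD uD)) (sym ψv) (ok u uD h)
      ... | inj₂ refl | inj₁ wD = subst₂ (λ p q → q ∉ b p) (sym ψv) (sym (ψD wD)) (λ r → ok w wD (E-sym G h) (b-sym r))
      ... | inj₂ refl | inj₂ refl = ⊥-elim (E-irr G h)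
      extend .con {u} a with view a
      ... | inj₁ uD = subst (C u) (sym (ψD uD)) (con e uD)
      ... | inj₂ refl = subst (C u) (sym ψv) Cvy

    Available : ∀ {D} → Emb G D C → Fin n → Set
    Available {D} e v = ∃[ y ] C v y × (∀ u → u ∈ D → φ e u ≢ y) × (∀ u → u ∈ D → v ∈ E G u → y ∉ b (φ e u))

    -- The hypothesis covers every intermediate domain, so the vertices of `T` may come in any
    -- order.
    greedy : (D₀ T : Sub n) →
      (∀ D → D₀ ⊆ D → D ⊆ D₀ ∪ T → (e : Emb G D C) → ∀ v → v ∈ T → v ∉ D → Available e v) →
      Emb G D₀ C → Emb G (D₀ ∪ T) C
    greedy D₀ T step e₀ = go (count ((D₀ ∪ T) ∖ D₀)) D₀ (λ _ a → a) (λ _ a → ∈∪ D₀ T (inj₁ a)) ≤-refl e₀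
      where
      go : ∀ fuel D → D₀ ⊆ D → D ⊆ D₀ ∪ T → count ((D₀ ∪ T) ∖ D) ≤ fuel → Emb G D C → Emb G (D₀ ∪ T) C
      go fuel D lo hi le e with any? (λ v → mem? T v ×-dec ¬? (mem? D v))
      ... | no h = restrict (λ v a → case mem? D v of λ where
              (yes vD) → vD
              (no vD) → [ lo v , (λ vT → ⊥-elim (h (v , vT , vD))) ]′ (∪∈ D₀ T a)) e
      ... | yes (v , vT , vD) with fuel | step D lo hi e v vT vD
      ...   | zero | _ = ⊥-elim (<⇒≱ (∈⇒0<count ((D₀ ∪ T) ∖ D) (∈∖ (D₀ ∪ T) D (∈∪ D₀ T (inj₂ vT)) vD)) le)
      ...   | suc fuel′ | y , Cvy , unused , ok =
        go fuel′ (D ∪ ⁅ v ⁆) (λ u a → ∈∪ D ⁅ v ⁆ (inj₁ (lo u a)))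
          (λ u a → [ hi u , (λ a → ∈∪ D₀ T (inj₂ (subst (_∈ T) (sym (⁅⁆∈ a)) vT))) ]′ (∪∈ D ⁅ v ⁆ a))
          (≤-pred (≤-trans (s≤s (count-mono ((D₀ ∪ T) ∖ (D ∪ ⁅ v ⁆)) (((D₀ ∪ T) ∖ D) ∖ ⁅ v ⁆)
              (λ u a → let a₁ , a₂ = ∖∈ (D₀ ∪ T) (D ∪ ⁅ v ⁆) a in
                 ∈∖ ((D₀ ∪ T) ∖ D) ⁅ v ⁆ (∈∖ (D₀ ∪ T) D a₁ (λ z → a₂ (∈∪ D ⁅ v ⁆ (inj₁ z)))) (λ z → a₂ (∈∪ D ⁅ v ⁆ (inj₂ z))))))
            (≤-trans (count-∖⁅⁆ ((D₀ ∪ T) ∖ D) (∈∖ (D₀ ∪ T) D (∈∪ D₀ T (inj₂ vT)) vD)) le)))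
          (extend e v vD y Cvy unused ok)

    -- At most |D| places of `H` are occupied, and each embedded neighbour of `v` forbids at most
    -- `κ` more; `Q` is any set containing these neighbours.
    available : ∀ {D} (e : Emb G D C) v (H : Sub N) (Q : Sub n) κ →
      (∀ u → u ∈ D → v ∈ E G u → u ∈ Q × count (H ∩ b (φ e u)) ≤ κ) →
      count D + count Q * κ < count H →
      ∃[ y ] y ∈ H × (∀ u → u ∈ D → φ e u ≢ y) × (∀ u → u ∈ D → v ∈ E G u → y ∉ b (φ e u))
    available {D} e v H Q κ hyp lt =
      let y , yH , y∉ = count-pick H (X₁ ∪ X₂) (≤-<-trans (≤-trans (count-≤+ (X₁ ∪ X₂) X₁ X₂ (λ y → ∪∈ X₁ X₂)) (+-mono-≤ X₁≤ X₂≤)) lt)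
      in y , yH , (λ u uD h → y∉ (∈∪ X₁ X₂ (inj₁ (∈set d₁ (u , uD , h))))) ,
         (λ u uD vu yb → y∉ (∈∪ X₁ X₂ (inj₂ (∈set d₂ (u , ∈set (d₃ u) (uD , vu , yH , yb))))))
      where
      d₁ : ∀ y → Dec (∃[ u ] u ∈ D × φ e u ≡ y)
      d₁ y = any? (λ u → mem? D u ×-dec (φ e u ≟F y))
      d₃ : ∀ u y → Dec (u ∈ D × v ∈ E G u × y ∈ H × y ∈ b (φ e u))
      d₃ u y = mem? D u ×-dec mem? (E G u) v ×-dec mem? H y ×-dec mem? (b (φ e u)) y
      d₂ : ∀ y → Dec (∃[ u ] y ∈ set (d₃ u))
      d₂ y = any? (λ u → mem? (set (d₃ u)) y)
      X₁ X₂ : Sub N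
      X₁ = set d₁
      X₂ = set d₂
      X₁≤ : count X₁ ≤ count D
      X₁≤ = count-image D X₁ (φ e) (λ y → set∈ d₁)
      X₂≤ : count X₂ ≤ count Q * κ
      X₂≤ = ≤-trans (count-⋃ X₂ (λ u → set (d₃ u)) (λ y → set∈ d₂))
        (sum-weight Q
          (λ u uQ → case (mem? D u ×-dec mem? (E G u) v) of λ where
             (yes (uD , vu)) → ≤-trans (count-mono (set (d₃ u)) (H ∩ b (φ e u)) (λ y a →
                 let _ , _ , a₁ , a₂ = set∈ (d₃ u) a in ∈∩ H (b (φ e u)) a₁ a₂)) (proj₂ (hyp u uD vu))
             (no h) → ≤-trans (≤-reflexive (count-empty (set (d₃ u)) (λ y a →
                 let a₁ , a₂ , _ = set∈ (d₃ u) a in h (a₁ , a₂)))) z≤n)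
          (λ u u∉Q → count-empty (set (d₃ u)) (λ y a →
             let a₁ , a₂ , _ = set∈ (d₃ u) a in u∉Q (proj₁ (hyp u a₁ a₂)))))

  -- Everything goes into `A`, and the marked vertices into the smaller region `A₁`.
  In : ∀ {n} → Sub N → Sub n → Sub N → Fin n → Fin N → Set
  In A P A₁ v y = y ∈ A × (v ∈ P → y ∈ A₁)

  EmbIn : ∀ {n} → Sub N → PG n → Set
  EmbIn A G = Emb G (S G) (In A ∅ ∅)

  ∅∪⊆ : ∀ {n} (T : Sub n) → ∅ ∪ T ⊆ T
  ∅∪⊆ T x a = [ (λ ()) , id ]′ (∪∈ ∅ T a)

  count< : ∀ {n} (p q : Sub n) {v} → p ⊆ q → v ∈ q → v ∉ p → count p < count q
  count< p q {v} s vq vp = ≤-trans (s≤s (count-mono p (q ∖ ⁅ v ⁆)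
    (λ x a → ∈∖⁅⁆ q (s x a) (λ { refl → vp a })))) (count-∖⁅⁆ q vq)

  -- Each placed vertex excludes itself and at most `κ` blue neighbours, hence the factor κ + 1.
  -- Marked vertices come first, before others can occupy `A₁`.
  embed-near : ∀ {n} (G : PG n) A κ P A₁ → Near A κ → A₁ ⊆ A → count P * suc κ ≤ count A₁ →
    ord G * suc κ ≤ count A → Emb G (S G) (In A P A₁)
  embed-near {n} G A κ P A₁ near A₁⊆A P≤ S≤ = restrict G (λ v a → ∈∪ (∅ ∪ T) (S G) (inj₂ a))
      (greedy G (∅ ∪ T) (S G) step₂ (greedy G ∅ T step₁ (empty-emb G)))
    where
    T : Sub n
    T = P ∩ S G
    C : Fin n → Fin N → Set
    C = In A P A₁
    near⊆ : ∀ {H a} → H ⊆ A → a ∈ A → count (H ∩ b a) ≤ κ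
    near⊆ {H} {a} s aA = ≤-trans (count-mono (H ∩ b a) (A ∩ b a)
      (λ y h → let h₁ , h₂ = ∩∈ H (b a) h in ∈∩ A (b a) (s y h₁) h₂)) (near a aA)
    room : ∀ {x y z} → x < y → y * suc κ ≤ z → x + x * κ < z
    room {x} {y} {z} lt le = ≤-trans (s≤s (≤-reflexive (sym (*-suc x κ)))) (≤-trans (≤-trans (+-monoˡ-≤ (x * suc κ) (s≤s z≤n)) (*-monoˡ-≤ (suc κ) lt)) le)
    step₁ : ∀ D → ∅ ⊆ D → D ⊆ ∅ ∪ T → (e : Emb G D C) → ∀ v → v ∈ T → v ∉ D → Available G e v
    step₁ D _ hi e v vT vD =
      let y , yH , un , ok = available G e v A₁ D κ (λ u uD _ → uD , near⊆ A₁⊆A (proj₁ (con e uD)))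
            (room (count< D T (λ x a → ∅∪⊆ T x (hi x a)) vT vD)
              (≤-trans (*-monoˡ-≤ (suc κ) (count-mono T P (λ x a → proj₁ (∩∈ P (S G) a)))) P≤))
      in y , (A₁⊆A y yH , λ _ → yH) , un , ok
    step₂ : ∀ D → (∅ ∪ T) ⊆ D → D ⊆ (∅ ∪ T) ∪ S G → (e : Emb G D C) → ∀ v → v ∈ S G → v ∉ D → Available G e v
    step₂ D lo hi e v vS vD =
      let y , yH , un , ok = available G e v A D κ (λ u uD _ → uD , near⊆ (λ _ a → a) (proj₁ (con e uD)))
            (room (count< D (S G) (λ x a → [ (λ c → proj₂ (∩∈ P (S G) (∅∪⊆ T x c))) , id ]′ (∪∈ (∅ ∪ T) (S G) (hi x a))) vS vD) S≤)
      in y , (yH , λ vP → ⊥-elim (vD (lo v (∈∪ ∅ T (inj₂ (∈∩ P (S G) vP vS)))))) , un , ok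

  embed-clique : ∀ {n} (G : PG n) A → Clique A → ord G ≤ count A → EmbIn A G
  embed-clique G A cl le = embed-near G A 0 ∅ ∅
    (λ a aA → ≤-reflexive (count-empty (A ∩ b a) (λ y h → let h₁ , h₂ = ∩∈ A (b a) h in cl a y aA h₁ h₂)))
    (λ _ ()) (≤-trans (≤-reflexive (cong (_* 1) (count-empty ∅ (λ _ ())))) z≤n)
    (≤-trans (≤-reflexive (*-identityʳ _)) le)

-- Inserting a free vertex into the image of a thread

module SuppressThread {n} (G : PG n) {P : Sub n} {m : ℕ} (2≤m : 2 ≤ m) (T : Thread G P m) where
  open Thread T public

  private
    ≤m : ∀ {i} → i ≤ 2 → i ≤ suc m
    ≤m le = m≤n⇒m≤1+n (≤-trans le 2≤m)

    th≢ : ∀ {i j} → i ≤ suc m → j ≤ suc m → i ≢ j → th i ≢ th j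
    th≢ a c ne e = ne (th-inj _ _ a c e)

    -- For m ≥ 2 the vertex `th 2` is itself inner, with `th 1` and `th 3` as its only neighbours.
    no-chord : th 2 ∉ E G (th 0)
    no-chord e with only 1 (th 0) 2≤m (E-sym G e)
    ... | inj₁ h = th≢ {0} {1} (≤m z≤n) (≤m (s≤s z≤n)) (λ ()) h
    ... | inj₂ h = th≢ {0} {3} (≤m z≤n) (s≤s 2≤m) (λ ()) h

  open Suppress G (th 1) (th 0) (th 2) (E-sym G (th-adj 0 z≤n)) (th-adj 1 (≤-trans (s≤s z≤n) 2≤m))
    (th≢ (≤m z≤n) (≤m ≤-refl) λ ()) (λ x → only 0 x (≤-trans (s≤s z≤n) 2≤m)) no-chord public

  th∈S : ∀ i → i ≤ suc m → th i ∈ S G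
  th∈S zero _ = E-S G (th-adj 0 z≤n)
  th∈S (suc i) (s≤s le) = E-S′ G (th-adj i le)

  th∈S′ : ∀ i → i ≤ suc m → i ≢ 1 → th i ∈ S suppress
  th∈S′ i le ne = ∈∖⁅⁆ (S G) (th∈S i le) (λ e → ne (th-inj i 1 le (≤m (s≤s z≤n)) e))

  -- Suppressing `th 1` leaves the path `th 0`, `th 2`, `th 3`, up to `th (suc m)`; its l-th vertex
  -- has index `pos l`.
  pos : ℕ → ℕ
  pos zero = 0
  pos (suc i) = 2 + i

  pos≤ : ∀ {l} → l ≤ m → pos l ≤ suc m
  pos≤ {zero} _ = z≤n
  pos≤ {suc l} le = s≤s le

  pos≢1 : ∀ l → pos l ≢ 1
  pos≢1 zero ()
  pos≢1 (suc l) ()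

  pos-injective : ∀ {i j} → pos i ≡ pos j → i ≡ j
  pos-injective {zero} {zero} _ = refl
  pos-injective {suc i} {suc j} e = suc-injective e

  pos-adj : ∀ l → l < m → th (pos (suc l)) ∈ E suppress (th (pos l))
  pos-adj zero _ = E-suppress-new
  pos-adj (suc l) lt = E-suppress (th-adj (2 + l) lt) (th≢ (s≤s (<⇒≤ lt)) (≤m (s≤s z≤n)) λ ()) (th≢ (s≤s lt) (≤m (s≤s z≤n)) λ ())

-- The index permutation reversing the block i < l ≤ j.
module Reversal (i j : ℕ) (i<j : i < j) where
  rev : ℕ → ℕ
  rev l = case (i <? l ×-dec l ≤? j) of λ where
    (yes _) → suc (i + j) ∸ l
    (no _) → l

  rev-in : ∀ {l} → i < l → l ≤ j → rev l ≡ suc (i + j) ∸ l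
  rev-in {l} a c with i <? l ×-dec l ≤? j
  ... | yes _ = refl
  ... | no h = ⊥-elim (h (a , c))

  rev-out : ∀ {l} → ¬ (i < l × l ≤ j) → rev l ≡ l
  rev-out {l} h′ with i <? l ×-dec l ≤? j
  ... | yes h = ⊥-elim (h′ h)
  ... | no _ = refl

  rev-low : ∀ {l} → l ≤ i → rev l ≡ l
  rev-low le = rev-out (λ h → <⇒≱ (proj₁ h) le)

  rev-high : ∀ {l} → j < l → rev l ≡ l
  rev-high lt = rev-out (λ h → <⇒≱ lt (proj₂ h))

  private
    block : ∀ {l} → i < l → l ≤ j → i < suc (i + j) ∸ l × suc (i + j) ∸ l ≤ j
    block {l} a c =
      ≤-trans (≤-reflexive (sym (m+n∸n≡m (suc i) l))) (∸-monoˡ-≤ l (s≤s (+-monoʳ-≤ i c)))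
      , ≤-trans (∸-monoʳ-≤ (suc (i + j)) a) (≤-reflexive (m+n∸m≡n i j))

  rev≤ : ∀ {m l} → j ≤ m → l ≤ m → rev l ≤ m
  rev≤ {m} {l} jm lm with i <? l ×-dec l ≤? j
  ... | yes (a , c) = ≤-trans (proj₂ (block a c)) jm
  ... | no _ = lm

  rev-injective : ∀ {l l′} → rev l ≡ rev l′ → l ≡ l′
  rev-injective {l} {l′} e with i <? l ×-dec l ≤? j | i <? l′ ×-dec l′ ≤? j
  ... | yes (a , c) | yes (a′ , c′) = ∸-cancelˡ-≡ (≤-trans c (m≤n⇒m≤1+n (m≤n+m j i))) (≤-trans c′ (m≤n⇒m≤1+n (m≤n+m j i))) e
  ... | yes (a , c) | no h = ⊥-elim (h (subst (λ z → i < z × z ≤ j) e (block a c)))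
  ... | no h | yes (a , c) = ⊥-elim (h (subst (λ z → i < z × z ≤ j) (sym e) (block a c)))
  ... | no _ | no _ = e

module PathInsertion {N : ℕ} (host : BlueGraph N) where
  open BlueGraph host
  open Host host
  open Emb

  BlueClique : Sub N → ℕ → Set
  BlueClique A c = Σ (Fin c → Fin N) λ f → InjSub f × (∀ i → f i ∈ A) × (∀ i j → i ≢ j → f j ∈ b (f i))

  module _ {n} (G : PG n) (P : Sub n) (A A₁ : Sub N) (m : ℕ) (2≤m : 2 ≤ m) (T : Thread G P m) where
    open SuppressThread G 2≤m T

    module _ (e : Emb suppress (S suppress) (In A P A₁)) (y : Fin N) (yA : y ∈ A)
             (unused : ∀ u → u ∈ S suppress → φ e u ≢ y) where

      path : ℕ → Fin N
      path l = φ e (th (pos l))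

      path∈A : ∀ l → l ≤ m → path l ∈ A
      path∈A l le = proj₁ (con e (th∈S′ (pos l) (pos≤ le) (pos≢1 l)))

      path-injective : ∀ {l l′} → l ≤ m → l′ ≤ m → path l ≡ path l′ → l ≡ l′
      path-injective {l} {l′} le le′ h = pos-injective (th-inj (pos l) (pos l′) (pos≤ le) (pos≤ le′)
        (inj e (th∈S′ (pos l) (pos≤ le) (pos≢1 l)) (th∈S′ (pos l′) (pos≤ le′) (pos≢1 l′)) h))

      path-red : ∀ l → l < m → path (suc l) ∉ b (path l)
      path-red l lt = red e (th∈S′ (pos l) (pos≤ (<⇒≤ lt)) (pos≢1 l)) (th∈S′ (pos (suc l)) (pos≤ lt) (pos≢1 (suc l))) (pos-adj l lt)

      path≢y : ∀ l → l ≤ m → path l ≢ y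
      path≢y l le = unused _ (th∈S′ (pos l) (pos≤ le) (pos≢1 l))

      -- Reordering the path by ρ may break it only between positions i and i + 1, where y goes.
      module Insert (ρ : ℕ → ℕ) (ρ≤ : ∀ {l} → l ≤ m → ρ l ≤ m) (ρ-inj : ∀ {l l′} → ρ l ≡ ρ l′ → l ≡ l′)
               (ρ0 : ρ 0 ≡ 0) (ρm : ρ m ≡ m) (i : ℕ) (i<m : i < m)
               (gap : ∀ l → l < m → l ≢ i → path (ρ (suc l)) ∉ b (path (ρ l)))
               (left : y ∉ b (path (ρ i))) (right : y ∉ b (path (ρ (suc i)))) where
        private
          w : ℕ → Fin N
          w l = case <-cmp l (suc i) of λ where
            (tri< _ _ _) → path (ρ l)
            (tri≈ _ _ _) → y
            (tri> _ _ _) → path (ρ (pred l))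

          w-low : ∀ {l} → l ≤ i → w l ≡ path (ρ l)
          w-low {l} le with <-cmp l (suc i)
          ... | tri< _ _ _ = refl
          ... | tri≈ h _ _ = ⊥-elim (h (s≤s le))
          ... | tri> h _ _ = ⊥-elim (h (s≤s le))

          w-mid : w (suc i) ≡ y
          w-mid with <-cmp (suc i) (suc i)
          ... | tri< _ h _ = ⊥-elim (h refl)
          ... | tri≈ _ _ _ = refl
          ... | tri> _ h _ = ⊥-elim (h refl)

          w-high : ∀ {l} → i < l → w (suc l) ≡ path (ρ l)
          w-high {l} lt with <-cmp (suc l) (suc i)
          ... | tri< _ _ h = ⊥-elim (h (s≤s lt))
          ... | tri≈ _ _ h = ⊥-elim (h (s≤s lt))
          ... | tri> _ _ _ = refl

          data Pos : ℕ → Set where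
            low : ∀ {l} → l ≤ i → Pos l
            mid : Pos (suc i)
            high : ∀ {l} → i < l → l ≤ m → Pos (suc l)

          place : ∀ {l} → l ≤ suc m → Pos l
          place {l} le with <-cmp l (suc i) | le
          ... | tri< (s≤s h) _ _ | _ = low h
          ... | tri≈ _ refl _ | _ = mid
          ... | tri> _ _ (s≤s h) | s≤s le′ = high h le′

          w-red : ∀ l → l ≤ m → w (suc l) ∉ b (w l)
          w-red l le with <-cmp l i
          ... | tri< lt _ _ = subst₂ (λ p q → q ∉ b p) (sym (w-low (<⇒≤ lt))) (sym (w-low lt))
                                (gap l (<-trans lt i<m) (<⇒≢ lt))
          ... | tri≈ _ refl _ = subst₂ (λ p q → q ∉ b p) (sym (w-low ≤-refl)) (sym w-mid) left
          ... | tri> _ _ (s≤s {n = l′} lt) with m≤n⇒m<n∨m≡n lt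
          ...   | inj₂ refl = subst₂ (λ p q → q ∉ b p) (sym w-mid) (sym (w-high ≤-refl)) (λ h → right (b-sym h))
          ...   | inj₁ lt′ = subst₂ (λ p q → q ∉ b p) (sym (w-high lt′)) (sym (w-high (m≤n⇒m≤1+n lt′)))
                               (gap l′ le (λ { refl → <-irrefl refl lt′ }))

          xρ-inj : ∀ {l l′} → l ≤ m → l′ ≤ m → path (ρ l) ≡ path (ρ l′) → l ≡ l′
          xρ-inj le le′ h = ρ-inj (path-injective (ρ≤ le) (ρ≤ le′) h)

          i≤m : ∀ {l} → l ≤ i → l ≤ m
          i≤m le = ≤-trans le (<⇒≤ i<m)

          w-inj : ∀ {l l′} → l ≤ suc m → l′ ≤ suc m → w l ≡ w l′ → l ≡ l′
          w-inj le le′ h with place le | place le′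
          ... | low a | low c = xρ-inj (i≤m a) (i≤m c) (trans (sym (w-low a)) (trans h (w-low c)))
          ... | low a | mid = ⊥-elim (path≢y _ (ρ≤ (i≤m a)) (trans (sym (w-low a)) (trans h w-mid)))
          ... | low a | high c d = ⊥-elim (<⇒≱ c (subst (_≤ i) (xρ-inj (i≤m a) d (trans (sym (w-low a)) (trans h (w-high c)))) a))
          ... | mid | low c = ⊥-elim (path≢y _ (ρ≤ (i≤m c)) (trans (sym (w-low c)) (trans (sym h) w-mid)))
          ... | mid | mid = refl
          ... | mid | high c d = ⊥-elim (path≢y _ (ρ≤ d) (trans (sym (w-high c)) (trans (sym h) w-mid)))
          ... | high a c | low d = ⊥-elim (<⇒≱ a (subst (_≤ i) (xρ-inj (i≤m d) c (trans (sym (w-low d)) (trans (sym h) (w-high a)))) d))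
          ... | high a c | mid = ⊥-elim (path≢y _ (ρ≤ c) (trans (sym (w-high a)) (trans h w-mid)))
          ... | high a c | high a′ c′ = cong suc (xρ-inj c c′ (trans (sym (w-high a)) (trans h (w-high a′))))

          w∈A : ∀ l → l ≤ suc m → w l ∈ A
          w∈A l le with place le
          ... | low a = subst (_∈ A) (sym (w-low a)) (path∈A _ (ρ≤ (i≤m a)))
          ... | mid = subst (_∈ A) (sym w-mid) yA
          ... | high a c = subst (_∈ A) (sym (w-high a)) (path∈A _ (ρ≤ c))

          w-value : ∀ l → l ≤ suc m → w l ≡ y ⊎ ∃[ q ] q ≤ suc m × q ≢ 1 × w l ≡ φ e (th q)
          w-value l le with place le
          ... | low {l} a = inj₂ (pos (ρ l) , pos≤ (ρ≤ (i≤m a)) , pos≢1 (ρ l) , w-low a)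
          ... | mid = inj₁ w-mid
          ... | high {l} a c = inj₂ (pos (ρ l) , pos≤ (ρ≤ c) , pos≢1 (ρ l) , w-high a)

          inner? : ∀ v → Dec (∃ λ (j : Fin m) → th (suc (toℕ j)) ≡ v)
          inner? v = any? (λ j → th (suc (toℕ j)) ≟F v)

          ψ : Fin n → Fin N
          ψ v = case inner? v of λ where
            (yes (j , _)) → w (suc (toℕ j))
            (no _) → φ e v

          -- The two ends of the thread count as outer. Their images stay put because `ρ` fixes 0
          -- and m, which keeps all edges to the rest of G intact.
          Outer : Fin n → Set
          Outer v = ∀ j → j < m → th (suc j) ≢ v

          j≤ : ∀ (j : Fin m) → suc (toℕ j) ≤ suc m
          j≤ j = s≤s (<⇒≤ (toℕ<n j))

          ψ-inner : ∀ {j} → j < m → ψ (th (suc j)) ≡ w (suc j)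
          ψ-inner {j} lt with inner? (th (suc j))
          ... | yes (j′ , h) = cong w (th-inj _ _ (j≤ j′) (s≤s (<⇒≤ lt)) h)
          ... | no h = ⊥-elim (h (fromℕ< lt , cong (th ∘ suc) (toℕ-fromℕ< lt)))

          ψ-outer : ∀ {v} → Outer v → ψ v ≡ φ e v
          ψ-outer {v} o with inner? v
          ... | yes (j , h) = ⊥-elim (o (toℕ j) (toℕ<n j) h)
          ... | no _ = refl

          view : ∀ v → (∃[ j ] j < m × th (suc j) ≡ v) ⊎ Outer v
          view v with inner? v
          ... | yes (j , h) = inj₁ (toℕ j , toℕ<n j , h)
          ... | no h = inj₂ (λ j lt h′ → h (fromℕ< lt , trans (cong (th ∘ suc) (toℕ-fromℕ< lt)) h′))

          0<m : 0 < m
          0<m = ≤-trans (s≤s z≤n) 2≤m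

          end₀ : ψ (th 0) ≡ w 0
          end₀ = trans (ψ-outer (λ j lt h → case th-inj _ _ (s≤s (<⇒≤ lt)) z≤n h of λ ()))
                   (trans (sym (cong path ρ0)) (sym (w-low z≤n)))

          xm : ∀ m → 0 < m → th (pos m) ≡ th (suc m)
          xm (suc m) _ = refl

          endₘ : ψ (th (suc m)) ≡ w (suc m)
          endₘ = trans (ψ-outer (λ j lt h → <⇒≢ lt (suc-injective (th-inj _ _ (s≤s (<⇒≤ lt)) ≤-refl h))))
                   (trans (sym (cong (φ e) (xm m 0<m))) (trans (sym (cong path ρm)) (sym (w-high i<m))))

          ψ-th : ∀ q → q ≤ suc m → ψ (th q) ≡ w q
          ψ-th zero _ = end₀
          ψ-th (suc q) (s≤s le) with m≤n⇒m<n∨m≡n le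
          ... | inj₁ lt = ψ-inner lt
          ... | inj₂ refl = endₘ

          outer-S : ∀ {v} → v ∈ S G → Outer v → v ∈ S suppress
          outer-S vS o = ∈∖⁅⁆ (S G) vS (λ h → o 0 0<m (sym h))

          mixed : ∀ {j v} → j < m → v ∈ S G → Outer v → ψ (th (suc j)) ≢ ψ v
          mixed {j} {v} lt vS o h with w-value (suc j) (s≤s (<⇒≤ lt))
          ... | inj₁ wy = unused v (outer-S vS o) (trans (sym (ψ-outer o)) (trans (sym h) (trans (ψ-inner lt) wy)))
          ... | inj₂ (q , q≤ , q≢1 , wq) with inj e (th∈S′ q q≤ q≢1) (outer-S vS o)
                                     (trans (sym wq) (trans (sym (ψ-inner lt)) (trans h (ψ-outer o))))
          ...   | refl with w-inj (s≤s (<⇒≤ lt)) q≤ (trans (sym (ψ-inner lt)) (trans h (ψ-th q q≤)))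
          ...     | refl = o j lt refl

          inner-red : ∀ {j v} → j < m → v ∈ E G (th (suc j)) → ψ v ∉ b (ψ (th (suc j)))
          inner-red {j} {v} lt ev with only j v lt ev
          ... | inj₁ refl = subst₂ (λ p q → p ∉ b q) (sym (ψ-th j (≤-trans (<⇒≤ lt) (n≤1+n m)))) (sym (ψ-inner lt))
                              (λ h → w-red j (<⇒≤ lt) (b-sym h))
          ... | inj₂ refl = subst₂ (λ p q → p ∉ b q) (sym (ψ-th (2 + j) (s≤s lt))) (sym (ψ-inner lt)) (w-red (suc j) lt)

        insert : Emb G (S G) (In A P A₁)
        insert .φ = ψ
        insert .inj {u} {v} uS vS h with view u | view v
        ... | inj₁ (j , lt , refl) | inj₁ (j′ , lt′ , refl) =
                cong th (w-inj (s≤s (<⇒≤ lt)) (s≤s (<⇒≤ lt′)) (trans (sym (ψ-inner lt)) (trans h (ψ-inner lt′))))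
        ... | inj₁ (j , lt , refl) | inj₂ o = ⊥-elim (mixed lt vS o h)
        ... | inj₂ o | inj₁ (j , lt , refl) = ⊥-elim (mixed lt uS o (sym h))
        ... | inj₂ o | inj₂ o′ = inj e (outer-S uS o) (outer-S vS o′) (trans (sym (ψ-outer o)) (trans h (ψ-outer o′)))
        insert .red {u} {v} uS vS h with view u | view v
        ... | inj₁ (j , lt , refl) | _ = inner-red lt h
        ... | inj₂ o | inj₁ (j , lt , refl) = λ h′ → inner-red lt (E-sym G h) (b-sym h′)
        ... | inj₂ o | inj₂ o′ = subst₂ (λ p q → q ∉ b p) (sym (ψ-outer o)) (sym (ψ-outer o′))
                (red e (outer-S uS o) (outer-S vS o′) (E-suppress h (λ a → o 0 0<m (sym a)) (λ a → o′ 0 0<m (sym a))))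
        insert .con {u} uS with view u
        ... | inj₁ (j , lt , refl) = subst (_∈ A) (sym (ψ-inner lt)) (w∈A _ (s≤s (<⇒≤ lt))) , λ h → ⊥-elim (free j lt h)
        ... | inj₂ o = subst (λ z → z ∈ A × (u ∈ P → z ∈ A₁)) (sym (ψ-outer o)) (con e (outer-S uS o))

      -- The last path vertex is left out, because a red neighbour helps only together with its
      -- successor on the path.
      reds : Sub m
      reds = set (λ l → ¬? (mem? (b y) (path (toℕ l))))

      -- If y has red neighbours x_i and x_j, i < j, on the red path x_0 x_1 …, then either
      -- x_0 … x_i y x_j … x_{i+1} x_{j+1} … is a longer red path or x_{i+1} x_{j+1} is blue.
      insert-or-few-reds : ∀ c → ¬ BlueClique A (suc c) → Emb G (S G) (In A P A₁) ⊎ count reds < c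
      insert-or-few-reds c noClique with any? (λ l → mem? reds l ×-dec ¬? (mem? (b y) (path (suc (toℕ l)))))
      ... | yes (l , lr , next) = inj₁ (Insert.insert (λ l → l) (λ a → a) (λ a → a) refl refl (toℕ l) (toℕ<n l)
              (λ l lt _ → path-red l lt) (λ h → set∈ dr lr (b-sym h)) (λ h → next (b-sym h)))
        where dr = λ (l : Fin m) → ¬? (mem? (b y) (path (toℕ l)))
      ... | no direct with any? (λ l → any? (λ l′ → mem? reds l ×-dec mem? reds l′ ×-dec (toℕ l <? toℕ l′) ×-dec
                              ¬? (mem? (b (path (suc (toℕ l)))) (path (suc (toℕ l′))))))
      ...   | yes (l , l′ , lr , lr′ , lt , cross) = inj₁ (Insert.insert rev (rev≤ (<⇒≤ j<m)) rev-injective (rev-low z≤n)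
                (rev-high j<m) i (toℕ<n l) gap
                (λ h → set∈ dr lr (b-sym (subst (λ z → y ∈ b (path z)) (rev-low ≤-refl) h)))
                (λ h → set∈ dr lr′ (b-sym (subst (λ z → y ∈ b (path z)) rev-si h))))
        where
        dr = λ (l : Fin m) → ¬? (mem? (b y) (path (toℕ l)))
        i = toℕ l
        j = toℕ l′
        j<m = toℕ<n l′
        open Reversal i j lt
        rev-si : rev (suc i) ≡ j
        rev-si = trans (rev-in ≤-refl lt) (m+n∸m≡n i j)
        gap : ∀ l → l < m → l ≢ i → path (rev (suc l)) ∉ b (path (rev l))
        gap l l<m ne with <-cmp l i
        ... | tri< a _ _ = subst₂ (λ p q → path p ∉ b (path q)) (sym (rev-low a)) (sym (rev-low (<⇒≤ a))) (path-red l l<m)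
        ... | tri≈ _ a _ = ⊥-elim (ne a)
        ... | tri> _ _ i<l with <-cmp l j
        ...   | tri< l<j _ _ = subst₂ (λ p q → path p ∉ b (path q)) (sym (rev-in (m≤n⇒m≤1+n i<l) l<j)) (sym (rev-in i<l (<⇒≤ l<j)))
                  (λ h → subst (λ z → path z ∉ b (path (i + j ∸ l))) (sym (+-∸-assoc 1 l≤)) (path-red (i + j ∸ l) (≤-<-trans (≤-trans (∸-monoʳ-≤ (i + j) (<⇒≤ i<l)) (≤-reflexive (m+n∸m≡n i j))) j<m)) (b-sym h))
          where
          l≤ : l ≤ i + j
          l≤ = ≤-trans (<⇒≤ l<j) (m≤n+m j i)
        ...   | tri≈ _ refl _ = subst₂ (λ p q → path p ∉ b (path q)) (sym (rev-high ≤-refl))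
                  (sym (trans (rev-in i<l ≤-refl) (m+n∸n≡m (suc i) l))) cross
        ...   | tri> _ _ j<l = subst₂ (λ p q → path p ∉ b (path q)) (sym (rev-high (m≤n⇒m≤1+n j<l))) (sym (rev-high j<l)) (path-red l l<m)
      -- No insertion works, so successors of red neighbours are blue to `y` and to each other; `c`
      -- of them together with `y` form the forbidden clique.
      ...   | no crossing with count reds <? c
      ...     | yes lt = inj₂ lt
      ...     | no ge with choose c reds (≮⇒≥ ge)
      ...       | f , f-inj , f-red = ⊥-elim (noClique (g , g-inj , g∈A , g-blue))
        where
        g : Fin (suc c) → Fin N
        g zero = y
        g (suc i) = path (suc (toℕ (f i)))
        blue₀ : ∀ i → path (suc (toℕ (f i))) ∈ b y
        blue₀ i = case mem? (b y) (path (suc (toℕ (f i)))) of λ where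
          (yes h) → h
          (no h) → ⊥-elim (direct (f i , f-red i , h))
        blue< : ∀ i j → toℕ (f i) < toℕ (f j) → g (suc j) ∈ b (g (suc i))
        blue< i j lt = case mem? (b (g (suc i))) (g (suc j)) of λ where
          (yes h) → h
          (no h) → ⊥-elim (crossing (f i , f j , f-red i , f-red j , lt , h))
        g-blue : ∀ i j → i ≢ j → g j ∈ b (g i)
        g-blue zero zero ne = ⊥-elim (ne refl)
        g-blue zero (suc j) _ = blue₀ j
        g-blue (suc i) zero _ = b-sym (blue₀ i)
        g-blue (suc i) (suc j) ne with <-cmp (toℕ (f i)) (toℕ (f j))
        ... | tri< lt _ _ = blue< i j lt
        ... | tri≈ _ h _ = ⊥-elim (ne (cong suc (f-inj i j (toℕ-injective h))))
        ... | tri> _ _ lt = b-sym (blue< j i lt)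
        g∈A : ∀ i → g i ∈ A
        g∈A zero = yA
        g∈A (suc i) = path∈A _ (toℕ<n (f i))
        g-inj : InjSub g
        g-inj i j h with i ≟F j
        ... | yes q = q
        ... | no ne = ⊥-elim (b-irr (subst (λ z → z ∈ b (g i)) (sym h) (g-blue i j ne)))

-- Embedding graphs below the critical order into a book-free set

argmax : ∀ {n} (f : Fin n → ℕ) → Fin n → ∃[ x ] ∀ y → f y ≤ f x
argmax {suc zero} f _ = zero , λ { zero → ≤-refl }
argmax {suc (suc n)} f _ with argmax (f ∘ suc) zero
... | x , h with ≤-total (f zero) (f (suc x))
...   | inj₁ le = suc x , λ { zero → le ; (suc y) → h y }
...   | inj₂ le = zero , λ { zero → ≤-refl ; (suc y) → ≤-trans (h y) le }

module Sparse-embedding {N : ℕ} (host : BlueGraph N)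
  (κ : ℕ) where
  open BlueGraph host
  open Host host
  open Emb
  open PathInsertion host

  private
    k = suc κ

  NoBook : Sub N → Set
  NoBook V = ∀ u v → u ∈ V → v ∈ V → v ∈ b u → count (V ∩ (b u ∩ b v)) < k

  -- Any two vertices of a blue clique on k + 2 vertices have the other k as common blue neighbours.
  noClique : ∀ {V A} → NoBook V → A ⊆ V → ¬ BlueClique A (2 + k)
  noClique {V} nb A⊆V (f , f-inj , f∈A , blue) = <⇒≱ (nb (f zero) (f (suc zero)) (A⊆V _ (f∈A _)) (A⊆V _ (f∈A _)) (blue _ _ λ ()))
    (inj-into⇒≤ (λ i → f (suc (suc i))) (V ∩ (b (f zero) ∩ b (f (suc zero)))) (λ i j h → sucF-injective (sucF-injective (f-inj _ _ h)))
      (λ i → ∈∩ V (b (f zero) ∩ b (f (suc zero))) (A⊆V _ (f∈A _)) (∈∩ (b (f zero)) (b (f (suc zero))) (blue _ _ λ ()) (blue _ _ λ ()))))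

  -- A blue neighbour of `a` within `A` is a page on the blue edge from `x` to `a`, so there are
  -- fewer than k of them.
  near-in : ∀ {V x A} → NoBook V → x ∈ V → A ⊆ V → A ⊆ b x → Near A κ
  near-in {V} {x} {A} nb xV A⊆V A⊆b a aA = ≤-trans (count-mono (A ∩ b a) (V ∩ (b x ∩ b a))
    (λ y h → let h₁ , h₂ = ∩∈ A (b a) h in ∈∩ V (b x ∩ b a) (A⊆V y h₁) (∈∩ (b x) (b a) (A⊆b y h₁) h₂)))
    (≤-pred (nb x a xV (A⊆V a aA) (A⊆b a aA)))

  module LiftDelete {n} (G : PG n) (W : Sub n) (W⊆S : W ⊆ S G)
    (lf : ∀ w → w ∈ W → deg G w ≡ 1) (ind : ∀ u v → v ∈ E G u → u ∈ W → v ∉ W) where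
    open DeleteLeaves G W W⊆S lf ind public

    lift-delete : ∀ {C} → Emb delete (S delete) C → Emb G (S delete) C
    lift-delete e = record
      { φ = φ e ; inj = inj e ; con = con e
      ; red = λ {u} {v} uD vD h → red e uD vD (E-delete h (proj₂ (∖∈ (S G) W uD)) (proj₂ (∖∈ (S G) W vD))) }

  weaken : ∀ {n} {G : PG n} {D C C′} → (∀ v y → C v y → C′ v y) → Emb G D C → Emb G D C′
  weaken h e = record { φ = φ e ; inj = inj e ; red = red e ; con = λ {u} a → h u _ (con e a) }

  module _ {n} {G : PG n} {D : Sub n} {C} (e : Emb G D C) where
    private
      d : ∀ y → Dec (∃[ u ] u ∈ D × φ e u ≡ y)
      d y = any? (λ u → mem? D u ×-dec (φ e u ≟F y))

    used : Sub N
    used = set d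

    used≤ : count used ≤ count D
    used≤ = count-image D used (φ e) (λ y → set∈ d)

    unused⇒ : ∀ {y} → y ∉ used → ∀ u → u ∈ D → φ e u ≢ y
    unused⇒ h u uD eq = h (∈set d (u , uD , eq))

  module SingleLeaf {n} (G : PG n) (v : Fin n) (vS : v ∈ S G) (lf : deg G v ≡ 1) where
    open LiftDelete G ⁅ v ⁆ (λ x a → subst (_∈ S G) (sym (⁅⁆∈ a)) vS) (λ w a → trans (cong (deg G) (⁅⁆∈ a)) lf)
      (λ u w uw a c → E-irr G (subst₂ (λ p q → q ∈ E G p) (⁅⁆∈ a) (⁅⁆∈ c) uw)) public

    ord-delete1 : suc (ord delete) ≡ ord G
    ord-delete1 = trans (trans (+-comm 1 _) (cong (ord delete +_)
      (sym (≤-antisym (count⁅⁆ v) (∈⇒0<count ⁅ v ⁆ (∈⁅⁆ refl)))))) ord-delete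

    attach : ∀ {C} (e : Emb delete (S delete) C) → ∃[ y ] C v y × (∀ u → u ∈ S delete → φ e u ≢ y) ×
       (∀ u → u ∈ S delete → v ∈ E G u → y ∉ b (φ e u)) → Emb G (S G) C
    attach e (y , Cvy , un , ok) = restrict G (λ u uS → case u ≟F v of λ where
        (yes h) → ∈∪ (S delete) ⁅ v ⁆ (inj₂ (∈⁅⁆ h))
        (no h) → ∈∪ (S delete) ⁅ v ⁆ (inj₁ (∈∖⁅⁆ (S G) uS h)))
      (extend G (lift-delete e) v (λ h → proj₂ (∖∈ (S G) ⁅ v ⁆ h) (∈⁅⁆ refl)) y Cvy un ok)

  module _ {n} (G : PG n) (P : Sub n) (A A₁ : Sub N) (m : ℕ) (2≤m : 2 ≤ m) (T : Thread G P m)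
    (e : Emb (SuppressThread.suppress G 2≤m T) (S (SuppressThread.suppress G 2≤m T)) (In A P A₁)) where

    -- A position red to neither vertex is blue to both. For a blue edge `y y′` such positions are
    -- pages; taking `y′` equal to `y` bounds m for a single vertex.
    m≤reds+blues : ∀ y yA un y′ yA′ un′ (H : Sub N) →
      (∀ l → l < m → path G P A A₁ m 2≤m T e y yA un l ∈ b y → path G P A A₁ m 2≤m T e y yA un l ∈ b y′ → path G P A A₁ m 2≤m T e y yA un l ∈ H) →
      m ≤ count (reds G P A A₁ m 2≤m T e y yA un) + count (reds G P A A₁ m 2≤m T e y′ yA′ un′) + count H
    m≤reds+blues y yA un y′ yA′ un′ H h = ≤-trans (≤-reflexive (sym (count-full m))) (≤-trans
        (count-≤+ (λ _ → true) (r₁ ∪ r₂) (set dH)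
          (λ l _ → case mem? (b y) (xx (toℕ l)) of λ where
            (no a) → inj₁ (∈∪ r₁ r₂ (inj₁ (∈set (λ l → ¬? (mem? (b y) (xx (toℕ l)))) a)))
            (yes a) → case mem? (b y′) (xx (toℕ l)) of λ where
              (no a′) → inj₁ (∈∪ r₁ r₂ (inj₂ (∈set (λ l → ¬? (mem? (b y′) (xx (toℕ l)))) a′)))
              (yes a′) → inj₂ (∈set dH (a , a′))))
        (+-mono-≤ (count-≤+ (r₁ ∪ r₂) r₁ r₂ (λ l → ∪∈ r₁ r₂))
          (count-inj (set dH) H (xx ∘ toℕ) (λ l a → let a₁ , a₂ = set∈ dH a in h (toℕ l) (toℕ<n l) a₁ a₂)
          (λ l l′ _ _ q → toℕ-injective (path-injective G P A A₁ m 2≤m T e y yA un (<⇒≤ (toℕ<n l)) (<⇒≤ (toℕ<n l′)) q)))))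
      where
      xx = path G P A A₁ m 2≤m T e y yA un
      r₁ = reds G P A A₁ m 2≤m T e y yA un
      r₂ = reds G P A A₁ m 2≤m T e y′ yA′ un′
      dH : ∀ (l : Fin m) → Dec (xx (toℕ l) ∈ b y × xx (toℕ l) ∈ b y′)
      dH l = mem? (b y) (xx (toℕ l)) ×-dec mem? (b y′) (xx (toℕ l))

  2≤3k : ∀ {m} → 3 * k ≤ m → 2 ≤ m
  2≤3k le = ≤-trans (≤-trans (s≤s (s≤s z≤n)) (*-monoʳ-≤ 3 (s≤s z≤n))) le

  -- The image of a parent is blue to at most `κ` vertices of `A`, so `κ` spare vertices are enough
  -- for every leaf. Marked vertices survive all reductions and reach `A₁` in the base case.
  embed-in-near : ∀ {n} V → NoBook V → ∀ A → A ⊆ V → Near A κ → (P : Sub n) → ∀ A₁ → A₁ ⊆ A → ∀ m p ℓ → 3 * k ≤ m →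
    count P ≤ p → p * k ≤ count A₁ → suc m * (6 * suc p + 6 * ℓ) * k ≤ count A →
    ∀ fuel (G : PG n) → ord G ≤ fuel → Sparse ℓ G → ord G + κ ≤ count A → Emb G (S G) (In A P A₁)
  embed-in-near V nb A A⊆V near P A₁ A₁⊆A m p ℓ 3k≤m P≤ pk≤ base = go
    where
    go : ∀ fuel (G : PG _) → ord G ≤ fuel → Sparse ℓ G → ord G + κ ≤ count A → Emb G (S G) (In A P A₁)
    go fuel G le sp room with reduction G P m p ℓ P≤ sp
    ... | small s = embed-near G A κ P A₁ near A₁⊆A (≤-trans (*-monoˡ-≤ k P≤) pk≤) (≤-trans (*-monoˡ-≤ k s) base)
    go zero G le sp room | leaf v vS _ _ = ⊥-elim (<⇒≱ (∈⇒0<count (S G) vS) le)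
    go (suc fuel) G le sp room | leaf v vS vP lf =
      attach e (let y , yA , un , ok = available G (lift-delete e) v A (E G v) κ
                                         (λ u uD vu → E-sym G vu , near _ (proj₁ (con e uD))) small-room
                in y , (yA , λ h → ⊥-elim (vP h)) , un , ok)
      where
      open SingleLeaf G v vS lf
      e : Emb delete (S delete) (In A P A₁)
      e = go fuel delete (≤-pred (≤-trans (≤-reflexive ord-delete1) le)) (sparse-delete ℓ sp)
            (≤-trans (+-monoˡ-≤ κ (≤-trans (n≤1+n _) (≤-reflexive ord-delete1))) room)
      small-room : count (S delete) + deg G v * κ < count A
      small-room = ≤-trans (≤-reflexive (trans (cong (λ z → suc (ord delete + z * κ)) lf)
          (cong₂ _+_ ord-delete1 (*-identityˡ κ)))) room
    go zero G le sp room | thread T = ⊥-elim (<⇒≱ (∈⇒0<count (S G) (SuppressThread.th∈S G (2≤3k 3k≤m) T 0 z≤n)) le)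
    go (suc fuel) G le sp room | thread T = case insert-or-few-reds G P A A₁ m 2≤m T e y yA un (suc k) (noClique nb A⊆V) of λ where
        (inj₁ r) → r
        -- A failing `y` has at most k red positions and at most `κ` blue ones. Even with the red
        -- ones counted twice this gives only 3k - 1 of the m positions.
        (inj₂ few) → ⊥-elim (<⇒≱ (≤-trans (s≤s (≤-trans (m≤reds+blues G P A A₁ m 2≤m T e y yA un y yA un (A ∩ b y)
            (λ l lt h _ → ∈∩ A (b y) (path∈A G P A A₁ m 2≤m T e y yA un l (<⇒≤ lt)) h))
            (+-mono-≤ (+-mono-≤ (≤-pred few) (≤-pred few)) (near y yA)))) (≤-reflexive (lem κ))) 3k≤m)
      where
      2≤m = 2≤3k 3k≤m
      open SuppressThread G 2≤m T
      lem : ∀ κ → suc (suc κ + suc κ + κ) ≡ 3 * suc κ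
      lem = solve-∀
      e : Emb suppress (S suppress) (In A P A₁)
      e = go fuel suppress (≤-pred (≤-trans ord-suppress le)) (sparse-suppress ℓ sp)
            (≤-trans (+-monoˡ-≤ κ (<⇒≤ ord-suppress)) room)
      pk = count-pick A (used e) (≤-<-trans (used≤ e) (≤-trans ord-suppress (≤-trans (m≤m+n _ κ) room)))
      y = proj₁ pk
      yA = proj₁ (proj₂ pk)
      un = unused⇒ e (proj₂ (proj₂ pk))

  -- High-degree vertices go into a largest blue neighbourhood, which is almost a red clique;
  -- the others have few neighbours, each of which blocks few places.
  embed-crude : ∀ {n} V → NoBook V → (G : PG n) → ord G + k * degsum G ≤ count V → EmbIn V G
  embed-crude {n} V nb G room = weaken (λ _ _ h → proj₁ h , λ ()) (restrict G (λ v a → ∈∪ (∅ ∪ U) (S G) (inj₂ a))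
      (greedy G (∅ ∪ U) (S G) step₂ (greedy G ∅ U step₁ (empty-emb G))))
    where
    dD : ∀ x y → Dec (x ∈ V × y ∈ V × y ∈ b x)
    dD x y = mem? V x ×-dec mem? V y ×-dec mem? (b x) y
    max = argmax (λ x → count (set (dD x))) y₀
    x₀ = proj₁ max
    A : Sub N
    A = set (dD x₀)
    β q d : ℕ
    β = count A
    -- The threshold balances two demands. There are at most degsum / (q + 1) vertices of degree
    -- above `q`, so k times their number is at most `β`; a vertex of degree at most `q` loses at
    -- most qβ ≤ k · degsum places.
    q = (k * degsum G) / suc β
    d = suc q
    A⊆V : A ⊆ V
    A⊆V y h = proj₁ (proj₂ (set∈ (dD x₀) h))
    near : Near A κ
    near a aA = near-in nb (proj₁ (set∈ (dD x₀) aA)) A⊆V (λ y h → proj₂ (proj₂ (set∈ (dD x₀) h))) a aA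
    β-max : ∀ {y} → y ∈ V → count (V ∩ b y) ≤ β
    β-max {y} yV = ≤-trans (count-mono (V ∩ b y) (set (dD y)) (λ z h → let h₁ , h₂ = ∩∈ V (b y) h in ∈set (dD y) (yV , h₁ , h₂)))
      (proj₂ max y)
    dU : ∀ v → Dec (v ∈ S G × d ≤ deg G v)
    dU v = mem? (S G) v ×-dec (d ≤? deg G v)
    U : Sub n
    U = set dU
    C : Fin n → Fin N → Set
    C = In V U A
    Uk≤ : count U * k ≤ β
    Uk≤ = ≤-pred (*-cancelʳ-< d (count U * k) (suc β) (begin-strict
      count U * k * d ≡⟨ lem (count U) k d ⟩
      k * (count U * d) ≤⟨ *-monoʳ-≤ k (weight-sum U (λ v h → proj₂ (set∈ dU h))) ⟩
      k * degsum G <⟨ m<[1+n]*[1+m/1+n]  ⟩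
      suc β * d ∎))
      where
      open ≤-Reasoning
      lem : ∀ a b c → a * b * c ≡ b * (a * c)
      lem = solve-∀
      m<[1+n]*[1+m/1+n] : k * degsum G < suc β * d
      m<[1+n]*[1+m/1+n] = begin-strict
        k * degsum G ≡⟨ m≡m%n+[m/n]*n (k * degsum G) (suc β) ⟩
        (k * degsum G) % suc β + q * suc β <⟨ +-monoˡ-< (q * suc β) (m%n<n (k * degsum G) (suc β)) ⟩
        suc β + q * suc β ≡⟨ *-comm d (suc β) ⟩
        suc β * d ∎
    step₁ : ∀ D → ∅ ⊆ D → D ⊆ ∅ ∪ U → (e : Emb G D C) → ∀ v → v ∈ U → v ∉ D → Available G e v
    step₁ D _ hi e v vU vD =
      let y , yA , un , ok = available G e v A D κ
            (λ u uD _ → uD , near _ (proj₂ (con e uD) (∅∪⊆ U u (hi u uD))))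
            (≤-trans (s≤s (≤-trans (≤-reflexive (sym (*-suc (count D) κ))) (m≤n+m _ κ)))
              (≤-trans (*-monoˡ-≤ k (count< D U (λ x a → ∅∪⊆ U x (hi x a)) vU vD)) Uk≤))
      in y , (A⊆V y yA , λ _ → yA) , un , ok
    step₂ : ∀ D → (∅ ∪ U) ⊆ D → D ⊆ (∅ ∪ U) ∪ S G → (e : Emb G D C) → ∀ v → v ∈ S G → v ∉ D → Available G e v
    step₂ D lo hi e v vS vD =
      let y , yV , un , ok = available G e v V (E G v) β (λ u uD vu → E-sym G vu , β-max (proj₁ (con e uD)))
            (≤-trans (+-mono-≤ (count< D (S G)
                (λ x a → [ (λ c → proj₁ (set∈ dU (∅∪⊆ U x c))) , id ]′ (∪∈ (∅ ∪ U) (S G) (hi x a))) vS vD)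
              (≤-trans (*-mono-≤ low (n≤1+n β)) (m/n*n≤m (k * degsum G) (suc β)))) room)
      in y , (yV , λ h → ⊥-elim (v∉U h)) , un , ok
      where
      v∉U : v ∉ U
      v∉U h = vD (lo v (∈∪ ∅ U (inj₂ h)))
      low : deg G v ≤ q
      low = ≤-pred (≰⇒> (λ h → v∉U (∈set dU (vS , h))))

module Books {N : ℕ} (host : BlueGraph N)
  (κ : ℕ) where
  open BlueGraph host
  open Host host
  open Emb
  open PathInsertion host
  open Sparse-embedding host κ

  private
    k = suc κ

  all : ∀ {n} → Sub n
  all _ = true

  -- After a smaller graph is embedded, at least s + κ vertices of `V` are free. If the removed
  -- vertex cannot be put back, they form a near-clique (all blue to one vertex) or a red clique,
  -- and G is embedded among them anew.
  embed-in-bookfree : ∀ {n} V → NoBook V → ∀ m ℓ s → 3 * k ≤ m → 2 * s + k ≤ count V + 2 →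
    (let B = suc m * (6 * 1 + 6 * ℓ)) → B + k * (2 * (B + ℓ)) ≤ count V → B * k + s ≤ count V →
    ∀ fuel (G : PG n) → ord G ≤ fuel → Sparse ℓ G → ord G ≤ s → EmbIn V G
  embed-in-bookfree {n} V nb m ℓ s 3k≤m h₁ h₂ h₃ = go
    where
    open ≤-Reasoning
    weak : ∀ {n} {G : PG n} {D A} → A ⊆ V → Emb G D (In A ∅ ∅) → Emb G D (In V ∅ ∅)
    weak s = weaken (λ _ y h → s y (proj₁ h) , λ ())
    free≥ : ∀ {G : PG n} {G′ : PG n} (e : EmbIn V G′) → suc (ord G′) ≤ ord G → ord G ≤ s →
      s + κ ≤ count (V ∖ used e)
    free≥ {G} {G′} e lt le = +-cancelʳ-≤ (suc s) _ _ (begin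
      s + κ + suc s ≡⟨ lem s κ ⟩
      2 * s + k ≤⟨ h₁ ⟩
      count V + 2 ≤⟨ +-monoˡ-≤ 2 (count-∖ V (used e)) ⟩
      count (V ∖ used e) + count (used e) + 2 ≤⟨ +-monoˡ-≤ 2 (+-monoʳ-≤ _ (used≤ e)) ⟩
      count (V ∖ used e) + ord G′ + 2 ≡⟨ lem′ (count (V ∖ used e)) (ord G′) ⟩
      count (V ∖ used e) + suc (suc (ord G′)) ≤⟨ +-monoʳ-≤ _ (s≤s (≤-trans lt le)) ⟩
      count (V ∖ used e) + suc s ∎)
      where
      lem : ∀ s κ → s + κ + suc s ≡ 2 * s + suc κ
      lem = solve-∀
      lem′ : ∀ a c → a + c + 2 ≡ a + suc (suc c)
      lem′ = solve-∀
    Goal : PG n → Set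
    Goal G = EmbIn V G

    leaf-step : ∀ (G : PG n) → Sparse ℓ G → ord G ≤ s → ∀ v (vS : v ∈ S G) (lf : deg G v ≡ 1) →
      let open SingleLeaf G v vS lf in EmbIn V delete → Goal G
    leaf-step G sp room v vS lf e = case any? (λ y → mem? A y ×-dec ¬? (mem? (b x) y)) of λ where
        (yes (y , yF , yx)) → attach e (y , (A⊆V y yF , λ ()) , unused⇒ e (proj₂ (∖∈ V (used e) yF)) ,
            λ u uD vu → subst (λ z → y ∉ b (φ e z)) (count≤1-unique (E G v) (≤-reflexive lf) (proj₂ par) (E-sym G vu)) yx)
        (no h) → weak A⊆V (embed-in-near V nb A A⊆V
            (near-in nb (proj₁ (con e parS)) A⊆V (λ y a → case mem? (b x) y of λ where
                (yes q) → q
                (no q) → ⊥-elim (h (y , a , q)))) ∅ ∅ (λ _ ()) m 0 ℓ 3k≤m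
            (≤-reflexive (count-empty ∅ (λ _ ()))) z≤n
            (+-cancelʳ-≤ s _ _ (≤-trans h₃ (≤-trans (count-∖ V (used e)) (+-monoʳ-≤ _ (≤-trans (used≤ e) od≤)))))
            (ord G) G ≤-refl sp (≤-trans (+-monoˡ-≤ κ room) (free≥ {G} e (≤-reflexive ord-delete1) room)))
      where
      open SingleLeaf G v vS lf
      od≤ : ord delete ≤ s
      od≤ = ≤-trans (≤-trans (n≤1+n _) (≤-reflexive ord-delete1)) room
      par = count-inhabited (E G v) (≤-reflexive (sym lf))
      parS : proj₁ par ∈ S delete
      parS = ∈∖⁅⁆ (S G) (E-S′ G (proj₂ par)) (λ q → E-irr G (subst (_∈ E G v) q (proj₂ par)))
      x : Fin N
      x = φ e (proj₁ par)
      A : Sub N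
      A = V ∖ used e
      A⊆V : A ⊆ V
      A⊆V y a = proj₁ (∖∈ V (used e) a)

    2≤m : 2 ≤ m
    2≤m = 2≤3k 3k≤m

    thread-step : ∀ (G : PG n) → ord G ≤ s → (T : Thread G ∅ m) →
      let open SuppressThread G 2≤m T in EmbIn V suppress → Goal G
    thread-step G room T e = case any? (λ y → any? (λ y′ → mem? Y y ×-dec mem? Y y′ ×-dec mem? (b y) y′)) of λ where
        (no h) → weak Y⊆V (embed-clique G Y (λ y y′ yY yY′ yb → h (y , y′ , yY , yY′ , yb))
                (≤-trans (≤-trans room (m≤m+n s κ)) (free≥ {G} e ord-suppress room)))
        (yes (y , y′ , yY , yY′ , yb)) → case try y yY of λ where
          (inj₁ r) → r
          (inj₂ f) → case try y′ yY′ of λ where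
            (inj₁ r) → r
            (inj₂ f′) → ⊥-elim (clash y y′ yY yY′ yb f f′)
      where
      open SuppressThread G 2≤m T
      Y : Sub N
      Y = V ∖ used e
      Y⊆V : Y ⊆ V
      Y⊆V y a = proj₁ (∖∈ V (used e) a)
      un : ∀ y → y ∈ Y → ∀ u → u ∈ S suppress → φ e u ≢ y
      un y yY = unused⇒ e (proj₂ (∖∈ V (used e) yY))
      Few : ∀ y → y ∈ Y → Set
      Few y yY = count (reds G ∅ V ∅ m 2≤m T e y (Y⊆V y yY) (un y yY)) < suc k
      try : ∀ y (yY : y ∈ Y) → Goal G ⊎ Few y yY
      try y yY = insert-or-few-reds G ∅ V ∅ m 2≤m T e y (Y⊆V y yY) (un y yY) (suc k) (noClique nb (λ _ a → a))
      lem : ∀ κ → suc (suc κ + suc κ + κ) ≡ 3 * suc κ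
      lem = solve-∀
      -- Each end of the edge has at most k red positions out of m ≥ 3k, so at least k path vertices
      -- are blue to both and complete a book in `V`.
      clash : ∀ y y′ (yY : y ∈ Y) (yY′ : y′ ∈ Y) → y′ ∈ b y → Few y yY → Few y′ yY′ → ⊥
      clash y y′ yY yY′ yb f f′ = <⇒≱ (≤-trans (s≤s (≤-trans
              (m≤reds+blues G ∅ V ∅ m 2≤m T e y (Y⊆V y yY) (un y yY) y′ (Y⊆V y′ yY′) (un y′ yY′) (V ∩ (b y ∩ b y′))
                 (λ l lt a a′ → ∈∩ V (b y ∩ b y′) (path∈A G ∅ V ∅ m 2≤m T e y (Y⊆V y yY) (un y yY) l (<⇒≤ lt)) (∈∩ (b y) (b y′) a a′)))
              (+-mono-≤ (+-mono-≤ (≤-pred f) (≤-pred f′)) (≤-pred (nb y y′ (Y⊆V y yY) (Y⊆V y′ yY′) yb)))))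
              (≤-reflexive (lem κ))) 3k≤m

    go : ∀ fuel (G : PG n) → ord G ≤ fuel → Sparse ℓ G → ord G ≤ s → Goal G
    go fuel G le sp room with reduction G ∅ m 0 ℓ (≤-reflexive (count-empty ∅ (λ _ ()))) sp
    ... | small sm = embed-crude V nb G (≤-trans (+-mono-≤ sm (*-monoʳ-≤ k (≤-trans sp (*-monoʳ-≤ 2 (+-monoˡ-≤ ℓ sm))))) h₂)
    go zero G le sp room | leaf v vS _ _ = ⊥-elim (<⇒≱ (∈⇒0<count (S G) vS) le)
    go (suc fuel) G le sp room | leaf v vS _ lf = leaf-step G sp room v vS lf
        (go fuel delete (≤-pred (≤-trans (≤-reflexive ord-delete1) le)) (sparse-delete ℓ sp)
          (≤-trans (≤-trans (n≤1+n _) (≤-reflexive ord-delete1)) room))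
      where open SingleLeaf G v vS lf
    go zero G le sp room | thread T = ⊥-elim (<⇒≱ (∈⇒0<count (S G) (SuppressThread.th∈S G 2≤m T 0 z≤n)) le)
    go (suc fuel) G le sp room | thread T = thread-step G room T
        (go fuel suppress (≤-pred (≤-trans ord-suppress le)) (sparse-suppress ℓ sp) (≤-trans (<⇒≤ ord-suppress) room))
      where open SuppressThread G 2≤m T

  -- Blue matchings among the free vertices

  record Matching (Y : Sub N) (a : ℕ) : Set where
    field
      p q : Fin a → Fin N
      p-inj : InjSub p
      q-inj : InjSub q
      p≢q : ∀ i j → p i ≢ q j
      p∈ : ∀ i → p i ∈ Y
      q∈ : ∀ i → q i ∈ Y
      blue : ∀ i → q i ∈ b (p i)

    ends : Sub N
    ends = image p ∪ image q

    ends≤ : count ends ≤ a + a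
    ends≤ = ≤-trans (count-≤+ ends (image p) (image q) (λ _ → ∪∈ (image p) (image q)))
      (+-mono-≤ (count-image≤ p) (count-image≤ q))

    p∈ends : ∀ i → p i ∈ ends
    p∈ends i = ∈∪ (image p) (image q) (inj₁ (∈image p (i , refl)))
    q∈ends : ∀ i → q i ∈ ends
    q∈ends i = ∈∪ (image p) (image q) (inj₂ (∈image q (i , refl)))

    ends⊆ : ends ⊆ Y
    ends⊆ y h with ∪∈ (image p) (image q) h
    ... | inj₁ a = let i , r = image∈ p a in subst (_∈ Y) r (p∈ i)
    ... | inj₂ a = let i , r = image∈ q a in subst (_∈ Y) r (q∈ i)

  open Matching

  private
    cons : ∀ {X : Set} {a} → X → (Fin a → X) → Fin (suc a) → X
    cons x f zero = x
    cons x f (suc i) = f i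

    cons-inj : ∀ {a x} {f : Fin a → Fin N} → (∀ i → f i ≢ x) → InjSub f → InjSub (cons x f)
    cons-inj h hs zero zero _ = refl
    cons-inj h hs zero (suc j) r = ⊥-elim (h j (sym r))
    cons-inj h hs (suc i) zero r = ⊥-elim (h i r)
    cons-inj h hs (suc i) (suc j) r = cong suc (hs i j r)

  add-edge : ∀ {Y Y′ a x y} → Y′ ⊆ Y → (M : Matching Y′ a) → x ∈ Y → y ∈ Y → y ∈ b x → x ∉ ends M → y ∉ ends M →
    Matching Y (suc a)
  add-edge {x = x} {y} s M xY yY xy x∉ y∉ = record
    { p = cons x (p M) ; q = cons y (q M)
    ; p-inj = cons-inj (λ i r → x∉ (subst (_∈ ends M) r (p∈ends M i))) (p-inj M)
    ; q-inj = cons-inj (λ i r → y∉ (subst (_∈ ends M) r (q∈ends M i))) (q-inj M)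
    ; p≢q = λ { zero zero r → b-irr (subst (_∈ b x) (sym r) xy)
              ; zero (suc j) r → x∉ (subst (_∈ ends M) (sym r) (q∈ends M j))
              ; (suc i) zero r → y∉ (subst (_∈ ends M) r (p∈ends M i))
              ; (suc i) (suc j) r → p≢q M i j r }
    ; p∈ = λ { zero → xY ; (suc i) → s _ (p∈ M i) }
    ; q∈ = λ { zero → yY ; (suc i) → s _ (q∈ M i) }
    ; blue = λ { zero → xy ; (suc i) → blue M i } }

  ends-suc : ∀ {Y Y′ a} (M′ : Matching Y (suc a)) (M : Matching Y′ a) →
    (∀ i → p M′ (suc i) ≡ p M i) → (∀ i → q M′ (suc i) ≡ q M i) →
    ∀ {z} → z ∈ ends M′ → z ≡ p M′ zero ⊎ z ≡ q M′ zero ⊎ z ∈ ends M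
  ends-suc M′ M hp hq h with ∪∈ (image (p M′)) (image (q M′)) h
  ... | inj₁ c with image∈ (p M′) c
  ...   | zero , r = inj₁ (sym r)
  ...   | suc l , r = inj₂ (inj₂ (subst (_∈ ends M) (trans (sym (hp l)) r) (p∈ends M l)))
  ends-suc M′ M hp hq h | inj₂ c with image∈ (q M′) c
  ...   | zero , r = inj₂ (inj₁ (sym r))
  ...   | suc l , r = inj₂ (inj₂ (subst (_∈ ends M) (trans (sym (hq l)) r) (q∈ends M l)))

  grow : ∀ {Y Y′ a} → Y′ ⊆ Y → Matching Y′ a → Matching Y a
  grow s M = record { p = p M ; q = q M ; p-inj = p-inj M ; q-inj = q-inj M ; p≢q = p≢q M
                    ; p∈ = λ i → s _ (p∈ M i) ; q∈ = λ i → s _ (q∈ M i) ; blue = blue M }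

  -- A red clique I and a few vertices R with few blue neighbours in I cover all but a vertices of Y.
  record Split (Y : Sub N) (t a : ℕ) : Set where
    field
      I R : Sub N
      I⊆ : I ⊆ Y
      R⊆ : R ⊆ Y
      I∩R : ∀ x → x ∈ I → x ∉ R
      clique : Clique I
      few : ∀ r → r ∈ R → count (I ∩ b r) ≤ 2 * t
      R≤ : count R ≤ a
      cover : count Y ≤ count I + count R + a

  open Split

  -- An edge y y′ with at most 2t blue edges from y to I donates y to R. If both ends have
  -- more, the edge is traded for two edges into I. Either way the matching pays for the loss.
  matching-or-split : ∀ t fuel Y → count Y ≤ fuel → Matching Y t ⊎ ∃[ a ] a < t × Matching Y a × Split Y t a
  matching-or-split t fuel Y le with any? (λ y → any? (λ y′ → mem? Y y ×-dec mem? Y y′ ×-dec mem? (b y) y′))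
  matching-or-split zero fuel Y le | no h = inj₁ (record { p = λ () ; q = λ () ; p-inj = λ () ; q-inj = λ () ; p≢q = λ () ; p∈ = λ () ; q∈ = λ () ; blue = λ () })
  matching-or-split (suc t) fuel Y le | no h = inj₂ (0 , s≤s z≤n
    , record { p = λ () ; q = λ () ; p-inj = λ () ; q-inj = λ () ; p≢q = λ () ; p∈ = λ () ; q∈ = λ () ; blue = λ () }
    , record { I = Y ; R = ∅ ; I⊆ = λ _ a → a ; R⊆ = λ _ () ; I∩R = λ _ _ () ; clique = λ y y′ a c d → h (y , y′ , a , c , d)
             ; few = λ _ () ; R≤ = ≤-reflexive (count-empty ∅ λ _ ()) ; cover = ≤-trans (m≤m+n _ _) (m≤m+n _ _) })
  matching-or-split t zero Y le | yes (y , y′ , yY , _) = ⊥-elim (<⇒≱ (∈⇒0<count Y yY) le)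
  matching-or-split t (suc fuel) Y le | yes (y , y′ , yY , y′Y , yy′)
    with matching-or-split t fuel ((Y ∖ ⁅ y ⁆) ∖ ⁅ y′ ⁆)
           (≤-pred (≤-trans (s≤s (count-mono ((Y ∖ ⁅ y ⁆) ∖ ⁅ y′ ⁆) (Y ∖ ⁅ y ⁆) (λ x a → proj₁ (∖∈ (Y ∖ ⁅ y ⁆) ⁅ y′ ⁆ a)))) (≤-trans (count-∖⁅⁆ Y yY) le)))
  ... | inj₁ M = inj₁ (grow (λ x a → proj₁ (∖∈ Y ⁅ y ⁆ (proj₁ (∖∈ (Y ∖ ⁅ y ⁆) ⁅ y′ ⁆ a)))) M)
  ... | inj₂ (a , a<t , M , Sp) = outcome
    where
    Y′ = (Y ∖ ⁅ y ⁆) ∖ ⁅ y′ ⁆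
    Y′⊆ : Y′ ⊆ Y
    Y′⊆ x h = proj₁ (∖∈ Y ⁅ y ⁆ (proj₁ (∖∈ (Y ∖ ⁅ y ⁆) ⁅ y′ ⁆ h)))
    y∉ : y ∉ Y′
    y∉ h = proj₂ (∖∈ Y ⁅ y ⁆ (proj₁ (∖∈ (Y ∖ ⁅ y ⁆) ⁅ y′ ⁆ h))) (∈⁅⁆ refl)
    y′∉ : y′ ∉ Y′
    y′∉ h = proj₂ (∖∈ (Y ∖ ⁅ y ⁆) ⁅ y′ ⁆ h) (∈⁅⁆ refl)
    Y≤ : count Y ≤ 2 + count Y′
    Y≤ = begin
      count Y ≤⟨ count-∖ Y ⁅ y ⁆ ⟩
      count (Y ∖ ⁅ y ⁆) + count ⁅ y ⁆ ≤⟨ +-mono-≤ (count-∖ (Y ∖ ⁅ y ⁆) ⁅ y′ ⁆) (count⁅⁆ y) ⟩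
      count Y′ + count ⁅ y′ ⁆ + 1 ≤⟨ +-monoˡ-≤ 1 (+-monoʳ-≤ (count Y′) (count⁅⁆ y′)) ⟩
      count Y′ + 1 + 1 ≡⟨ lem (count Y′) ⟩
      2 + count Y′ ∎
      where
      open ≤-Reasoning
      lem : ∀ a → a + 1 + 1 ≡ 2 + a
      lem = solve-∀
    M⁺ : Matching Y (suc a)
    M⁺ = add-edge Y′⊆ M yY y′Y yy′ (λ h → y∉ (ends⊆ M _ h)) (λ h → y′∉ (ends⊆ M _ h))
    finish : ∀ {a} → a ≤ t → Matching Y a → Split Y t a → Matching Y t ⊎ ∃[ a ] a < t × Matching Y a × Split Y t a
    finish le M Sp with m≤n⇒m<n∨m≡n le
    ... | inj₁ lt = inj₂ (_ , lt , M , Sp)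
    ... | inj₂ refl = inj₁ M
    donate : ∀ z → z ∈ Y → z ∉ Y′ → count (I Sp ∩ b z) ≤ 2 * t → Split Y t (suc a)
    donate z zY z∉ fz = record
      { I = I Sp ; R = R Sp ∪ ⁅ z ⁆ ; I⊆ = λ x h → Y′⊆ x (I⊆ Sp x h)
      ; R⊆ = λ x h → [ (λ c → Y′⊆ x (R⊆ Sp x c)) , (λ c → subst (_∈ Y) (sym (⁅⁆∈ c)) zY) ]′ (∪∈ (R Sp) ⁅ z ⁆ h)
      ; I∩R = λ x xI h → [ I∩R Sp x xI , (λ c → z∉ (I⊆ Sp _ (subst (_∈ I Sp) (⁅⁆∈ c) xI))) ]′ (∪∈ (R Sp) ⁅ z ⁆ h)
      ; clique = clique Sp
      ; few = λ r h → [ few Sp r , (λ c → subst (λ w → count (I Sp ∩ b w) ≤ 2 * t) (sym (⁅⁆∈ c)) fz) ]′ (∪∈ (R Sp) ⁅ z ⁆ h)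
      ; R≤ = ≤-trans (count-∪⁅⁆ (R Sp) z) (s≤s (R≤ Sp))
      ; cover = begin
          count Y ≤⟨ Y≤ ⟩
          2 + count Y′ ≤⟨ +-monoʳ-≤ 2 (cover Sp) ⟩
          2 + (count (I Sp) + count (R Sp) + a) ≡⟨ lem (count (I Sp)) (count (R Sp)) a ⟩
          count (I Sp) + (count (R Sp) + 1) + suc a ≤⟨ +-monoˡ-≤ (suc a) (+-monoʳ-≤ (count (I Sp)) R+1≤) ⟩
          count (I Sp) + count (R Sp ∪ ⁅ z ⁆) + suc a ∎ }
      where
      open ≤-Reasoning
      lem : ∀ i r a → 2 + (i + r + a) ≡ i + (r + 1) + suc a
      lem = solve-∀
      R+1≤ : count (R Sp) + 1 ≤ count (R Sp ∪ ⁅ z ⁆)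
      R+1≤ = ≤-trans (+-monoʳ-≤ (count (R Sp)) (∈⇒0<count ⁅ z ⁆ (∈⁅⁆ refl)))
        (count-+≤ (R Sp) ⁅ z ⁆ (R Sp ∪ ⁅ z ⁆) (λ x h → ∈∪ (R Sp) ⁅ z ⁆ (inj₁ h)) (λ x h → ∈∪ (R Sp) ⁅ z ⁆ (inj₂ h))
          (λ x h c → z∉ (R⊆ Sp _ (subst (_∈ R Sp) (⁅⁆∈ c) h))))
    outcome : Matching Y t ⊎ ∃[ a ] a < t × Matching Y a × Split Y t a
    outcome with count (I Sp ∩ b y) ≤? 2 * t | count (I Sp ∩ b y′) ≤? 2 * t
    ... | yes f | _ = finish a<t M⁺ (donate y yY y∉ f)
    ... | no _ | yes f = finish a<t M⁺ (donate y′ y′Y y′∉ f)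
    ... | no g | no g′ with m≤n⇒m<n∨m≡n a<t
    ...   | inj₂ refl = inj₁ M⁺
    ...   | inj₁ a+1<t = finish a+1<t M⁺⁺ (record
              { I = I Sp ; R = R Sp ; I⊆ = λ x h → Y′⊆ x (I⊆ Sp x h) ; R⊆ = λ x h → Y′⊆ x (R⊆ Sp x h)
              ; I∩R = I∩R Sp ; clique = clique Sp ; few = few Sp ; R≤ = ≤-trans (R≤ Sp) (≤-trans (n≤1+n a) (n≤1+n _))
              ; cover = ≤-trans Y≤ (≤-trans (+-monoʳ-≤ 2 (cover Sp)) (≤-reflexive (lem (count (I Sp)) (count (R Sp)) a))) })
      where
      lem : ∀ i r a → 2 + (i + r + a) ≡ i + r + (2 + a)
      lem = solve-∀
      2a≤ : suc (a + a) ≤ 2 * t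
      2a≤ = ≤-trans (+-mono-≤ a<t (<⇒≤ a<t)) (≤-reflexive (cong (t +_) (sym (+-identityʳ t))))
      -- Each end has more than 2t blue neighbours in `I`, while the matching and the first partner
      -- occupy at most 2a + 1 ≤ 2t vertices, so two distinct new partners exist.
      pick₁ = count-pick (I Sp ∩ b y) (ends M) (≤-<-trans (ends≤ M) (≤-trans 2a≤ (<⇒≤ (≰⇒> g))))
      i = proj₁ pick₁
      iI = ∩∈ (I Sp) (b y) (proj₁ (proj₂ pick₁))
      pick₂ = count-pick (I Sp ∩ b y′) (ends M ∪ ⁅ i ⁆)
        (≤-<-trans (≤-trans (count-∪⁅⁆ (ends M) i) (s≤s (ends≤ M))) (≤-<-trans 2a≤ (≰⇒> g′)))
      j = proj₁ pick₂
      jI = ∩∈ (I Sp) (b y′) (proj₁ (proj₂ pick₂))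
      Y″ = Y ∖ ⁅ y ⁆
      M₁ : Matching (Y ∖ ⁅ y ⁆) (suc a)
      M₁ = add-edge (λ x h → proj₁ (∖∈ (Y ∖ ⁅ y ⁆) ⁅ y′ ⁆ h)) M
             (∈∖⁅⁆ Y y′Y (λ r → b-irr (subst (_∈ b y) r yy′)))
             (∈∖⁅⁆ Y (Y′⊆ _ (I⊆ Sp _ (proj₁ jI))) (λ r → y∉ (I⊆ Sp _ (subst (_∈ I Sp) r (proj₁ jI)))))
             (proj₂ jI) (λ h → y′∉ (ends⊆ M _ h)) (λ h → proj₂ (proj₂ pick₂) (∈∪ (ends M) ⁅ i ⁆ (inj₁ h)))
      i∉M₁ : i ∉ ends M₁
      i∉M₁ h = case ends-suc M₁ M (λ _ → refl) (λ _ → refl) h of λ where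
        (inj₁ r) → y′∉ (I⊆ Sp _ (subst (_∈ I Sp) r (proj₁ iI)))
        (inj₂ (inj₁ r)) → proj₂ (proj₂ pick₂) (∈∪ (ends M) ⁅ i ⁆ (inj₂ (∈⁅⁆ (sym r))))
        (inj₂ (inj₂ c)) → proj₂ (proj₂ pick₁) c
      M⁺⁺ : Matching Y (suc (suc a))
      M⁺⁺ = add-edge (λ x h → proj₁ (∖∈ Y ⁅ y ⁆ h)) M₁ yY (Y′⊆ _ (I⊆ Sp _ (proj₁ iI))) (proj₂ iI)
        (λ h → proj₂ (∖∈ Y ⁅ y ⁆ (ends⊆ M₁ _ h)) (∈⁅⁆ refl)) i∉M₁

-- Embedding across a red clique and a few extra vertices; systems of disjoint books

module Splitting {N : ℕ} (host : BlueGraph N)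
  (κ : ℕ) where
  open BlueGraph host
  open Host host
  open Emb
  open PathInsertion host
  open Sparse-embedding host κ
  open Books host κ

  private
    k = suc κ

  -- W is placed on R; the neighbours of W then avoid the few vertices Z of I with blue edges to R.
  embed-split : ∀ {n} (G : PG n) (I R : Sub N) (W : Sub n) s → Clique I → (∀ x → x ∈ I → x ∉ R) → W ⊆ S G →
    (∀ u v → v ∈ E G u → u ∈ W → v ∉ W) → (∀ w → w ∈ W → deg G w ≤ 2) → count W ≤ count R →
    ord G ≤ count W + count I → (∀ r → r ∈ R → count (I ∩ b r) ≤ s) → count W * 2 + count R * s ≤ count I →
    EmbIn all G
  embed-split {n} G I R W s clique I∩R W⊆S indep deg2 W≤R ord≤ few room =
    weaken (λ _ _ _ → refl , λ ()) (restrict G (λ v a → ∈∪ (D₁ ∪ NW) (S G) (inj₂ a))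
      (greedy G (D₁ ∪ NW) (S G) step₃ (greedy G D₁ NW step₂ (greedy G ∅ W step₁ (empty-emb G)))))
    where
    dNW : ∀ v → Dec (v ∉ W × ∃[ w ] w ∈ W × v ∈ E G w)
    dNW v = ¬? (mem? W v) ×-dec any? (λ w → mem? W w ×-dec mem? (E G w) v)
    NW : Sub n
    NW = set dNW
    dZ : ∀ y → Dec (∃[ r ] y ∈ I × r ∈ R × y ∈ b r)
    dZ y = any? (λ r → mem? I y ×-dec mem? R r ×-dec mem? (b r) y)
    Z : Sub N
    Z = set dZ
    D₁ : Sub n
    D₁ = ∅ ∪ W
    C : Fin n → Fin N → Set
    C v y = (v ∈ W → y ∈ R) × (v ∉ W → y ∈ I × (v ∈ NW → y ∉ Z))
    NW≤ : count NW ≤ count W * 2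
    NW≤ = ≤-trans (count-⋃ NW (λ w → set (dN w)) (λ v a → let w , wW , vw = proj₂ (set∈ dNW a) in w , ∈set (dN w) (wW , vw)))
      (sum-weight W (λ w wW → ≤-trans (count-mono (set (dN w)) (E G w) (λ v a → proj₂ (set∈ (dN w) a))) (deg2 w wW))
        (λ w w∉ → count-empty (set (dN w)) (λ v a → w∉ (proj₁ (set∈ (dN w) a)))))
      where
      dN : ∀ w v → Dec (w ∈ W × v ∈ E G w)
      dN w v = mem? W w ×-dec mem? (E G w) v
    Z≤ : count Z ≤ count R * s
    Z≤ = ≤-trans (count-⋃ Z (λ r → set (dr r)) (λ y a → let r , h = set∈ dZ a in r , ∈set (dr r) h))
      (sum-weight R (λ r rR → ≤-trans (count-mono (set (dr r)) (I ∩ b r)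
          (λ y a → let h₁ , _ , h₂ = set∈ (dr r) a in ∈∩ I (b r) h₁ h₂)) (few r rR))
        (λ r r∉ → count-empty (set (dr r)) (λ y a → r∉ (proj₁ (proj₂ (set∈ (dr r) a))))))
      where
      dr : ∀ r y → Dec (y ∈ I × r ∈ R × y ∈ b r)
      dr r y = mem? I y ×-dec mem? R r ×-dec mem? (b r) y
    step₁ : ∀ D → ∅ ⊆ D → D ⊆ ∅ ∪ W → (e : Emb G D C) → ∀ v → v ∈ W → v ∉ D → Available G e v
    step₁ D _ hi e v vW vD =
      let y , yR , un , ok = available G e v R ∅ 0 (λ u uD vu → ⊥-elim (indep u v vu (∅∪⊆ W u (hi u uD)) vW))
            (≤-trans (s≤s (≤-reflexive (trans (cong (count D +_) (*-zeroʳ (count {n} ∅))) (+-identityʳ _))))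
              (≤-trans (count< D W (λ x a → ∅∪⊆ W x (hi x a)) vW vD) W≤R))
      in y , ((λ _ → yR) , λ h → ⊥-elim (h vW)) , un , ok
    -- The images of `W` lie in `R`, outside `I`, so only the other embedded vertices occupy places
    -- of `I`.
    fresh-in-I : ∀ {D} (e : Emb G D C) (H : Sub N) → H ⊆ I → count (D ∖ W) < count H →
      ∃[ y ] y ∈ H × (∀ u → u ∈ D → φ e u ≢ y)
    fresh-in-I {D} e H H⊆I lt =
      let y , yH , y∉ = count-pick H (set d) (≤-<-trans (count-image (D ∖ W) (set d) (φ e) (λ y → set∈ d)) lt)
      in y , yH , λ u uD q → case mem? W u of λ where
        (yes uW) → I∩R y (H⊆I y yH) (subst (_∈ R) q (proj₁ (con e uD) uW))
        (no uW) → y∉ (∈set d (u , ∈∖ D W uD uW , q))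
      where
      d : ∀ y → Dec (∃[ u ] u ∈ D ∖ W × φ e u ≡ y)
      d y = any? (λ u → mem? (D ∖ W) u ×-dec (φ e u ≟F y))
    step₂ : ∀ D → D₁ ⊆ D → D ⊆ D₁ ∪ NW → (e : Emb G D C) → ∀ v → v ∈ NW → v ∉ D → Available G e v
    step₂ D lo hi e v vN vD =
      let y , yH , un = fresh-in-I e (I ∖ Z) (λ y a → proj₁ (∖∈ I Z a)) (≤-trans (count< (D ∖ W) NW
              (λ x a → let a₁ , a₂ = ∖∈ D W a in [ (λ c → ⊥-elim (a₂ (∅∪⊆ W x c))) , id ]′ (∪∈ D₁ NW (hi x a₁)))
              vN (λ a → vD (proj₁ (∖∈ D W a)))) NW≤I)
          yI , y∉Z = ∖∈ I Z yH
          v∉W = proj₁ (set∈ dNW vN)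
      in y , ((λ h → ⊥-elim (v∉W h)) , λ _ → yI , λ _ → y∉Z) , un , λ u uD vu → case mem? W u of λ where
           (yes uW) → λ yb → y∉Z (∈set dZ (φ e u , yI , proj₁ (con e uD) uW , yb))
           (no u∉W) → clique _ y (proj₁ (proj₂ (con e uD) u∉W)) yI
      where
      NW≤I : count NW ≤ count (I ∖ Z)
      NW≤I = +-cancelʳ-≤ (count R * s) _ _ (≤-trans (+-monoˡ-≤ (count R * s) NW≤) (≤-trans room
        (≤-trans (count-∖ I Z) (+-monoʳ-≤ (count (I ∖ Z)) Z≤))))
    step₃ : ∀ D → (D₁ ∪ NW) ⊆ D → D ⊆ (D₁ ∪ NW) ∪ S G → (e : Emb G D C) → ∀ v → v ∈ S G → v ∉ D → Available G e v
    step₃ D lo hi e v vS vD =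
      let y , yI , un = fresh-in-I e I (λ _ a → a) (≤-trans (count< (D ∖ W) (S G ∖ W)
              (λ x a → let a₁ , a₂ = ∖∈ D W a in ∈∖ (S G) W (inS x (hi x a₁)) a₂)
              (∈∖ (S G) W vS v∉W) (λ a → vD (proj₁ (∖∈ D W a)))) S≤I)
      in y , ((λ h → ⊥-elim (v∉W h)) , λ _ → yI , λ h → ⊥-elim (v∉NW h)) , un , λ u uD vu → case mem? W u of λ where
           (yes uW) → ⊥-elim (v∉NW (∈set dNW (v∉W , u , uW , vu)))
           (no u∉W) → clique _ y (proj₁ (proj₂ (con e uD) u∉W)) yI
      where
      v∉NW : v ∉ NW
      v∉NW h = vD (lo v (∈∪ D₁ NW (inj₂ h)))
      v∉W : v ∉ W
      v∉W h = vD (lo v (∈∪ D₁ NW (inj₁ (∈∪ ∅ W (inj₂ h)))))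
      inS : ∀ x → x ∈ (D₁ ∪ NW) ∪ S G → x ∈ S G
      inS x h = case ∪∈ (D₁ ∪ NW) (S G) h of λ where
        (inj₂ a) → a
        (inj₁ a) → case ∪∈ D₁ NW a of λ where
          (inj₁ c) → W⊆S x (∅∪⊆ W x c)
          (inj₂ c) → let _ , w , _ , xw = set∈ dNW c in E-S′ G xw
      S≤I : count (S G ∖ W) ≤ count I
      S≤I = +-cancelʳ-≤ (count W) _ _ (≤-trans
        (count-+≤ (S G ∖ W) W (S G) (λ x a → proj₁ (∖∈ (S G) W a)) W⊆S (λ x a c → proj₂ (∖∈ (S G) W a) c))
        (≤-trans ord≤ (≤-reflexive (+-comm (count W) (count I)))))

  -- Vertices are addressed by copy and position in the book; `system⇒copy` passes to the single
  -- numbering used by `tB`.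
  record BookSystem (Y : Sub N) (t : ℕ) : Set where
    field
      F : Fin t → Fin (2 + k) → Fin N
      F-inj : ∀ a i a′ i′ → F a i ≡ F a′ i′ → a ≡ a′ × i ≡ i′
      F∈ : ∀ a i → F a i ∈ Y
      F-blue : ∀ a i j → bookAdj k i j ≡ true → F a j ∈ b (F a i)

  open BookSystem

  BlueCopy : ℕ → Set
  BlueCopy t = Σ (Fin (t * (2 + k)) → Fin N) λ f → InjSub f × (∀ x y → tBookAdj t k x y ≡ true → f y ∈ b (f x))

  ∧-true : ∀ {x y} → x ∧ y ≡ true → x ≡ true × y ≡ true
  ∧-true {true} {true} refl = refl , refl

  remQuot-injective : ∀ {t} m (x y : Fin (t * m)) → remQuot {t} m x ≡ remQuot {t} m y → x ≡ y
  remQuot-injective {t} m x y h = trans (sym (combine-remQuot {t} m x))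
    (trans (cong (λ z → combine (proj₁ z) (proj₂ z)) h) (combine-remQuot {t} m y))

  system⇒copy : ∀ {Y t} → BookSystem Y t → BlueCopy t
  system⇒copy {t = t} B = (λ x → F B (proj₁ (remQuot {t} (2 + k) x)) (proj₂ (remQuot {t} (2 + k) x)))
    , (λ x y h → let h₁ , h₂ = F-inj B _ _ _ _ h in remQuot-injective {t} (2 + k) x y (cong₂ _,_ h₁ h₂))
    , λ x y h → let h₁ , h₂ = ∧-true h in
        subst (λ a → F B a (proj₂ (remQuot {t} (2 + k) y)) ∈ b (F B (proj₁ (remQuot {t} (2 + k) x)) (proj₂ (remQuot {t} (2 + k) x))))
          (does-true (proj₁ (remQuot {t} (2 + k) x) ≟F proj₁ (remQuot {t} (2 + k) y)) h₁)
          (F-blue B _ (proj₂ (remQuot {t} (2 + k) x)) (proj₂ (remQuot {t} (2 + k) y)) h₂)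

  clique⇒copy : ∀ {A t} → BlueClique A (t * (2 + k)) → BlueCopy t
  clique⇒copy {t = t} (f , f-inj , _ , blue) = f , f-inj , λ x y h → blue x y
    (λ { refl → true≢false h (tBookAdj-irrefl t k x) })

  book : Fin N → Fin N → (Fin k → Fin N) → Fin (2 + k) → Fin N
  book u v g zero = u
  book u v g (suc zero) = v
  book u v g (suc (suc i)) = g i

  book-blue : ∀ {u v} {g : Fin k → Fin N} → v ∈ b u → (∀ i → g i ∈ b u) → (∀ i → g i ∈ b v) →
    ∀ i j → bookAdj k i j ≡ true → book u v g j ∈ b (book u v g i)
  book-blue uv gu gv zero (suc zero) _ = uv
  book-blue uv gu gv zero (suc (suc j)) _ = gu j
  book-blue uv gu gv (suc zero) zero _ = b-sym uv
  book-blue uv gu gv (suc zero) (suc (suc j)) _ = gv j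
  book-blue uv gu gv (suc (suc i)) zero _ = b-sym (gu i)
  book-blue uv gu gv (suc (suc i)) (suc zero) _ = b-sym (gv i)
  book-blue uv gu gv (suc (suc i)) (suc (suc j)) h = case proj₂ (∧-true {not (does (i ≟F j))} h) of λ ()

  book-inj : ∀ {u v} {g : Fin k → Fin N} → u ≢ v → InjSub g → (∀ i → g i ≢ u) → (∀ i → g i ≢ v) → InjSub (book u v g)
  book-inj uv g-inj gu gv zero zero _ = refl
  book-inj uv g-inj gu gv zero (suc zero) h = ⊥-elim (uv h)
  book-inj uv g-inj gu gv zero (suc (suc j)) h = ⊥-elim (gu j (sym h))
  book-inj uv g-inj gu gv (suc zero) zero h = ⊥-elim (uv (sym h))
  book-inj uv g-inj gu gv (suc zero) (suc zero) _ = refl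
  book-inj uv g-inj gu gv (suc zero) (suc (suc j)) h = ⊥-elim (gv j (sym h))
  book-inj uv g-inj gu gv (suc (suc i)) zero h = ⊥-elim (gu i h)
  book-inj uv g-inj gu gv (suc (suc i)) (suc zero) h = ⊥-elim (gv i h)
  book-inj uv g-inj gu gv (suc (suc i)) (suc (suc j)) h = cong (λ z → suc (suc z)) (g-inj i j h)

  -- All books together need tk pages. As each page set is that large, distinct pages can be chosen
  -- however much the sets overlap.
  edges⇒system : ∀ {Y t} (M : Matching Y t) (Pg : Fin t → Sub N) → (∀ j → t * k ≤ count (Pg j)) →
    (∀ j z → z ∈ Pg j → z ∈ b (Matching.p M j) × z ∈ b (Matching.q M j)) → (∀ j z → z ∈ Pg j → z ∉ Matching.ends M) →
    BookSystem all t
  edges⇒system {Y} {t} M Pg big blue fresh = record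
    { F = F′ ; F-inj = F′-inj ; F∈ = λ _ _ → refl
    ; F-blue = λ a → book-blue (Matching.blue M a) (λ i → proj₁ (blue a _ (gP a i))) (λ i → proj₂ (blue a _ (gP a i))) }
    where
    open Matching M using (p; q; p-inj; q-inj; p≢q; p∈ends; q∈ends)
    rep = sdr (t * k) (λ c → Pg (proj₁ (remQuot {t} k c))) (λ c → big _)
    g : Fin t → Fin k → Fin N
    g a i = proj₁ rep (combine a i)
    gP : ∀ a i → g a i ∈ Pg a
    gP a i = subst (λ z → g a i ∈ Pg (proj₁ z)) (remQuot-combine a i) (proj₂ (proj₂ rep) (combine a i))
    F′ : Fin t → Fin (2 + k) → Fin N
    F′ a = book (p a) (q a) (g a)
    gp : ∀ a i a′ → g a i ≢ p a′
    gp a i a′ h = fresh a _ (gP a i) (subst (_∈ Matching.ends M) (sym h) (p∈ends a′))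
    gq : ∀ a i a′ → g a i ≢ q a′
    gq a i a′ h = fresh a _ (gP a i) (subst (_∈ Matching.ends M) (sym h) (q∈ends a′))
    F′-inj : ∀ a i a′ i′ → F′ a i ≡ F′ a′ i′ → a ≡ a′ × i ≡ i′
    F′-inj a zero a′ zero h = p-inj a a′ h , refl
    F′-inj a zero a′ (suc zero) h = ⊥-elim (p≢q a a′ h)
    F′-inj a zero a′ (suc (suc i′)) h = ⊥-elim (gp a′ i′ a (sym h))
    F′-inj a (suc zero) a′ zero h = ⊥-elim (p≢q a′ a (sym h))
    F′-inj a (suc zero) a′ (suc zero) h = q-inj a a′ h , refl
    F′-inj a (suc zero) a′ (suc (suc i′)) h = ⊥-elim (gq a′ i′ a (sym h))
    F′-inj a (suc (suc i)) a′ zero h = ⊥-elim (gp a i a′ h)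
    F′-inj a (suc (suc i)) a′ (suc zero) h = ⊥-elim (gq a i a′ h)
    F′-inj a (suc (suc i)) a′ (suc (suc i′)) h =
      let r₁ , r₂ = combine-injective a i a′ i′ (proj₁ (proj₂ rep) _ _ h) in r₁ , cong (λ z → suc (suc z)) r₂

  -- If t rounds do not succeed, at most t - 1 books were removed. The loss (t - 1)(k + 2) appears
  -- without subtraction, as the k + 2 on the left side.
  remove-books : ∀ t Y → BookSystem Y t ⊎ ∃[ V ] V ⊆ Y × NoBook V × count Y + (2 + k) ≤ count V + t * (2 + k)
  remove-books zero Y = inj₁ (record { F = λ () ; F-inj = λ () ; F∈ = λ () ; F-blue = λ () })
  remove-books (suc t) Y with any? (λ u → any? (λ v → mem? Y u ×-dec mem? Y v ×-dec mem? (b u) v ×-dec (k ≤? count (Y ∩ (b u ∩ b v)))))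
  ... | no h = inj₂ (Y , (λ _ a → a) , (λ u v a c d → ≰⇒> (λ le → h (u , v , a , c , d , le))) , +-monoʳ-≤ (count Y) (m≤m+n (2 + k) _))
  ... | yes (u , v , uY , vY , uv , big) = case remove-books t (Y ∖ image B) of λ where
        (inj₁ Bs) → inj₁ (record
          { F = λ { zero → B ; (suc a) → F Bs a }
          ; F-inj = λ { zero i zero i′ h → refl , B-inj i i′ h
                      ; zero i (suc a′) i′ h → ⊥-elim (proj₂ (∖∈ Y (image B) (F∈ Bs a′ i′)) (∈image B (i , h)))
                      ; (suc a) i zero i′ h → ⊥-elim (proj₂ (∖∈ Y (image B) (F∈ Bs a i)) (∈image B (i′ , sym h)))
                      ; (suc a) i (suc a′) i′ h → let r₁ , r₂ = F-inj Bs a i a′ i′ h in cong suc r₁ , r₂ }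
          ; F∈ = λ { zero i → B∈ i ; (suc a) i → proj₁ (∖∈ Y (image B) (F∈ Bs a i)) }
          ; F-blue = λ { zero → B-blue ; (suc a) → F-blue Bs a } })
        (inj₂ (V , V⊆ , nb , le)) → inj₂ (V , (λ x a → proj₁ (∖∈ Y (image B) (V⊆ x a))) , nb , (begin
          count Y + (2 + k) ≤⟨ +-monoˡ-≤ (2 + k) (≤-trans (count-∖ Y (image B)) (+-monoʳ-≤ _ (count-image≤ B))) ⟩
          count (Y ∖ image B) + (2 + k) + (2 + k) ≤⟨ +-monoˡ-≤ (2 + k) le ⟩
          count V + t * (2 + k) + (2 + k) ≡⟨ lem (count V) (t * (2 + k)) (2 + k) ⟩
          count V + suc t * (2 + k) ∎))
    where
    open ≤-Reasoning
    lem : ∀ a c d → a + c + d ≡ a + (d + c)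
    lem = solve-∀
    pages = choose k (Y ∩ (b u ∩ b v)) big
    g = proj₁ pages
    g∈ : ∀ i → g i ∈ Y × g i ∈ b u × g i ∈ b v
    g∈ i = let h₁ , h₂ = ∩∈ Y (b u ∩ b v) (proj₂ (proj₂ pages) i) in h₁ , ∩∈ (b u) (b v) h₂
    B : Fin (2 + k) → Fin N
    B = book u v g
    B-inj : InjSub B
    B-inj = book-inj (λ { refl → b-irr uv }) (proj₁ (proj₂ pages))
      (λ i h → b-irr (subst (_∈ b u) h (proj₁ (proj₂ (g∈ i))))) (λ i h → b-irr (subst (_∈ b v) h (proj₂ (proj₂ (g∈ i)))))
    B∈ : ∀ i → B i ∈ Y
    B∈ zero = uY
    B∈ (suc zero) = vY
    B∈ (suc (suc i)) = proj₁ (g∈ i)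
    B-blue : ∀ i j → bookAdj k i j ≡ true → B j ∈ b (B i)
    B-blue = book-blue uv (λ i → proj₁ (proj₂ (g∈ i))) (λ i → proj₂ (proj₂ (g∈ i)))

sequence : ∀ {t} {A : Set} {Q : Fin t → Set} → (∀ j → A ⊎ Q j) → A ⊎ (∀ j → Q j)
sequence {zero} h = inj₂ λ ()
sequence {suc t} h = case h zero of λ where
  (inj₁ a) → inj₁ a
  (inj₂ q) → case sequence (h ∘ suc) of λ where
    (inj₁ a) → inj₁ a
    (inj₂ qs) → inj₂ λ { zero → q ; (suc j) → qs j }

-- Constants and size conditions

-- The book B_k and the number t of its copies, with k = 1 + κ and t = 1 + u.
module Constants (κ u : ℕ) where
  k t c₁ c₂ c₃ L₀ s₀ : ℕ
  k = suc κ
  t = suc u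
  -- Removing t - 1 books from 2n + t - 2 vertices leaves at least 2n - 1 - `c₁`. A near-clique of n
  -- - `c₁` vertices needs `κ` spare ones, so `c₂` leaves must hang elsewhere; the second
  -- near-clique has only n - `c₂` vertices and asks for `c₃`. After the exceptional vertices are
  -- dropped, both sides still have n - `L₀`. Finally `s₀` blue neighbours, at most `c₂` of them
  -- spoiled, leave tk pages.
  c₁ = u * suc k
  c₂ = c₁ + κ
  c₃ = c₂ + κ
  L₀ = c₂ + c₃ * k
  s₀ = c₂ + t * k

  -- Threads have m inner vertices, and n + ℓ bounds the number of edges.
  record Enough (m ℓ n : ℕ) : Set where
    field
      pages : t * k + ((k + u * (2 + k)) + (k + u * (2 + k))) ≤ m
      long : 2 * u ≤ m
      3k≤m : 3 * k ≤ m
      -- One summand `c₂` in this and in the last five conditions is due to the recursion: the last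
      -- stage is run on all graphs of order above n - `c₂`.
      few-leaves : suc m * (6 * L₀ + 6 * ℓ) + c₂ ≤ n
      crude : suc m * (6 * 1 + 6 * ℓ) + k * (2 * (suc m * (6 * 1 + 6 * ℓ) + ℓ)) + suc c₁ ≤ n + n
      core : suc m * (6 * 1 + 6 * ℓ) * k + suc c₁ ≤ n
      marked : suc m * (6 * suc c₃ + 6 * ℓ) * k + c₂ + c₂ ≤ n
      big-cliques : k + 2 * c₃ + L₀ + c₂ ≤ n
      placement : L₀ * (2 + s₀) + L₀ + c₂ ≤ n
      3≤n : 3 + c₂ ≤ n
      matching : u * 2 + u * (2 * t) + u + c₂ ≤ n

-- The last vertices, through a long thread or through many leaves

module BookfreeColouring {N : ℕ} (host : BlueGraph N)
  (κ u : ℕ) (noCopy : ¬ Splitting.BlueCopy host κ (suc u)) where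
  open BlueGraph host
  open Host host
  open Emb
  open PathInsertion host
  open Sparse-embedding host κ
  open Books host κ
  open Splitting host κ

  open Constants κ u

  module ThreadStep {n} (G : PG n) {m : ℕ} (2≤m : 2 ≤ m) (T : Thread G ∅ m)
    (e : EmbIn all (SuppressThread.suppress G 2≤m T))
    (room : ord G + ord G + t ≤ N + 2) (pages : t * k + ((k + u * (2 + k)) + (k + u * (2 + k))) ≤ m)
    (long : 2 * u ≤ m) (large : u * 2 + u * (2 * t) + u ≤ ord G) where
    open SuppressThread G 2≤m T

    private
      Y : Sub N
      Y = all ∖ used e
      un : ∀ {y} → y ∈ Y → ∀ v → v ∈ S suppress → φ e v ≢ y
      un yY = unused⇒ e (proj₂ (∖∈ all (used e) yY))
      pathOf : ℕ → Fin N
      pathOf l = φ e (th (pos l))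

      Y≥ : ord G + t ≤ suc (count Y)
      Y≥ = +-cancelʳ-≤ (ord G + 1) _ _ (begin
        ord G + t + (ord G + 1) ≡⟨ lem (ord G) t ⟩
        ord G + ord G + t + 1 ≤⟨ +-monoˡ-≤ 1 room ⟩
        N + 2 + 1 ≡⟨ cong (λ z → z + 2 + 1) (sym (count-full N)) ⟩
        count (all {N}) + 2 + 1 ≤⟨ +-monoˡ-≤ 1 (+-monoˡ-≤ 2 (≤-trans (count-∖ all (used e)) (+-monoʳ-≤ (count Y) (used≤ e)))) ⟩
        count Y + ord suppress + 2 + 1 ≡⟨ lem₂ (count Y) (ord suppress) ⟩
        suc (count Y) + (suc (ord suppress) + 1) ≤⟨ +-monoʳ-≤ (suc (count Y)) (+-monoˡ-≤ 1 ord-suppress) ⟩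
        suc (count Y) + (ord G + 1) ∎)
        where
        open ≤-Reasoning
        lem : ∀ a c → a + c + (a + 1) ≡ a + a + c + 1
        lem = solve-∀
        lem₂ : ∀ a c → a + c + 2 + 1 ≡ suc a + (suc c + 1)
        lem₂ = solve-∀

      Few : ∀ y → y ∈ Y → Set
      Few y yY = count (reds G ∅ all ∅ m 2≤m T e y refl (un yY)) < suc (k + u * (2 + k))

      -- Outside `V` a blue clique is excluded only once it has t(k + 2) = 2 + k + u(k + 2) vertices
      -- and so contains tB_k; this is where the larger bound on red positions comes from.
      try : ∀ y (yY : y ∈ Y) → EmbIn all G ⊎ Few y yY
      try y yY = insert-or-few-reds G ∅ all ∅ m 2≤m T e y refl (un yY) (suc (k + u * (2 + k))) (λ c → noCopy (clique⇒copy c))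

      -- If no end can be inserted, every edge of the matching has tk common blue neighbours on the
      -- path. Path vertices are used and the ends are free, so pages and ends are disjoint.
      many-edges : Matching Y t → EmbIn all G
      many-edges M = case sequence (λ j → try (p j) (p∈ j)) of λ where
          (inj₁ r) → r
          (inj₂ f) → case sequence (λ j → try (q j) (q∈ j)) of λ where
            (inj₁ r) → r
            (inj₂ f′) → ⊥-elim (noCopy (system⇒copy (edges⇒system M Pg (λ j → enough j (f j) (f′ j))
              (λ j z h → let _ , h′ = ∩∈ (image path′) (b (p j) ∩ b (q j)) h in ∩∈ (b (p j)) (b (q j)) h′)
              (λ j z h h′ → let h₁ , _ = ∩∈ (image path′) (b (p j) ∩ b (q j)) h
                                l , r = image∈ path′ h₁
                            in path≢y G ∅ all ∅ m 2≤m T e z refl (un (ends⊆ z h′)) (toℕ l) (<⇒≤ (toℕ<n l)) r))))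
        where
        open Matching M
        path′ : Fin m → Fin N
        path′ l = pathOf (toℕ l)
        Pg : Fin t → Sub N
        Pg j = image path′ ∩ (b (p j) ∩ b (q j))
        enough : ∀ j → Few (p j) (p∈ j) → Few (q j) (q∈ j) → t * k ≤ count (Pg j)
        enough j f f′ = +-cancelʳ-≤ ((k + u * (2 + k)) + (k + u * (2 + k))) _ _ (≤-trans pages
          (≤-trans (m≤reds+blues G ∅ all ∅ m 2≤m T e (p j) refl (un (p∈ j)) (q j) refl (un (q∈ j)) (Pg j)
              (λ l lt a a′ → ∈∩ (image path′) (b (p j) ∩ b (q j)) (∈image path′ (fromℕ< lt , cong pathOf (toℕ-fromℕ< lt)))
                               (∈∩ (b (p j)) (b (q j)) a a′)))
            (≤-trans (+-monoˡ-≤ (count (Pg j)) (+-mono-≤ (≤-pred f) (≤-pred f′))) (≤-reflexive (+-comm _ (count (Pg j)))))))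

      -- Since |Y| ≥ n + t - 1 and at most t - 1 vertices are uncovered, `I` and `R` together have n
      -- vertices. `R` receives every second inner vertex of the thread: these are independent and
      -- have degree two.
      split : ∀ {a} → a < t → Split Y t a → EmbIn all G
      split {a} a<t Sp = embed-split G I R W (2 * t) clique I∩R W⊆S indep
          (λ w h → let i , r = image∈ odd h in ≤-reflexive (subst (λ z → deg G z ≡ 2) r (deg2 _ (odd< i))))
          (count-image≤ odd) I+W≥ few
          (≤-trans (+-mono-≤ (*-monoˡ-≤ 2 (≤-trans W≤ r≤u)) (*-monoˡ-≤ (2 * t) r≤u)) I≥)
        where
        open Split Sp
        r : ℕ
        r = count R
        r≤u : r ≤ u
        r≤u = ≤-trans R≤ (≤-pred a<t)
        odd : Fin r → Fin n
        odd i = th (suc (2 * toℕ i))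
        odd< : ∀ i → 2 * toℕ i < m
        odd< i = ≤-trans (≤-trans (+-monoʳ-≤ (suc (toℕ i)) (n≤1+n _))
                   (*-monoʳ-≤ 2 (toℕ<n i))) (≤-trans (*-monoʳ-≤ 2 r≤u) long)
        W : Sub n
        W = image odd
        odd-inj : InjSub odd
        odd-inj i j h = toℕ-injective (*-cancelˡ-≡ _ _ 2 (suc-injective (th-inj _ _ (s≤s (<⇒≤ (odd< i))) (s≤s (<⇒≤ (odd< j))) h)))
        W≤ : count W ≤ r
        W≤ = count-image≤ odd
        W⊆S : W ⊆ S G
        W⊆S x h = let i , q = image∈ odd h in subst (_∈ S G) q (th∈S _ (s≤s (<⇒≤ (odd< i))))
        indep : ∀ x y → y ∈ E G x → x ∈ W → y ∉ W
        indep x y xy xW yW = case image∈ odd xW , image∈ odd yW of λ where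
          ((i , refl) , (j , refl)) → case only _ _ (odd< i) xy of λ where
            (inj₁ h) → even≢odd (toℕ i) (toℕ j) (sym (th-inj _ _ (s≤s (<⇒≤ (odd< j))) (m≤n⇒m≤1+n (<⇒≤ (odd< i))) h))
            (inj₂ h) → even≢odd (toℕ j) (toℕ i) (suc-injective (th-inj _ _ (s≤s (<⇒≤ (odd< j))) (s≤s (odd< i)) h))
        I+R≥ : ord G ≤ count I + count R
        I+R≥ = +-cancelʳ-≤ t _ _ (≤-trans Y≥ (≤-trans (s≤s cover)
          (≤-trans (≤-reflexive (sym (+-suc (count I + count R) a))) (+-monoʳ-≤ (count I + count R) a<t))))
        I+W≥ : ord G ≤ count W + count I
        I+W≥ = ≤-trans I+R≥ (≤-trans (≤-reflexive (+-comm (count I) (count R))) (+-monoˡ-≤ (count I) (count-image≥ odd odd-inj)))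
        I≥ : u * 2 + u * (2 * t) ≤ count I
        I≥ = +-cancelʳ-≤ u _ _ (≤-trans large (≤-trans I+R≥ (+-monoʳ-≤ (count I) r≤u)))

    thread-step : EmbIn all G
    thread-step = case matching-or-split t (count Y) Y ≤-refl of λ where
      (inj₁ M) → many-edges M
      (inj₂ (a , a<t , _ , Sp)) → split a<t Sp

  module FinalStage {n} (G : PG n) (m ℓ : ℕ) (3k≤m : 3 * k ≤ m) (sparse : Sparse ℓ G)
    (room : ord G + ord G + t ≤ N + 2) (leaves : L₀ ≤ count (set (λ v → mem? (S G) v ×-dec (deg G v ≟ 1))))
    (base : suc m * (6 * suc c₃ + 6 * ℓ) * k + c₂ ≤ ord G) (large₁ : k + 2 * c₃ + L₀ ≤ ord G)
    (large₂ : L₀ * (2 + s₀) + L₀ ≤ ord G) (3≤ : 3 ≤ ord G)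
    (V : Sub N) (nb : NoBook V) (V≥ : ord G + ord G ≤ count V + suc c₁)
    (embed-smaller : ∀ (G′ : PG n) → Sparse ℓ G′ → ord G′ + c₂ ≤ ord G → EmbIn V G′) where

    private
      nn : ℕ
      nn = ord G
      dL : ∀ v → Dec (v ∈ S G × deg G v ≡ 1)
      dL v = mem? (S G) v ×-dec (deg G v ≟ 1)
      L : Sub n
      L = set dL

      leaf-edge : ∀ {v w z} → v ∈ L → w ∈ E G v → z ∈ E G v → w ≡ z
      leaf-edge {v} vL = count≤1-unique (E G v) (≤-reflexive (proj₂ (set∈ dL vL)))

      -- Two adjacent leaves would be a whole component, but there is a third vertex.
      indep : ∀ v w → w ∈ E G v → v ∈ L → w ∉ L
      indep v w vw vL wL = case count-pick (S G) (⁅ v ⁆ ∪ ⁅ w ⁆) (≤-trans (s≤s (≤-trans (count-∪⁅⁆ ⁅ v ⁆ w) (s≤s (count⁅⁆ v)))) 3≤) of λ where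
        (x , xS , x∉) → case conn G (⁅ v ⁆ ∪ ⁅ w ⁆) (E-S G vw) (∈∪ ⁅ v ⁆ ⁅ w ⁆ (inj₁ (∈⁅⁆ refl))) xS x∉ of λ where
          (a , c , ac , a∈ , c∉) → case ∪∈ ⁅ v ⁆ ⁅ w ⁆ a∈ of λ where
            (inj₁ h) → c∉ (∈∪ ⁅ v ⁆ ⁅ w ⁆ (inj₂ (∈⁅⁆ (leaf-edge vL (subst (λ z → c ∈ E G z) (⁅⁆∈ h) ac) vw))))
            (inj₂ h) → c∉ (∈∪ ⁅ v ⁆ ⁅ w ⁆ (inj₁ (∈⁅⁆ (leaf-edge wL (subst (λ z → c ∈ E G z) (⁅⁆∈ h) ac) (E-sym G vw)))))

      module Strip (c : ℕ) (c≤ : c ≤ L₀) where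
        trimmed = trim c L (≤-trans c≤ leaves)
        W : Sub n
        W = proj₁ trimmed
        W⊆L : W ⊆ L
        W⊆L = proj₁ (proj₂ trimmed)
        W≡ : count W ≡ c
        W≡ = proj₂ (proj₂ trimmed)
        W⊆S : W ⊆ S G
        W⊆S x h = proj₁ (set∈ dL (W⊆L x h))
        W-indep : ∀ v w → w ∈ E G v → v ∈ W → w ∉ W
        W-indep v w vw vW wW = indep v w vw (W⊆L v vW) (W⊆L w wW)
        W-leaf : ∀ w → w ∈ W → deg G w ≡ 1
        W-leaf w h = proj₂ (set∈ dL (W⊆L w h))
        open LiftDelete G W W⊆S W-leaf W-indep public

        parent : ∀ v → v ∈ W → ∃[ x ] x ∈ E G v × x ∈ S delete
        parent v vW = let x , vx = count-inhabited (E G v) (≤-reflexive (sym (W-leaf v vW))) in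
          x , vx , ∈∖ (S G) W (E-S′ G vx) (W-indep v x vx vW)

        dP : ∀ v → Dec (∃[ w ] w ∈ W × v ∈ E G w)
        dP v = any? (λ w → mem? W w ×-dec mem? (E G w) v)
        Par : Sub n
        Par = set dP
        Par≤ : count Par ≤ c
        Par≤ = ≤-trans (count-⋃ Par (λ w → set (dN w)) (λ v h → let w , a , q = set∈ dP h in w , ∈set (dN w) (a , q)))
          (≤-trans (sum-weight W (λ w wW → ≤-trans (count-mono (set (dN w)) (E G w) (λ v h → proj₂ (set∈ (dN w) h)))
                                  (≤-reflexive (W-leaf w wW)))
            (λ w w∉ → count-empty (set (dN w)) (λ v h → w∉ (proj₁ (set∈ (dN w) h)))))
            (≤-reflexive (trans (*-identityʳ _) W≡)))
          where
          dN : ∀ w v → Dec (w ∈ W × v ∈ E G w)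
          dN w v = mem? W w ×-dec mem? (E G w) v

        ord-strip : ord delete + c ≡ nn
        ord-strip = trans (cong (ord delete +_) (sym W≡)) ord-delete

        restore : ∀ {C} → Emb G (S delete ∪ W) C → Emb G (S G) C
        restore = restrict G (λ v vS → ∈∪ (S delete) W (∪-∖ (S G) W v vS))

        -- A parent in `A₁` sees `c` non-blue vertices of `Z`, and the other leaves take at most c -
        -- 1 of them.
        hang-leaves : ∀ A A₁ Z → (∀ x → x ∈ A → x ∉ Z) → (∀ y → y ∈ A₁ → c ≤ count (Z ∖ b y)) →
          Emb delete (S delete) (In A Par A₁) → EmbIn all G
        hang-leaves A A₁ Z A∩Z big e₀ = weaken (λ _ _ _ → refl , λ ()) (restore (greedy G (S delete) W step
            (weaken′ (lift-delete e₀))))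
          where
          C : Fin n → Fin N → Set
          C v y = (v ∉ W → In A Par A₁ v y) × (v ∈ W → y ∈ Z)
          weaken′ : Emb G (S delete) (In A Par A₁) → Emb G (S delete) C
          weaken′ e = record { φ = φ e ; inj = inj e ; red = red e
            ; con = λ uD → (λ _ → con e uD) , λ uW → ⊥-elim (proj₂ (∖∈ (S G) W uD) uW) }
          step : ∀ D → S delete ⊆ D → D ⊆ S delete ∪ W → (e : Emb G D C) → ∀ v → v ∈ W → v ∉ D → Available G e v
          step D lo hi e v vW vD =
            y , ((λ h → ⊥-elim (h vW)) , λ _ → yZ)
              , (λ w wD q → case mem? W w of λ where
                  (yes wW) → y∉ (∈set d (w , ∈∩ D W wD wW , q))
                  (no w∉) → A∩Z y (subst (_∈ A) q (proj₁ (proj₁ (con e wD) w∉))) yZ)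
              , λ w wD wv yb → y∉b (subst (λ z → y ∈ b (φ e z)) (leaf-edge (W⊆L v vW) (E-sym G wv) vx) yb)
            where
            x = proj₁ (parent v vW)
            vx = proj₁ (proj₂ (parent v vW))
            xS = proj₂ (proj₂ (parent v vW))
            d : ∀ y → Dec (∃[ w ] w ∈ D ∩ W × φ e w ≡ y)
            d y = any? (λ w → mem? (D ∩ W) w ×-dec (φ e w ≟F y))
            xA₁ : φ e x ∈ A₁
            xA₁ = proj₂ (proj₁ (con e (lo x xS)) (proj₂ (∖∈ (S G) W xS))) (∈set dP (v , vW , vx))
            pk = count-pick (Z ∖ b (φ e x)) (set d) (≤-trans (s≤s (count-image (D ∩ W) (set d) (φ e) (λ y → set∈ d)))
              (≤-trans (count< (D ∩ W) W (λ w h → proj₂ (∩∈ D W h)) vW (λ h → vD (proj₁ (∩∈ D W h))))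
                (≤-trans (≤-reflexive W≡) (big _ xA₁))))
            y = proj₁ pk
            y∉ = proj₂ (proj₂ pk)
            yZ = proj₁ (∖∈ Z (b (φ e x)) (proj₁ (proj₂ pk)))
            y∉b = proj₂ (∖∈ Z (b (φ e x)) (proj₁ (proj₂ pk)))

      -- Leaves whose parents sit in A₁ are moved from the near-clique A to Z.
      embed-across : ∀ A A₁ Z c → c ≤ c₃ → c ≤ L₀ → A ⊆ V → Near A κ → A₁ ⊆ A → (∀ x → x ∈ A → x ∉ Z) →
        (∀ y → y ∈ A₁ → c ≤ count (Z ∖ b y)) → c * k ≤ count A₁ → nn + κ ≤ count A + c → nn ≤ count A + c₂ →
        EmbIn all G
      embed-across A A₁ Z c c≤ c≤L A⊆V near A₁⊆A A∩Z big many A≥ A≥′ = hang-leaves A A₁ Z A∩Z big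
          (embed-in-near V nb A A⊆V near Par A₁ A₁⊆A m c ℓ 3k≤m Par≤ many base′ (ord delete) delete ≤-refl
            (sparse-delete ℓ sparse) (+-cancelʳ-≤ c _ _ (≤-trans (≤-reflexive (trans (lem (ord delete) κ c) (cong (_+ κ) ord-strip))) A≥)))
        where
        open Strip c c≤L
        lem : ∀ a d e → a + d + e ≡ a + e + d
        lem = solve-∀
        base′ : suc m * (6 * suc c + 6 * ℓ) * k ≤ count A
        base′ = +-cancelʳ-≤ c₂ _ _ (≤-trans (+-monoˡ-≤ c₂ (*-monoˡ-≤ k (*-monoʳ-≤ (suc m) (+-monoˡ-≤ (6 * ℓ) (*-monoʳ-≤ 6 (s≤s c≤))))))
          (≤-trans base A≥′))

      c₁≤c₂ : c₁ ≤ c₂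
      c₁≤c₂ = m≤m+n c₁ κ
      c₂≤c₃ : c₂ ≤ c₃
      c₂≤c₃ = m≤m+n c₂ κ
      c₂≤L₀ : c₂ ≤ L₀
      c₂≤L₀ = m≤m+n c₂ _
      c₃≤L₀ : c₃ ≤ L₀
      c₃≤L₀ = ≤-trans (≤-trans (≤-reflexive (sym (*-identityʳ c₃))) (*-monoʳ-≤ c₃ (s≤s z≤n))) (m≤n+m (c₃ * k) c₂)

      module Cliques (A₂ C₂ : Sub N) (A₂⊆V : A₂ ⊆ V) (C₂⊆V : C₂ ⊆ V) (disj : ∀ x → x ∈ A₂ → x ∉ C₂)
        (fewA : ∀ y → y ∈ A₂ → count (C₂ ∖ b y) ≤ c₂) (fewC : ∀ y → y ∈ C₂ → count (A₂ ∖ b y) ≤ c₃)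
        (A₂≥ : nn ≤ count A₂ + L₀) (C₂≥ : nn ≤ count C₂ + L₀) where

        -- A blue edge in `X` has all but 2`c₃` vertices of `Y` as common blue neighbours; at least
        -- k remain, a book inside `V`.
        clique : ∀ X Y c → X ⊆ V → Y ⊆ V → c ≤ c₃ → nn ≤ count Y + L₀ → (∀ y → y ∈ X → count (Y ∖ b y) ≤ c) → Clique X
        clique X Y c X⊆V Y⊆V c≤ Y≥ few x y xX yX xy = <⇒≱ (≤-trans (s≤s (begin
            count Y ≤⟨ count-≤+ Y ((Y ∖ b x) ∪ (Y ∖ b y)) (V ∩ (b x ∩ b y)) cov ⟩
            count ((Y ∖ b x) ∪ (Y ∖ b y)) + count (V ∩ (b x ∩ b y)) ≤⟨ +-mono-≤
               (≤-trans (count-≤+ _ (Y ∖ b x) (Y ∖ b y) (λ z → ∪∈ (Y ∖ b x) (Y ∖ b y))) (+-mono-≤ (few x xX) (few y yX)))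
               (≤-pred (nb x y (X⊆V x xX) (X⊆V y yX) xy)) ⟩
            c + c + κ ≤⟨ +-monoˡ-≤ κ (+-mono-≤ c≤ c≤) ⟩
            c₃ + c₃ + κ ∎)) (≤-reflexive (lem c₃ κ))) (+-cancelʳ-≤ L₀ _ _ (≤-trans large₁ Y≥))
          where
          open ≤-Reasoning
          lem : ∀ c κ → suc (c + c + κ) ≡ suc κ + 2 * c
          lem = solve-∀
          cov : ∀ z → z ∈ Y → z ∈ (Y ∖ b x) ∪ (Y ∖ b y) ⊎ z ∈ V ∩ (b x ∩ b y)
          cov z zY = case mem? (b x) z of λ where
            (no h) → inj₁ (∈∪ (Y ∖ b x) (Y ∖ b y) (inj₁ (∈∖ Y (b x) zY h)))
            (yes h) → case mem? (b y) z of λ where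
              (no h′) → inj₁ (∈∪ (Y ∖ b x) (Y ∖ b y) (inj₂ (∈∖ Y (b y) zY h′)))
              (yes h′) → inj₂ (∈∩ V (b x ∩ b y) (Y⊆V z zY) (∈∩ (b x) (b y) h h′))

        dBad : ∀ v → Dec (v ∉ A₂ × v ∉ C₂ × s₀ ≤ count (A₂ ∩ b v) × s₀ ≤ count (C₂ ∩ b v))
        dBad v = ¬? (mem? A₂ v) ×-dec ¬? (mem? C₂ v) ×-dec (s₀ ≤? count (A₂ ∩ b v)) ×-dec (s₀ ≤? count (C₂ ∩ b v))
        dA : ∀ v → Dec (v ∉ A₂ × v ∉ C₂ × count (A₂ ∩ b v) < s₀)
        dA v = ¬? (mem? A₂ v) ×-dec ¬? (mem? C₂ v) ×-dec (count (A₂ ∩ b v) <? s₀)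
        dC : ∀ v → Dec (v ∉ A₂ × v ∉ C₂ × count (C₂ ∩ b v) < s₀)
        dC v = ¬? (mem? A₂ v) ×-dec ¬? (mem? C₂ v) ×-dec (count (C₂ ∩ b v) <? s₀)
        Bad RA RC : Sub N
        Bad = set dBad
        RA = set dA
        RC = set dC ∖ RA

        -- Each bad vertex v spans a book with a neighbour in A₂ and pages in C₂.
        Bad≤ : count Bad ≤ u
        Bad≤ = case t ≤? count Bad of λ where
            (no h) → ≤-pred (≰⇒> h)
            (yes h) → ⊥-elim (contra (choose t Bad h))
          where
          contra : (Σ (Fin t → Fin N) λ p → InjSub p × (∀ i → p i ∈ Bad)) → ⊥
          contra (p , p-inj , pB) = noCopy (system⇒copy (edges⇒system M Pg enough
              (λ j z h → let _ , h′ = ∩∈ C₂ (b (p j) ∩ b (q j)) h in ∩∈ (b (p j)) (b (q j)) h′) fresh))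
            where
            reps = sdr t (λ j → A₂ ∩ b (p j)) (λ j → ≤-trans (≤-trans (≤-trans (≤-reflexive (sym (*-identityʳ t))) (*-monoʳ-≤ t (s≤s z≤n)))
                     (m≤n+m (t * k) c₂)) (proj₁ (proj₂ (proj₂ (set∈ dBad (pB j))))))
            q : Fin t → Fin N
            q = proj₁ reps
            q∈ : ∀ j → q j ∈ A₂ × q j ∈ b (p j)
            q∈ j = ∩∈ A₂ (b (p j)) (proj₂ (proj₂ reps) j)
            M : Matching all t
            M = record { p = p ; q = q ; p-inj = p-inj ; q-inj = proj₁ (proj₂ reps)
                       ; p≢q = λ i j h → proj₁ (set∈ dBad (pB i)) (subst (_∈ A₂) (sym h) (proj₁ (q∈ j)))
                       ; p∈ = λ _ → refl ; q∈ = λ _ → refl ; blue = λ j → proj₂ (q∈ j) }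
            Pg : Fin t → Sub N
            Pg j = C₂ ∩ (b (p j) ∩ b (q j))
            -- Of the at least `s₀` blue neighbours of the bad vertex in `C₂`, at most `c₂` fail to
            -- be blue to `q j`.
            enough : ∀ j → t * k ≤ count (Pg j)
            enough j = +-cancelʳ-≤ c₂ _ _ (≤-trans (≤-reflexive (+-comm (t * k) c₂))
              (≤-trans (proj₂ (proj₂ (proj₂ (set∈ dBad (pB j)))))
                (≤-trans (count-≤+ (C₂ ∩ b (p j)) (Pg j) (C₂ ∖ b (q j)) (λ z h → let h₁ , h₂ = ∩∈ C₂ (b (p j)) h in
                    case mem? (b (q j)) z of λ where
                      (yes a) → inj₁ (∈∩ C₂ (b (p j) ∩ b (q j)) h₁ (∈∩ (b (p j)) (b (q j)) h₂ a))
                      (no a) → inj₂ (∈∖ C₂ (b (q j)) h₁ a)))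
                  (+-monoʳ-≤ (count (Pg j)) (fewA (q j) (proj₁ (q∈ j)))))))
            fresh : ∀ j z → z ∈ Pg j → z ∉ Matching.ends M
            fresh j z h h′ = let zC = proj₁ (∩∈ C₂ (b (p j) ∩ b (q j)) h) in case ∪∈ (image p) (image q) h′ of λ where
              (inj₁ a) → let i , r = image∈ p a in proj₁ (proj₂ (set∈ dBad (pB i))) (subst (_∈ C₂) (sym r) zC)
              (inj₂ a) → let i , r = image∈ q a in disj z (subst (_∈ A₂) r (proj₁ (q∈ i))) zC

        cover : N ≤ count A₂ + count RA + (count C₂ + count RC) + count Bad
        cover = ≤-trans (≤-reflexive (sym (count-full N))) (≤-trans
          (count-≤+ all ((A₂ ∪ RA) ∪ (C₂ ∪ RC)) Bad cases)
          (+-monoˡ-≤ (count Bad) (≤-trans (count-≤+ ((A₂ ∪ RA) ∪ (C₂ ∪ RC)) (A₂ ∪ RA) (C₂ ∪ RC) (λ z → ∪∈ (A₂ ∪ RA) (C₂ ∪ RC)))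
            (+-mono-≤ (count-≤+ (A₂ ∪ RA) A₂ RA (λ z → ∪∈ A₂ RA)) (count-≤+ (C₂ ∪ RC) C₂ RC (λ z → ∪∈ C₂ RC))))))
          where
          cases : ∀ v → v ∈ all → v ∈ (A₂ ∪ RA) ∪ (C₂ ∪ RC) ⊎ v ∈ Bad
          cases v _ = case mem? A₂ v of λ where
            (yes h) → inj₁ (∈∪ (A₂ ∪ RA) (C₂ ∪ RC) (inj₁ (∈∪ A₂ RA (inj₁ h))))
            (no a) → case mem? C₂ v of λ where
              (yes h) → inj₁ (∈∪ (A₂ ∪ RA) (C₂ ∪ RC) (inj₂ (∈∪ C₂ RC (inj₁ h))))
              (no c) → case mem? RA v of λ where
                (yes h) → inj₁ (∈∪ (A₂ ∪ RA) (C₂ ∪ RC) (inj₁ (∈∪ A₂ RA (inj₂ h))))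
                (no r) → case count (C₂ ∩ b v) <? s₀ of λ where
                  (yes h) → inj₁ (∈∪ (A₂ ∪ RA) (C₂ ∪ RC) (inj₂ (∈∪ C₂ RC (inj₂ (∈∖ (set dC) RA (∈set dC (a , c , h)) r)))))
                  (no h) → inj₂ (∈set dBad (a , c , ≮⇒≥ (λ lt → r (∈set dA (a , c , lt))) , ≮⇒≥ h))

        -- The clique lacks at most `L₀` vertices, and as many leaves of G are put on vertices of
        -- `R`. If `I` already has n vertices, the truncated difference `r` is zero.
        place : ∀ I R → Clique I → (∀ x → x ∈ I → x ∉ R) → (∀ r → r ∈ R → count (I ∩ b r) ≤ s₀) →
          nn ≤ count I + L₀ → nn ≤ count I + count R → EmbIn all G
        place I R cl I∩R few I≥ I+R≥ = embed-split G I R′ W s₀ cl (λ x xI h → I∩R x xI (R′⊆ x h)) W⊆S W-indep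
            (λ w h → ≤-trans (≤-reflexive (W-leaf w h)) (s≤s z≤n)) (≤-reflexive (trans W≡ (sym R′≡)))
            (≤-trans (m≤n+m∸n nn (count I)) (≤-reflexive (trans (+-comm (count I) r) (cong (_+ count I) (sym W≡)))))
            (λ y h → few y (R′⊆ y h))
            (≤-trans (≤-reflexive (trans (cong₂ (λ a c → a * 2 + c * s₀) W≡ R′≡) (sym (*-distribˡ-+ r 2 s₀))))
              (≤-trans (*-monoˡ-≤ (2 + s₀) r≤) (+-cancelʳ-≤ L₀ _ _ (≤-trans large₂ I≥))))
          where
          r : ℕ
          r = nn ∸ count I
          r≤ : r ≤ L₀
          r≤ = m≤n+o⇒m∸n≤o nn (count I) I≥
          open Strip r r≤
          tr = trim r R (m≤n+o⇒m∸n≤o nn (count I) I+R≥)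
          R′ : Sub N
          R′ = proj₁ tr
          R′⊆ : R′ ⊆ R
          R′⊆ = proj₁ (proj₂ tr)
          R′≡ : count R′ ≡ r
          R′≡ = proj₂ (proj₂ tr)

        -- With at most t - 1 bad vertices among at least 2n + t - 2, the two sides together have at
        -- least 2n - 1, so one of them has n.
        enough : nn + nn ≤ suc (count A₂ + count RA + (count C₂ + count RC))
        enough = +-cancelʳ-≤ t _ _ (≤-trans room (≤-trans (+-monoˡ-≤ 2 cover)
          (≤-trans (+-monoˡ-≤ 2 (+-monoʳ-≤ (count A₂ + count RA + (count C₂ + count RC)) Bad≤))
            (≤-reflexive (lem (count A₂ + count RA + (count C₂ + count RC)) u)))))
          where
          lem : ∀ a u → a + u + 2 ≡ suc a + suc u
          lem = solve-∀

        conclude : EmbIn all G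
        conclude = case nn ≤? count A₂ + count RA of λ where
          (yes h) → place A₂ RA (clique A₂ C₂ c₂ A₂⊆V C₂⊆V c₂≤c₃ C₂≥ fewA) (λ x a h → proj₁ (set∈ dA h) a)
                      (λ r h → <⇒≤ (proj₂ (proj₂ (set∈ dA h)))) A₂≥ h
          (no h) → place C₂ RC (clique C₂ A₂ c₃ C₂⊆V A₂⊆V ≤-refl A₂≥ fewC)
                      (λ x a h → proj₁ (proj₂ (set∈ dC (proj₁ (∖∈ (set dC) RA h)))) a)
                      (λ r h → <⇒≤ (proj₂ (proj₂ (set∈ dC (proj₁ (∖∈ (set dC) RA h)))))) C₂≥
                      (+-cancelˡ-≤ (suc (count A₂ + count RA)) _ _ (≤-trans (+-monoˡ-≤ nn (≰⇒> h)) enough))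

      -- `A` has been cut down to exactly n - `c₁` vertices, so that at least n - 1 are left in `Z`
      -- for the second near-clique.
      module TwoCliques (A : Sub N) (A⊆V : A ⊆ V) (near : Near A κ) (A≡ : count A + c₁ ≡ nn) where
        Z : Sub N
        Z = V ∖ A
        Z≥ : nn ≤ suc (count Z)
        Z≥ = +-cancelʳ-≤ nn _ _ (≤-trans V≥ (≤-trans (+-monoˡ-≤ (suc c₁) (count-∖ V A))
          (≤-reflexive (trans (lem (count Z) (count A) c₁) (cong (suc (count Z) +_) A≡)))))
          where
          lem : ∀ z a c → z + a + suc c ≡ suc z + (a + c)
          lem = solve-∀
        A∩Z : ∀ x → x ∈ A → x ∉ Z
        A∩Z x xA h = proj₂ (∖∈ V A h) xA
        dA₁ : ∀ a → Dec (a ∈ A × c₂ ≤ count (Z ∖ b a))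
        dA₁ a = mem? A a ×-dec (c₂ ≤? count (Z ∖ b a))
        A₁ A₂ : Sub N
        A₁ = set dA₁
        A₂ = A ∖ A₁
        A₂⊆A : A₂ ⊆ A
        A₂⊆A x h = proj₁ (∖∈ A A₁ h)
        A₂-few : ∀ a → a ∈ A₂ → count (Z ∖ b a) < c₂
        A₂-few a h = ≰⇒> (λ le → proj₂ (∖∈ A A₁ h) (∈set dA₁ (A₂⊆A a h , le)))

        module Second (A₁< : count A₁ < c₂ * k) where
          A₂≥ : nn ≤ count A₂ + L₀
          A₂≥ = ≤-trans (≤-reflexive (sym A≡)) (≤-trans (+-monoˡ-≤ c₁ (count-∖ A A₁))
            (≤-trans (≤-reflexive (trans (+-assoc (count A₂) (count A₁) c₁) (cong (count A₂ +_) (+-comm (count A₁) c₁))))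
              (+-monoʳ-≤ (count A₂) (+-mono-≤ c₁≤c₂ (≤-trans (<⇒≤ A₁<) (*-monoˡ-≤ k c₂≤c₃))))))
          0<A₂ : 0 < count A₂
          0<A₂ = ≤-trans (s≤s z≤n) (+-cancelʳ-≤ L₀ (k + 2 * c₃) (count A₂) (≤-trans large₁ A₂≥))
          a₀ : Fin N
          a₀ = proj₁ (count-inhabited A₂ 0<A₂)
          a₀∈ : a₀ ∈ A₂
          a₀∈ = proj₂ (count-inhabited A₂ 0<A₂)
          -- As `a₀` is blue to all but fewer than `c₂` vertices of `Z`, its blue neighbourhood
          -- there is a near-clique of at least n - `c₂` vertices.
          C : Sub N
          C = Z ∩ b a₀
          C⊆Z : C ⊆ Z
          C⊆Z x h = proj₁ (∩∈ Z (b a₀) h)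
          C⊆V : C ⊆ V
          C⊆V x h = proj₁ (∖∈ V A (C⊆Z x h))
          C≥ : nn ≤ count C + c₂
          C≥ = ≤-trans Z≥ (≤-trans (s≤s (count-≤+ Z C (Z ∖ b a₀) (λ x h → case mem? (b a₀) x of λ where
                 (yes q) → inj₁ (∈∩ Z (b a₀) h q)
                 (no q) → inj₂ (∈∖ Z (b a₀) h q))))
               (≤-trans (≤-reflexive (sym (+-suc (count C) _))) (+-monoʳ-≤ (count C) (A₂-few a₀ a₀∈))))
          C-near : Near C κ
          C-near = near-in nb (A⊆V a₀ (A₂⊆A a₀ a₀∈)) C⊆V (λ x h → proj₂ (∩∈ Z (b a₀) h))
          dC₁ : ∀ c → Dec (c ∈ C × c₃ ≤ count (A₂ ∖ b c))
          dC₁ c = mem? C c ×-dec (c₃ ≤? count (A₂ ∖ b c))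
          C₁ C₂ : Sub N
          C₁ = set dC₁
          C₂ = C ∖ C₁
          C₂⊆C : C₂ ⊆ C
          C₂⊆C x h = proj₁ (∖∈ C C₁ h)
          C∩A₂ : ∀ x → x ∈ C → x ∉ A₂
          C∩A₂ x xC h = A∩Z x (A₂⊆A x h) (C⊆Z x xC)

          second : EmbIn all G
          second = case c₃ * k ≤? count C₁ of λ where
            (yes many) → embed-across C C₁ A₂ c₃ ≤-refl c₃≤L₀ C⊆V C-near (λ x h → proj₁ (set∈ dC₁ h)) C∩A₂
              (λ y h → proj₂ (set∈ dC₁ h)) many
              (≤-trans (+-monoˡ-≤ κ C≥) (≤-reflexive (+-assoc (count C) c₂ κ))) C≥
            (no few) → Cliques.conclude A₂ C₂ (λ x h → A⊆V x (A₂⊆A x h)) (λ x h → C⊆V x (C₂⊆C x h))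
              (λ x h h′ → C∩A₂ x (C₂⊆C x h′) h)
              (λ y h → ≤-trans (count-mono (C₂ ∖ b y) (Z ∖ b y) (λ x q → let q₁ , q₂ = ∖∈ C₂ (b y) q in
                  ∈∖ Z (b y) (C⊆Z x (C₂⊆C x q₁)) q₂)) (<⇒≤ (A₂-few y h)))
              (λ y h → <⇒≤ (≰⇒> (λ le → proj₂ (∖∈ C C₁ h) (∈set dC₁ (C₂⊆C y h , le)))))
              A₂≥
              (≤-trans C≥ (≤-trans (+-monoˡ-≤ c₂ (≤-trans (count-∖ C C₁) (+-monoʳ-≤ (count C₂) (<⇒≤ (≰⇒> few)))))
                (≤-reflexive (trans (+-assoc (count C₂) (c₃ * k) c₂) (cong (count C₂ +_) (+-comm (c₃ * k) c₂))))))

        first : EmbIn all G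
        first = case c₂ * k ≤? count A₁ of λ where
          (yes many) → embed-across A A₁ Z c₂ c₂≤c₃ c₂≤L₀ A⊆V near (λ x h → proj₁ (set∈ dA₁ h)) A∩Z
              (λ y h → proj₂ (set∈ dA₁ h)) many
              (≤-reflexive (trans (cong (_+ κ) (sym A≡)) (+-assoc (count A) c₁ κ)))
              (≤-trans (≤-reflexive (sym A≡)) (+-monoʳ-≤ (count A) c₁≤c₂))
          (no few) → Second.second (≰⇒> few)

    final-stage : EmbIn all G
    -- The test looks for a vertex with fewer than n non-blue vertices in `V`. If there is none,
    -- every leaf fits, since at most n - 1 places are taken.
    final-stage = case any? (λ x → mem? V x ×-dec (suc (count V) ≤? count (V ∩ b x) + nn)) of λ where
        (yes (x , xV , big)) → let A , A⊆ , A≡ = trim (nn ∸ c₁) (V ∩ b x) (m≤n+o⇒m∸n≤o nn c₁ (nbr≥ x big)) in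
          TwoCliques.first A (λ y h → proj₁ (∩∈ V (b x) (A⊆ y h)))
            (near-in nb xV (λ y h → proj₁ (∩∈ V (b x) (A⊆ y h))) (λ y h → proj₂ (∩∈ V (b x) (A⊆ y h))))
            (trans (cong (_+ c₁) A≡) (m∸n+n≡m c₁≤nn))
        (no h) → weaken (λ _ _ _ → refl , λ ()) (restore (greedy G (S delete) W
          (λ D lo hi e v vW vD → let x , vx , xS = parent v vW
                                     y , yV , un , ok = available G e v V (E G v) (count (V ∩ b (φ e x)))
                                        (λ w wD wv → E-sym G wv , ≤-reflexive (cong (λ z → count (V ∩ b (φ e z)))
                                          (leaf-edge (W⊆L v vW) (E-sym G wv) vx)))
                                        (leaf-room D hi v vW vD (φ e x) (≮⇒≥ (λ q → h (φ e x , proj₁ (con e (lo x xS)) , q))))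
                                 in y , (yV , λ ()) , un , ok)
          (lift-delete (embed-smaller delete (sparse-delete ℓ sparse) (≤-reflexive ord-strip)))))
      where
      open Strip c₂ c₂≤L₀
      c₁≤nn : c₁ ≤ nn
      c₁≤nn = ≤-trans (≤-trans c₁≤c₂ c₂≤L₀) (≤-trans (m≤n+m L₀ (L₀ * (2 + s₀))) large₂)
      nbr≥ : ∀ x → suc (count V) ≤ count (V ∩ b x) + nn → nn ≤ c₁ + count (V ∩ b x)
      nbr≥ x big = +-cancelʳ-≤ nn _ _ (≤-trans V≥ (≤-trans (≤-reflexive (+-suc (count V) c₁)) (≤-trans (+-monoˡ-≤ c₁ big)
        (≤-reflexive (lem (count (V ∩ b x)) nn c₁)))))
        where
        lem : ∀ a c d → a + c + d ≡ d + a + c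
        lem = solve-∀
      leaf-room : ∀ D → D ⊆ S delete ∪ W → ∀ v → v ∈ W → v ∉ D → ∀ y → count (V ∩ b y) + nn ≤ count V →
        count D + count (E G v) * count (V ∩ b y) < count V
      leaf-room D hi v vW vD y le = ≤-trans (≤-reflexive (cong (λ z → suc (count D + z)) (trans (cong (_* count (V ∩ b y)) (W-leaf v vW)) (*-identityˡ _))))
        (≤-trans (+-monoˡ-≤ _ (count< D (S G) (λ x h → [ (λ q → proj₁ (∖∈ (S G) W q)) , W⊆S x ]′ (∪∈ (S delete) W (hi x h))) (W⊆S v vW) vD))
          (≤-trans (≤-reflexive (+-comm nn _)) le))

-- The upper bound for the host

module UpperBound {N : ℕ} (host : BlueGraph N)
  (κ u m ℓ n₀ : ℕ) (enough : Constants.Enough κ u m ℓ n₀) where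
  open BlueGraph host
  open Host host
  open Sparse-embedding host κ
  open Books host κ
  open Splitting host κ
  open Constants κ u
  open Enough enough

  private
    B : ℕ
    B = suc m * (6 * 1 + 6 * ℓ)

  module _ (noCopy : ¬ BlueCopy t) (room₀ : n₀ + n₀ + t ≤ N + 2) where
    open BookfreeColouring host κ u noCopy

    module _ (V : Sub N) (nb : NoBook V) (V≥N : count {N} all + (2 + k) ≤ count V + t * (2 + k)) where

      private
        V≥ : n₀ + n₀ ≤ count V + suc c₁
        V≥ = +-cancelʳ-≤ (t + (2 + k)) _ _ (begin
          n₀ + n₀ + (t + (2 + k)) ≡⟨ sym (+-assoc (n₀ + n₀) t (2 + k)) ⟩
          n₀ + n₀ + t + (2 + k) ≤⟨ +-monoˡ-≤ (2 + k) room₀ ⟩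
          N + 2 + (2 + k) ≡⟨ cong (λ z → z + 2 + (2 + k)) (sym (count-full N)) ⟩
          count {N} all + 2 + (2 + k) ≡⟨ lem (count {N} all) (2 + k) ⟩
          count {N} all + (2 + k) + 2 ≤⟨ +-monoˡ-≤ 2 V≥N ⟩
          count V + t * (2 + k) + 2 ≡⟨ lem₂ (count V) u k ⟩
          count V + suc c₁ + (t + (2 + k)) ∎)
          where
          open ≤-Reasoning
          lem : ∀ a c → a + 2 + c ≡ a + c + 2
          lem = solve-∀
          lem₂ : ∀ v u k → v + suc u * (2 + k) + 2 ≡ v + suc (u * suc k) + (suc u + (2 + k))
          lem₂ = solve-∀

        -- The order up to which restarting inside `V` works. The remaining `c₂` vertices are
        -- exactly as many as the leaves stripped first by `final-stage`.
        s : ℕ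
        s = n₀ ∸ c₂

        ≤s : ∀ {a} → a + c₂ ≤ n₀ → a ≤ s
        ≤s {a} le = m+n≤o⇒m≤o∸n a le

        s+c₂ : s + c₂ ≡ n₀
        s+c₂ = m∸n+n≡m (≤-trans (m≤n+m c₂ 3) 3≤n)

        s≤n₀ : s ≤ n₀
        s≤n₀ = m∸n≤m n₀ c₂

        embed-small : ∀ {n} (G : PG n) → Sparse ℓ G → ord G ≤ s → EmbIn V G
        embed-small G sp le = embed-in-bookfree V nb m ℓ s 3k≤m h₁ h₂ h₃ (ord G) G ≤-refl sp le
          where
          open ≤-Reasoning
          h₁ : 2 * s + k ≤ count V + 2
          h₁ = +-cancelʳ-≤ (c₂ + c₂) _ _ (begin
            2 * s + k + (c₂ + c₂) ≡⟨ lem s k c₂ ⟩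
            (s + c₂) + (s + c₂) + k ≡⟨ cong (λ z → z + z + k) s+c₂ ⟩
            n₀ + n₀ + k ≤⟨ +-monoˡ-≤ k V≥ ⟩
            count V + suc c₁ + k ≡⟨ lem₂ (count V) c₁ κ ⟩
            count V + 2 + c₂ ≤⟨ +-monoʳ-≤ (count V + 2) (m≤m+n c₂ c₂) ⟩
            count V + 2 + (c₂ + c₂) ∎)
            where
            lem : ∀ s k c → 2 * s + k + (c + c) ≡ (s + c) + (s + c) + k
            lem = solve-∀
            lem₂ : ∀ v c κ → v + suc c + suc κ ≡ v + 2 + (c + κ)
            lem₂ = solve-∀
          h₂ : B + k * (2 * (B + ℓ)) ≤ count V
          h₂ = +-cancelʳ-≤ (suc c₁) _ _ (≤-trans crude V≥)
          h₃ : B * k + s ≤ count V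
          h₃ = +-cancelʳ-≤ (suc c₁) _ _ (begin
            B * k + s + suc c₁ ≡⟨ lem (B * k) s (suc c₁) ⟩
            B * k + suc c₁ + s ≤⟨ +-mono-≤ core s≤n₀ ⟩
            n₀ + n₀ ≤⟨ V≥ ⟩
            count V + suc c₁ ∎)
            where
            lem : ∀ a c d → a + c + d ≡ a + d + c
            lem = solve-∀

        everywhere : ∀ {n} {G : PG n} {D A} → Emb G D (In A ∅ ∅) → Emb G D (In all ∅ ∅)
        everywhere = weaken (λ _ _ _ → refl , λ ())

        module Large {n} (G : PG n) (sp : Sparse ℓ G) (le : ord G ≤ n₀) (large : ord G ≰ s) where
          n₀≤ : n₀ ≤ ord G + c₂
          n₀≤ = ≤-trans (≤-reflexive (sym s+c₂)) (+-monoˡ-≤ c₂ (<⇒≤ (≰⇒> large)))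

          ≤ord : ∀ {a} → a + c₂ ≤ n₀ → a ≤ ord G
          ≤ord h = +-cancelʳ-≤ c₂ _ _ (≤-trans h n₀≤)

          room : ord G + ord G + t ≤ N + 2
          room = ≤-trans (+-monoˡ-≤ t (+-mono-≤ le le)) room₀

          L : Sub n
          L = set (λ v → mem? (S G) v ×-dec (deg G v ≟ 1))

          many-leaves : L₀ ≤ count L → EmbIn all G
          many-leaves leaves = FinalStage.final-stage G m ℓ 3k≤m sp room leaves
            (≤ord marked) (≤ord big-cliques) (≤ord placement) (≤ord 3≤n) V nb
            (≤-trans (+-mono-≤ le le) V≥)
            (λ G′ sp′ le′ → embed-small G′ sp′ (≤s (≤-trans le′ le)))

          not-small : count L < L₀ → ord G ≰ suc m * (6 * suc (count L) + 6 * ℓ)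
          not-small lt h = large (≤s (≤-trans (+-monoˡ-≤ c₂ (≤-trans h
            (*-monoʳ-≤ (suc m) (+-monoˡ-≤ (6 * ℓ) (*-monoʳ-≤ 6 lt))))) few-leaves))

          unmark : Thread G L m → Thread G ∅ m
          unmark T = record { th = th ; th-inj = th-inj ; th-adj = th-adj ; only = only ; free = λ _ _ () ; deg2 = deg2 }
            where open Thread T

          2≤m : 2 ≤ m
          2≤m = 2≤3k 3k≤m

          thread-case : (T : Thread G ∅ m) → let open SuppressThread G 2≤m T in
            EmbIn all suppress → EmbIn all G
          thread-case T e = ThreadStep.thread-step G 2≤m T e room pages long (≤ord matching)

      embed : ∀ {n} fuel (G : PG n) → ord G ≤ fuel → Sparse ℓ G → ord G ≤ n₀ → EmbIn all G
      embed fuel G fu sp le with ord G ≤? s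
      ... | yes q = everywhere (embed-small G sp q)
      ... | no large with L₀ ≤? count (Large.L G sp le large)
      ...   | yes h = Large.many-leaves G sp le large h
      -- All leaves are marked, so no leaf can be returned; as there are fewer than `L₀` of them,
      -- the graph is too large for `small`, and a thread remains.
      ...   | no h with reduction G (Large.L G sp le large) m (count (Large.L G sp le large)) ℓ ≤-refl sp
      ...     | small sm = ⊥-elim (Large.not-small G sp le large (≰⇒> h) sm)
      ...     | leaf v vS v∉L lf = ⊥-elim (v∉L (∈set (λ v → mem? (S G) v ×-dec (deg G v ≟ 1)) (vS , lf)))
      embed zero G fu sp le | no large | no h | thread T = ⊥-elim (large (≤-trans fu z≤n))
      embed (suc fuel) G fu sp le | no large | no h | thread T = thread-case T′
          (embed fuel suppress (≤-pred (≤-trans ord-suppress fu)) (sparse-suppress ℓ sp) (≤-trans (<⇒≤ ord-suppress) le))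
        where
        open Large G sp le large
        T′ = unmark T
        open SuppressThread G 2≤m T′

    upper-bound : ∀ {n} (G : PG n) → Sparse ℓ G → ord G ≤ n₀ → EmbIn all G
    upper-bound G sp le = case remove-books t all of λ where
      (inj₁ Bs) → ⊥-elim (noCopy (system⇒copy Bs))
      (inj₂ (V , _ , nb , V≥)) → embed V nb V≥ (ord G) G ≤-refl sp le

-- Numerical verification of the size conditions

-- In κ = k - 1 and u = t - 1 every difference below has nonnegative coefficients.
slack : ∀ {a c} d → a + d ≡ c → a ≤ c
slack {a} d refl = m≤m+n a d

module _ (κ u : ℕ) where
  open Constants κ u

  private
    m M : ℕ
    -- The condition `pages` asks for 3tk + 4u; this value exceeds it by three.
    m = 3 * (t * k) + 3 * t + u
    M = suc m

  pages-poly : t * k + ((k + u * (2 + k)) + (k + u * (2 + k))) ≤ m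
  pages-poly = slack _ (lem κ u)
    where
    lem : ∀ κ u → let k = suc κ ; t = suc u ; m = 3 * (t * k) + 3 * t + u in
      t * k + ((k + u * (2 + k)) + (k + u * (2 + k))) + 3 ≡ m
    lem = solve-∀

  long-poly : 2 * u ≤ m
  long-poly = slack _ (lem κ u)
    where
    lem : ∀ κ u → let k = suc κ ; t = suc u ; m = 3 * (t * k) + 3 * t + u in
      2 * u + ((6 + 5 * u) + (3 + 3 * u) * κ) ≡ m
    lem = solve-∀

  3k-poly : 3 * k ≤ m
  3k-poly = slack _ (lem κ u)
    where
    lem : ∀ κ u → let k = suc κ ; t = suc u ; m = 3 * (t * k) + 3 * t + u in
      3 * k + ((3 + 7 * u) + (3 * u) * κ) ≡ m
    lem = solve-∀

  -- The three slope bounds concern the coefficients of `ℓ` in the size conditions; with ℓD ≤ n they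
  -- turn into fractions of n.
  slope₁ : 4 * (6 * M) ≤ (127 * t ^ 2 * k ^ 2 + 79 * t ^ 2 * k)
  slope₁ = slack _ (lem κ u)
    where
    lem : ∀ κ u → let k = suc κ ; t = suc u ; m = 3 * (t * k) + 3 * t + u ; M = suc m in
      4 * (6 * M) + ((38 + 244 * u + 206 * u * u) + (261 + 594 * u + 333 * u * u) * κ + (127 + 254 * u + 127 * u * u) * κ * κ) ≡ (127 * (t * (t * 1)) * (k * (k * 1)) + 79 * (t * (t * 1)) * k)
    lem = solve-∀

  slope₂ : 3 * (6 * M + 12 * k * M + 2 * k) ≤ 2 * (127 * t ^ 2 * k ^ 2 + 79 * t ^ 2 * k)
  slope₂ = slack _ (lem κ u)
    where
    lem : ∀ κ u → let k = suc κ ; t = suc u ; m = 3 * (t * k) + 3 * t + u ; M = suc m in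
      3 * (6 * M + 12 * k * M + 2 * k) + ((28 + 446 * u + 412 * u * u) + (246 + 918 * u + 666 * u * u) * κ + (146 + 400 * u + 254 * u * u) * κ * κ) ≡ 2 * (127 * (t * (t * 1)) * (k * (k * 1)) + 79 * (t * (t * 1)) * k)
    lem = solve-∀

  slope₃ : 4 * (6 * M * k) ≤ (127 * t ^ 2 * k ^ 2 + 79 * t ^ 2 * k)
  slope₃ = slack _ (lem κ u)
    where
    lem : ∀ κ u → let k = suc κ ; t = suc u ; m = 3 * (t * k) + 3 * t + u ; M = suc m in
      4 * (6 * M * k) + ((38 + 244 * u + 206 * u * u) + (93 + 426 * u + 333 * u * u) * κ + (55 + 182 * u + 127 * u * u) * κ * κ) ≡ (127 * (t * (t * 1)) * (k * (k * 1)) + 79 * (t * (t * 1)) * k)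
    lem = solve-∀

  few-leaves-poly : 4 * (6 * M * L₀ + c₂) ≤ 3 * (111 * t ^ 3 * k ^ 3)
  few-leaves-poly = slack _ (lem κ u)
    where
    lem : ∀ κ u → let k = suc κ ; t = suc u ; c₁ = u * suc k ; c₂ = c₁ + κ ; c₃ = c₂ + κ ; L₀ = c₂ + c₃ * k ; m = 3 * (t * k) + 3 * t + u ; M = suc m in
      4 * (6 * M * L₀ + c₂) + ((333 + 319 * u + 327 * u * u + 333 * u * u * u) + (491 + 1529 * u + 2037 * u * u + 999 * u * u * u) * κ + (447 + 1989 * u + 2541 * u * u + 999 * u * u * u) * κ * κ + (189 + 783 * u + 927 * u * u + 333 * u * u * u) * κ * κ * κ) ≡ 3 * (111 * (t * (t * (t * 1))) * (k * (k * (k * 1))))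
    lem = solve-∀

  crude-poly : 3 * (6 * M + 12 * k * M + suc c₁) ≤ 4 * (111 * t ^ 3 * k ^ 3)
  crude-poly = slack _ (lem κ u)
    where
    lem : ∀ κ u → let k = suc κ ; t = suc u ; c₁ = u * suc k ; m = 3 * (t * k) + 3 * t + u ; M = suc m in
      3 * (6 * M + 12 * k * M + suc c₁) + ((63 + 948 * u + 1332 * u * u + 444 * u * u * u) + (918 + 3579 * u + 3996 * u * u + 1332 * u * u * u) * κ + (1224 + 3888 * u + 3996 * u * u + 1332 * u * u * u) * κ * κ + (444 + 1332 * u + 1332 * u * u + 444 * u * u * u) * κ * κ * κ) ≡ 4 * (111 * (t * (t * (t * 1))) * (k * (k * (k * 1))))
    lem = solve-∀

  core-poly : 4 * (6 * M * k + suc c₁) ≤ 3 * (111 * t ^ 3 * k ^ 3)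
  core-poly = slack _ (lem κ u)
    where
    lem : ∀ κ u → let k = suc κ ; t = suc u ; c₁ = u * suc k ; m = 3 * (t * k) + 3 * t + u ; M = suc m in
      4 * (6 * M * k + suc c₁) + ((161 + 823 * u + 999 * u * u + 333 * u * u * u) + (759 + 2753 * u + 2997 * u * u + 999 * u * u * u) * κ + (927 + 2925 * u + 2997 * u * u + 999 * u * u * u) * κ * κ + (333 + 999 * u + 999 * u * u + 333 * u * u * u) * κ * κ * κ) ≡ 3 * (111 * (t * (t * (t * 1))) * (k * (k * (k * 1))))
    lem = solve-∀

  marked-poly : 4 * (6 * M * suc c₃ * k + (c₂ + c₂)) ≤ 3 * (111 * t ^ 3 * k ^ 3)
  marked-poly = slack _ (lem κ u)
    where
    lem : ∀ κ u → let k = suc κ ; t = suc u ; c₁ = u * suc k ; c₂ = c₁ + κ ; c₃ = c₂ + κ ; m = 3 * (t * k) + 3 * t + u ; M = suc m in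
      4 * (6 * M * suc c₃ * k + (c₂ + c₂)) + ((165 + 479 * u + 663 * u * u + 333 * u * u * u) + (415 + 1765 * u + 2349 * u * u + 999 * u * u * u) * κ + (447 + 2061 * u + 2613 * u * u + 999 * u * u * u) * κ * κ + (189 + 783 * u + 927 * u * u + 333 * u * u * u) * κ * κ * κ) ≡ 3 * (111 * (t * (t * (t * 1))) * (k * (k * (k * 1))))
    lem = solve-∀

  cliques-poly : k + 2 * c₃ + L₀ + c₂ ≤ (111 * t ^ 3 * k ^ 3)
  cliques-poly = slack _ (lem κ u)
    where
    lem : ∀ κ u → let k = suc κ ; t = suc u ; c₁ = u * suc k ; c₂ = c₁ + κ ; c₃ = c₂ + κ ; L₀ = c₂ + c₃ * k in
      k + 2 * c₃ + L₀ + c₂ + ((110 + 323 * u + 333 * u * u + 111 * u * u * u) + (324 + 992 * u + 999 * u * u + 333 * u * u * u) * κ + (331 + 998 * u + 999 * u * u + 333 * u * u * u) * κ * κ + (111 + 333 * u + 333 * u * u + 111 * u * u * u) * κ * κ * κ) ≡ (111 * (t * (t * (t * 1))) * (k * (k * (k * 1))))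
    lem = solve-∀

  placement-poly : L₀ * (2 + s₀) + L₀ + c₂ ≤ (111 * t ^ 3 * k ^ 3)
  placement-poly = slack _ (lem κ u)
    where
    lem : ∀ κ u → let k = suc κ ; t = suc u ; c₁ = u * suc k ; c₂ = c₁ + κ ; c₃ = c₂ + κ ; L₀ = c₂ + c₃ * k ; s₀ = c₂ + t * k in
      L₀ * (2 + s₀) + L₀ + c₂ + ((111 + 315 * u + 321 * u * u + 111 * u * u * u) + (320 + 965 * u + 979 * u * u + 333 * u * u * u) * κ + (319 + 975 * u + 988 * u * u + 333 * u * u * u) * κ * κ + (107 + 327 * u + 331 * u * u + 111 * u * u * u) * κ * κ * κ) ≡ (111 * (t * (t * (t * 1))) * (k * (k * (k * 1))))
    lem = solve-∀

  three-poly : 3 + c₂ ≤ (111 * t ^ 3 * k ^ 3)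
  three-poly = slack _ (lem κ u)
    where
    lem : ∀ κ u → let k = suc κ ; t = suc u ; c₁ = u * suc k ; c₂ = c₁ + κ in
      3 + c₂ + ((108 + 331 * u + 333 * u * u + 111 * u * u * u) + (332 + 998 * u + 999 * u * u + 333 * u * u * u) * κ + (333 + 999 * u + 999 * u * u + 333 * u * u * u) * κ * κ + (111 + 333 * u + 333 * u * u + 111 * u * u * u) * κ * κ * κ) ≡ (111 * (t * (t * (t * 1))) * (k * (k * (k * 1))))
    lem = solve-∀

  matching-poly : u * 2 + u * (2 * t) + u + c₂ ≤ (111 * t ^ 3 * k ^ 3)
  matching-poly = slack _ (lem κ u)
    where
    lem : ∀ κ u → let k = suc κ ; t = suc u ; c₁ = u * suc k ; c₂ = c₁ + κ in
      u * 2 + u * (2 * t) + u + c₂ + ((111 + 326 * u + 331 * u * u + 111 * u * u * u) + (332 + 998 * u + 999 * u * u + 333 * u * u * u) * κ + (333 + 999 * u + 999 * u * u + 333 * u * u * u) * κ * κ + (111 + 333 * u + 333 * u * u + 111 * u * u * u) * κ * κ * κ) ≡ (111 * (t * (t * (t * 1))) * (k * (k * (k * 1))))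
    lem = solve-∀

  copies-poly : suc u ≤ (111 * t ^ 3 * k ^ 3)
  copies-poly = slack _ (lem κ u)
    where
    lem : ∀ κ u → let k = suc κ ; t = suc u in
      suc u + ((110 + 332 * u + 333 * u * u + 111 * u * u * u) + (333 + 999 * u + 999 * u * u + 333 * u * u * u) * κ + (333 + 999 * u + 999 * u * u + 333 * u * u * u) * κ * κ + (111 + 333 * u + 333 * u * u + 111 * u * u * u) * κ * κ * κ) ≡ (111 * (t * (t * (t * 1))) * (k * (k * (k * 1))))
    lem = solve-∀

module _ (κ u ℓ n : ℕ) where
  open Constants κ u

  private
    m M D : ℕ
    m = 3 * (t * k) + 3 * t + u
    M = suc m
    D = 127 * t ^ 2 * k ^ 2 + 79 * t ^ 2 * k

  enough : 111 * t ^ 3 * k ^ 3 ≤ n → ℓ * D ≤ n → Enough m ℓ n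
  enough n≥ ℓD≤ = record
    { pages = pages-poly κ u
    ; long = long-poly κ u
    ; 3k≤m = 3k-poly κ u
    ; few-leaves = ≤-trans (≤-reflexive (lem₁ M L₀ ℓ c₂)) (split-bound (slope₁ κ u) (few-leaves-poly κ u))
    -- The target is 2n here: two thirds of n pay for the part linear in `ℓ`, four thirds for the
    -- constant part.
    ; crude = ≤-trans (≤-reflexive (lem₂ M k ℓ (suc c₁))) (*-cancelˡ-≤ 3 (begin
        3 * (ℓ * (6 * M + 12 * k * M + 2 * k) + (6 * M + 12 * k * M + suc c₁))
          ≡⟨ lem₃ ℓ (6 * M + 12 * k * M + 2 * k) (6 * M + 12 * k * M + suc c₁) ⟩
        ℓ * (3 * (6 * M + 12 * k * M + 2 * k)) + 3 * (6 * M + 12 * k * M + suc c₁)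
          ≤⟨ +-mono-≤ (*-monoʳ-≤ ℓ (slope₂ κ u)) (≤-trans (crude-poly κ u) (*-monoʳ-≤ 4 n≥)) ⟩
        ℓ * (2 * D) + 4 * n ≡⟨ lem₄ ℓ D n ⟩
        2 * (ℓ * D) + 4 * n ≤⟨ +-monoˡ-≤ (4 * n) (*-monoʳ-≤ 2 ℓD≤) ⟩
        2 * n + 4 * n ≡⟨ lem₅ n ⟩
        3 * (n + n) ∎))
    ; core = ≤-trans (≤-reflexive (lem₆ M k ℓ (suc c₁))) (split-bound (slope₃ κ u) (core-poly κ u))
    ; marked = ≤-trans (≤-reflexive (lem₇ M k ℓ c₃ c₂)) (split-bound (slope₃ κ u) (marked-poly κ u))
    ; big-cliques = ≤-trans (cliques-poly κ u) n≥
    ; placement = ≤-trans (placement-poly κ u) n≥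
    ; 3≤n = ≤-trans (three-poly κ u) n≥
    ; matching = ≤-trans (matching-poly κ u) n≥
    }
    where
    open ≤-Reasoning
    -- A quarter of n pays for the part linear in `ℓ`, three quarters for the constant part.
    split-bound : ∀ {a c} → 4 * a ≤ D → 4 * c ≤ 3 * (111 * t ^ 3 * k ^ 3) → ℓ * a + c ≤ n
    split-bound {a} {c} a≤ c≤ = *-cancelˡ-≤ 4 (begin
      4 * (ℓ * a + c) ≡⟨ lem ℓ a c ⟩
      ℓ * (4 * a) + 4 * c ≤⟨ +-mono-≤ (≤-trans (*-monoʳ-≤ ℓ a≤) ℓD≤) (≤-trans c≤ (*-monoʳ-≤ 3 n≥)) ⟩
      n + 3 * n ≡⟨⟩
      4 * n ∎)
      where
      lem : ∀ ℓ a c → 4 * (ℓ * a + c) ≡ ℓ * (4 * a) + 4 * c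
      lem = solve-∀
    lem₁ : ∀ M L ℓ c → M * (6 * L + 6 * ℓ) + c ≡ ℓ * (6 * M) + (6 * M * L + c)
    lem₁ = solve-∀
    lem₂ : ∀ M k ℓ c → M * (6 * 1 + 6 * ℓ) + k * (2 * (M * (6 * 1 + 6 * ℓ) + ℓ)) + c
      ≡ ℓ * (6 * M + 12 * k * M + 2 * k) + (6 * M + 12 * k * M + c)
    lem₂ = solve-∀
    lem₃ : ∀ ℓ a c → 3 * (ℓ * a + c) ≡ ℓ * (3 * a) + 3 * c
    lem₃ = solve-∀
    lem₄ : ∀ ℓ d n → ℓ * (2 * d) + 4 * n ≡ 2 * (ℓ * d) + 4 * n
    lem₄ = solve-∀
    lem₅ : ∀ n → 2 * n + 4 * n ≡ 3 * (n + n)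
    lem₅ = solve-∀
    lem₆ : ∀ M k ℓ c → M * (6 * 1 + 6 * ℓ) * k + c ≡ ℓ * (6 * M * k) + (6 * M * k + c)
    lem₆ = solve-∀
    lem₇ : ∀ M k ℓ c₃ c₂ → M * (6 * suc c₃ + 6 * ℓ) * k + c₂ + c₂ ≡ ℓ * (6 * M * k) + (6 * M * suc c₃ * k + (c₂ + c₂))
    lem₇ = solve-∀

-- From colourings to blue graphs

-- Exhaustive search decides whether a blue copy of tB_k exists, so its absence may be assumed
-- constructively. Invariance under pointwise equality replaces function extensionality.
any-function? : ∀ {N} m {Q : (Fin m → Fin N) → Set} → (∀ {f g} → (∀ i → f i ≡ g i) → Q f → Q g) → (∀ f → Dec (Q f)) → Dec (∃ Q)
any-function? zero resp d = case d (λ ()) of λ where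
  (yes q) → yes (_ , q)
  (no ¬q) → no λ { (f , q) → ¬q (resp (λ ()) q) }
any-function? {N} (suc m) {Q} resp d = case any? (λ x → any-function? m {λ f → Q (x ∷ f)} (λ h → resp (λ { zero → refl ; (suc i) → h i })) (λ f → d (x ∷ f))) of λ where
    (yes (x , f , q)) → yes (x ∷ f , q)
    (no ¬q) → no λ { (f , q) → ¬q (f zero , f ∘ suc , resp (λ { zero → refl ; (suc i) → refl }) q) }

module _ (G : Graph) where
  private
    n = ∣V∣ G

    cut : ∀ (X : Sub n) {v w} → Reach G v w → v ∈ X → w ∉ X → ∃[ a ] ∃[ c ] adj G a c ≡ true × a ∈ X × c ∉ X
    cut X reach-here vX wX = ⊥-elim (wX vX)
    cut X {v} (reach-step {w = z} e r) vX wX = case mem? X z of λ where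
      (yes zX) → cut X r zX wX
      (no zX) → v , z , e , vX , zX

  toPG : Connected G → PG n
  toPG conn = record
    { S = λ _ → true
    ; E = adj G
    ; E-sym = λ {x} {y} e → trans (Graph.sym G y x) e
    ; E-irr = λ {x} e → true≢false e (irrefl G x)
    ; E-S = λ _ → refl
    ; conn = λ X {v} {w} _ vX _ wX → cut X (conn v w) vX wX }

  private
    edge : Fin n → Fin n → ℕ
    edge v w = if (toℕ v <ᵇ toℕ w) ∧ adj G v w then 1 else 0

    listsum : ∀ {m} (f : Fin m → ℕ) → ListAction.sum (List.map f (List.allFin m)) ≡ sum f
    listsum f = trans (cong ListAction.sum (map-tabulate id f)) (go f)
      where
      go : ∀ {m} (f : Fin m → ℕ) → ListAction.sum (List.tabulate f) ≡ sum f
      go {zero} f = refl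
      go {suc m} f = cong (f zero +_) (go (f ∘ suc))

    ∣E∣-sum : ∣E∣ G ≡ sum (λ v → sum (edge v))
    ∣E∣-sum = trans (listsum (λ v → ListAction.sum (List.map (edge v) (List.allFin n)))) (sum-cong-≗ (λ v → listsum (edge v)))

    oriented : ∀ {v w} → toℕ v < toℕ w → adj G v w ≡ true → 1 ≤ edge v w
    oriented {v} {w} lt e with toℕ v <ᵇ toℕ w | <⇒<ᵇ lt | adj G v w | e
    ... | true | _ | true | _ = ≤-refl

    adj≤ : ∀ v w → ⟦ adj G v w ⟧ ≤ edge v w + edge w v
    adj≤ v w = ⟦⟧≤ λ e → case <-cmp (toℕ v) (toℕ w) of λ where
      (tri< lt _ _) → ≤-trans (oriented lt e) (m≤m+n _ _)
      (tri≈ _ h _) → ⊥-elim (true≢false (subst (λ z → adj G v z ≡ true) (sym (toℕ-injective h)) e) (irrefl G v))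
      (tri> _ _ lt) → ≤-trans (oriented lt (trans (Graph.sym G w v) e)) (m≤n+m _ _)

  degsum≤ : ∀ c → degsum (toPG c) ≤ 2 * ∣E∣ G
  degsum≤ c = begin
    sum (λ v → count (adj G v)) ≡⟨ sum-cong-≗ (λ v → count-def (adj G v)) ⟩
    sum (λ v → sum (λ w → ⟦ adj G v w ⟧)) ≤⟨ sum-mono (λ v → sum-mono (adj≤ v)) ⟩
    sum (λ v → sum (λ w → edge v w + edge w v)) ≡⟨ sum-cong-≗ (λ v → ∑-distrib-+ (edge v) (λ w → edge w v)) ⟩
    sum (λ v → sum (edge v) + sum (λ w → edge w v)) ≡⟨ ∑-distrib-+ (λ v → sum (edge v)) (λ v → sum (λ w → edge w v)) ⟩
    sum (λ v → sum (edge v)) + sum (λ v → sum (λ w → edge w v)) ≡⟨ cong (sum (λ v → sum (edge v)) +_) (∑-comm (λ v w → edge w v)) ⟩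
    sum (λ v → sum (edge v)) + sum (λ v → sum (edge v)) ≡⟨ cong₂ _+_ (sym ∣E∣-sum) (trans (sym ∣E∣-sum) (sym (+-identityʳ _))) ⟩
    2 * ∣E∣ G ∎
    where open ≤-Reasoning

  arrows : ∀ κ u → Connected G → 111 * suc u ^ 3 * suc κ ^ 3 ≤ n →
    ∣E∣ G * (127 * suc u ^ 2 * suc κ ^ 2 + 79 * suc u ^ 2 * suc κ) ≤ n * (127 * suc u ^ 2 * suc κ ^ 2 + 79 * suc u ^ 2 * suc κ) + n →
    ∀ N → Fin N → n + n + suc u ≤ N + 2 → Arrows N G (tB (suc u) (suc κ))
  arrows κ u conn n≥ e≤ N y₀ room (c , c-sym) = case any-function? (suc u * (3 + κ)) Copy-resp copy? of λ where
      (yes (f , f-inj , blue)) → inj₂ (f , (λ {x} {y} → f-inj x y) , λ v w h → proj₂ (set∈ (dB (f v)) (blue v w h)))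
      (no none) → inj₁ (red (UpperBound.upper-bound host κ u _ ℓ n
          (enough κ u ℓ n n≥ ℓD≤) none room (toPG conn) sparse (≤-reflexive (count-full n))))
    where
    t k ℓ : ℕ
    t = suc u
    k = suc κ
    -- For a tree, with n - 1 edges, truncation gives excess zero.
    ℓ = ∣E∣ G ∸ n
    -- Diagonal values of a colouring are arbitrary, so loops are excluded by hand.
    dB : ∀ x y → Dec (x ≢ y × c x y ≡ false)
    dB x y = ¬? (x ≟F y) ×-dec (c x y Bool.≟ false)
    host : BlueGraph N
    host = record
      { b = λ x → set (dB x)
      ; b-sym = λ {x} {y} h → let ne , e = set∈ (dB x) h in ∈set (dB y) ((λ q → ne (sym q)) , trans (c-sym y x) e)
      ; b-irr = λ {x} h → proj₁ (set∈ (dB x) h) refl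
      ; y₀ = y₀ }
    open BlueGraph host using (b)
    open Host host
    open Books host κ using (all)
    Copy : (Fin (t * (2 + k)) → Fin N) → Set
    Copy f = InjSub f × (∀ x y → tBookAdj t k x y ≡ true → f y ∈ b (f x))
    Copy-resp : ∀ {f g} → (∀ i → f i ≡ g i) → Copy f → Copy g
    Copy-resp h (i , a) = (λ x y e → i x y (trans (h x) (trans e (sym (h y))))) ,
      λ x y e → subst₂ (λ p q → q ∈ b p) (h x) (h y) (a x y e)
    copy? : ∀ f → Dec (Copy f)
    copy? f = all? (λ i → all? λ j → (f i ≟F f j) →-dec (i ≟F j)) ×-dec
              all? (λ x → all? λ y → (tBookAdj t k x y Bool.≟ true) →-dec mem? (b (f x)) (f y))
    sparse : Sparse ℓ (toPG conn)
    sparse = ≤-trans (degsum≤ conn) (*-monoʳ-≤ 2 (≤-trans (m≤n+m∸n (∣E∣ G) n) (≤-reflexive (cong (_+ ℓ) (sym (count-full n))))))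
    ℓD≤ : ℓ * (127 * t ^ 2 * k ^ 2 + 79 * t ^ 2 * k) ≤ n
    ℓD≤ = ≤-trans (≤-reflexive (*-distribʳ-∸ (127 * t ^ 2 * k ^ 2 + 79 * t ^ 2 * k) (∣E∣ G) n))
      (m≤n+o⇒m∸n≤o _ (n * (127 * t ^ 2 * k ^ 2 + 79 * t ^ 2 * k)) e≤)
    red : EmbIn all (toPG conn) → HasCopy (c , c-sym) true G
    red e = φ , (λ {x} {y} → inj refl refl) , λ v w h → case c (φ v) (φ w) Bool.≟ true of λ where
        (yes q) → q
        (no q) → ⊥-elim (Emb.red e {v} {w} refl refl h (∈set (dB (φ v)) ((λ r → true≢false h
           (subst (λ z → adj G v z ≡ false) (inj {v} {w} refl refl r) (irrefl G v))) , ¬true q)))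
      where open Emb e using (φ; inj)

  -- The lower bound

  -- Two red cliques on n - 1 vertices and a red clique on u < t vertices, with blue edges between them.
  module Avoiding (p u κ N : ℕ) (n≡ : n ≡ suc p) (u≤p : u ≤ p) (N≤ : N ≤ p + p + u) (conn : Connected G) where

    part : Fin N → Fin 3
    part x = case toℕ x <? p of λ where
      (yes _) → 0F
      (no _) → case toℕ x <? p + p of λ where
        (yes _) → 1F
        (no _) → 2F

    offset size : Fin 3 → ℕ
    offset 0F = 0
    offset 1F = p
    offset 2F = p + p
    size 2F = u
    size _ = p

    size≤p : ∀ a → size a ≤ p
    size≤p 0F = ≤-refl
    size≤p 1F = ≤-refl
    size≤p 2F = u≤p

    part-range : ∀ x → offset (part x) ≤ toℕ x × toℕ x < offset (part x) + size (part x)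
    part-range x with toℕ x <? p
    ... | yes lt = z≤n , lt
    ... | no ge with toℕ x <? p + p
    ...   | yes lt = ≮⇒≥ ge , lt
    ...   | no ge′ = ≮⇒≥ ge′ , ≤-trans (toℕ<n x) N≤

    within-part : ∀ {m} a (f : Fin m → Fin N) → InjSub f → (∀ i → part (f i) ≡ a) → m ≤ size a
    within-part {m} a f f-inj h = injective⇒≤ {f = g} (λ {i} {j} e → f-inj i j (toℕ-injective
        (∸-cancelʳ-≡ (lo i) (lo j) (fromℕ<-injective _ _ (hi i) (hi j) e))))
      where
      lo : ∀ i → offset a ≤ toℕ (f i)
      lo i = subst (λ z → offset z ≤ toℕ (f i)) (h i) (proj₁ (part-range (f i)))
      hi : ∀ i → toℕ (f i) ∸ offset a < size a
      hi i = subst (_≤ size a) (+-∸-assoc 1 (lo i)) (m≤n+o⇒m∸n≤o (suc (toℕ (f i))) (offset a)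
               (subst (λ z → toℕ (f i) < offset z + size z) (h i) (proj₂ (part-range (f i)))))
      g : Fin m → Fin (size a)
      g i = fromℕ< (hi i)

    colour : Colouring N
    colour = (λ x y → does (part x ≟F part y)) , λ x y → ≟-sym (part x) (part y)

    -- Red edges stay within a part, hence so does the connected graph G, but every part has fewer
    -- than n vertices.
    no-red : ¬ HasCopy colour true G
    no-red (f , f-inj , h) = <⇒≱ (≤-reflexive (sym n≡)) (≤-trans
        (within-part (part (f v₀)) f (λ i j → f-inj) (λ i → sym (same (conn v₀ i)))) (size≤p (part (f v₀))))
      where
      v₀ : Fin n
      v₀ = subst Fin (sym n≡) zero
      same : ∀ {v w} → Reach G v w → part (f v) ≡ part (f w)
      same reach-here = refl
      same (reach-step e r) = trans (does-true (part _ ≟F part _) (h _ _ e)) (same r)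

    one-is-last : ∀ (x y z : Fin 3) → x ≢ y → x ≢ z → y ≢ z → x ≡ 2F ⊎ y ≡ 2F ⊎ z ≡ 2F
    one-is-last 2F _ _ _ _ _ = inj₁ refl
    one-is-last 0F 2F _ _ _ _ = inj₂ (inj₁ refl)
    one-is-last 1F 2F _ _ _ _ = inj₂ (inj₁ refl)
    one-is-last _ _ 2F _ _ _ = inj₂ (inj₂ refl)
    one-is-last 0F 0F _ ne _ _ = ⊥-elim (ne refl)
    one-is-last 1F 1F _ ne _ _ = ⊥-elim (ne refl)
    one-is-last 0F 1F 0F _ ne _ = ⊥-elim (ne refl)
    one-is-last 0F 1F 1F _ _ ne = ⊥-elim (ne refl)
    one-is-last 1F 0F 1F _ ne _ = ⊥-elim (ne refl)
    one-is-last 1F 0F 0F _ _ ne = ⊥-elim (ne refl)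

    -- The spine and the first page of each book form a blue triangle, which meets all three parts.
    -- So t disjoint books need t vertices in the last part, which has at most t - 1.
    no-blue : ¬ HasCopy colour false (tB (suc u) (suc κ))
    no-blue (f , f-inj , h) = <-irrefl refl (within-part 2F (λ a → f (combine a (last a)))
        (λ a a′ e → proj₁ (combine-injective a _ a′ _ (f-inj e))) in-last)
      where
      differ : ∀ a i j → bookAdj (suc κ) i j ≡ true → part (f (combine a i)) ≢ part (f (combine a j))
      differ a i j e q = true≢false (trans (cong (λ z → does (z ≟F part (f (combine a j)))) q) (≟-refl (part (f (combine a j)))))
        (h (combine a i) (combine a j) (trans (cong₂ (λ r s → does (proj₁ r ≟F proj₁ s) ∧ bookAdj (suc κ) (proj₂ r) (proj₂ s))
          (remQuot-combine a i) (remQuot-combine a j)) (trans (cong (_∧ bookAdj (suc κ) i j) (≟-refl a)) e)))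
      triangle : ∀ a → ∃[ i ] part (f (combine a i)) ≡ 2F
      triangle a = case one-is-last (part (f (combine a 0F))) (part (f (combine a 1F))) (part (f (combine a 2F)))
                     (differ a 0F 1F refl) (differ a 0F 2F refl) (differ a 1F 2F refl) of λ where
        (inj₁ e) → 0F , e
        (inj₂ (inj₁ e)) → 1F , e
        (inj₂ (inj₂ e)) → 2F , e
      last : ∀ a → Fin (3 + κ)
      last a = proj₁ (triangle a)
      in-last : ∀ a → part (f (combine a (last a))) ≡ 2F
      in-last a = proj₂ (triangle a)

    not-arrows : ¬ Arrows N G (tB (suc u) (suc κ))
    not-arrows a = [ no-red , no-blue ]′ (a colour)

theorem1p10 : (k t : ℕ) → 0 < k → 0 < t → (G : Graph) →
    111 * t ^ 3 * k ^ 3 ≤ ∣V∣ G →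
    Connected G →
    ∣E∣ G * (127 * t ^ 2 * k ^ 2 + 79 * t ^ 2 * k)
    ≤ ∣V∣ G * (127 * t ^ 2 * k ^ 2 + 79 * t ^ 2 * k) + ∣V∣ G →
    IsRamseyNumber G (tB t k) (2 * ∣V∣ G + t ∸ 2)
theorem1p10 (suc κ) (suc u) _ _ G n≥ conn e≤ = 0<r
    , arrows G κ u conn n≥ e≤ r (fromℕ< 0<r) (≤-reflexive (sym r+2))
    -- From N < r and r + 2 = 2n + t follows N ≤ 2(n - 1) + (t - 1), the total size of the three
    -- parts.
    , λ N _ N<r → Avoiding.not-arrows G p u κ N n≡ (≤-pred (subst (suc u ≤_) n≡ t≤n))
        (+-cancelʳ-≤ 3 _ _ (≤-trans (≤-reflexive (+-suc N 2)) (≤-trans (+-monoˡ-≤ 2 N<r)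
          (≤-reflexive (trans r+2 (trans (cong (λ z → z + z + suc u) n≡) (lem p u))))))) conn
  where
  n r p : ℕ
  n = ∣V∣ G
  r = 2 * n + suc u ∸ 2
  p = pred n
  t≤n : suc u ≤ n
  t≤n = ≤-trans (copies-poly κ u) n≥
  3≤n : 3 ≤ n
  3≤n = ≤-trans (≤-trans (m≤m+n 3 _) (three-poly κ u)) n≥
  n≡ : n ≡ suc p
  n≡ = sym (suc-pred n {{>-nonZero (≤-trans (s≤s z≤n) 3≤n)}})
  r+2 : r + 2 ≡ n + n + suc u
  r+2 = trans (m∸n+n≡m (≤-trans (≤-trans (≤-trans (s≤s (s≤s z≤n)) 3≤n) (m≤m+n n _)) (m≤m+n (2 * n) (suc u))))
          (cong (λ z → n + z + suc u) (+-identityʳ n))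
  0<r : 0 < r
  0<r = +-cancelʳ-≤ 2 1 r (≤-trans 3≤n (≤-trans (≤-trans (m≤m+n n n) (m≤m+n (n + n) (suc u))) (≤-reflexive (sym r+2))))
  lem : ∀ p u → suc p + suc p + suc u ≡ p + p + u + 3
  lem = solve-∀
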